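{- The model repair problem for alternating-time temporal logic (ATL), interpreted over turn-based synchronous game structures, is NP-complete. That is, the following decision problem is NP-complete: given a finite turn-based synchronous game structure $M=(s_0,S,R,L,\sigma)$ and an ATL formula $\eta$, decide whether there exists a total substructure $M'\subseteq M$ with $M',s_0\models\eta$.
   Context: Let $\mathcal{AP}$ be a set of atomic propositions and $\Sigma$ the set of players. A turn-based synchronous game structure is a tuple $M=(s_0,S,R,L,\sigma)$ with $S$ a finite set of states, $s_0\in S$ the initial state, $R\subseteq S\times S$ the transition relation, $L:S\to2^{\mathcal{AP}}$ the labeling function, and $\sigma:S\to\Sigma$ the turn function giving the player whose turn it is to move. It is total if every state has an outgoing transition; the structures $M$ are assumed total. A fullpath is an infinite sequence of states consecutive under $R$; $\pi[i]$ denotes the $i$th state of $\pi$ (from $0$), and $\pi[0,i]$ the finite prefix up to $\pi[i]$. ATL syntax: $\varphi::=\mathsf{true}\mid\mathsf{false}\mid p\mid\neg\varphi\mid\varphi\land\varphi\mid\varphi\lor\varphi\mid\langle\langle A\rangle\rangle\mathsf{X}\varphi\mid\langle\langle A\rangle\rangle[\varphi\,\mathsf{V}\,\varphi]$ with $p\in\mathcal{AP}$, $A\subseteq\Sigma$. A strategy for a player $a\in\Sigma$ is a mapping $f_a:S^*\to S$ assigning to every finite path a successor state (of its last state). For $A\subseteq\Sigma$, an $A$-strategy is $F_A=\{f_a\mid a\in A\}$, one strategy per player in $A$. The set $out(s,F_A)$ consists of all fullpaths $\pi$ with $\pi[0]=s$ such that for all $i\ge0$, if $\sigma(\pi[i])=a\in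 A$ then $\pi[i+1]=f_a(\pi[0,i])$. Semantics: $M,s\models p$ iff $p\in L(s)$; constants and boolean connectives as usual; $M,s\models\langle\langle A\rangle\rangle\mathsf{X}\varphi$ iff there exists $F_A$ such that $M,\pi[1]\models\varphi$ for all $\pi\in out(s,F_A)$; $M,s\models\langle\langle A\rangle\rangle[\varphi\,\mathsf{V}\,\psi]$ iff there exists $F_A$ such that for all $\pi\in out(s,F_A)$ and all $k\ge0$: if $M,\pi[j]\not\models\varphi$ for all $j<k$, then $M,\pi[k]\models\psi$. Substructure: $M'=(s_0',S',R',L',\sigma')\subseteq M=(s_0,S,R,L,\sigma)$ means $S'\subseteq S$, $s_0'=s_0$, $R'\subseteq R$, $L'=L\upharpoonright S'$ and $\sigma'=\sigma\upharpoonright S'$. -}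

module Defs where

open import Data.Bool using (Bool; true; false)
open import Data.Fin using (Fin; toℕ)
open import Data.Fin.Subset using (Subset; _∈_; _⊆_)
open import Data.List using (List; []; _∷_; _++_; _∷ʳ_; [_]; applyUpTo; concatMap; foldr; length; map; replicate)
open import Data.List.Relation.Unary.All using (All)
open import Data.List.Relation.Unary.Linked using (Linked)
open import Data.Maybe using (Maybe; just; nothing)
import Data.Maybe as Maybe
open import Data.Nat using (ℕ; zero; suc; _+_; _*_; _≤_; _<_)
open import Data.Product using (Σ-syntax; ∃-syntax; _×_; _,_)
open import Data.Sum using (_⊎_)
open import Data.Unit using (⊤)
open import Data.Empty using (⊥)
open import Data.Vec using (Vec; lookup; toList; zipWith)
import Data.Vec as Vec
open import Function using (_⇔_)
open import Relation.Binary.PropositionalEquality using (_≡_)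
open import Relation.Nullary using (¬_)

------------------------------------------------------------------------
-- Deterministic multi-tape Turing machines

Word : Set
Word = List Bool

data Symbol (g : ℕ) : Set where
  blank : Symbol g
  bit   : Bool → Symbol g
  aux   : Fin g → Symbol g

data Move : Set where
  left stay right : Move

-- A two-way infinite tape.  `before` lists the cells to the left of the head,
-- nearest first; `after` those to its right, nearest first.  All cells not
-- listed are blank.
record Tape (g : ℕ) : Set where
  constructor tape
  field
    before : List (Symbol g)
    head   : Symbol g
    after  : List (Symbol g)

module _ {g : ℕ} where

  emptyTape : Tape g
  emptyTape = tape [] blank []

  inputTape : Word → Tape g
  inputTape []      = emptyTape
  inputTape (b ∷ x) = tape [] (bit b) (map bit x)

  writeMove : Tape g → Symbol g × Move → Tape g
  writeMove (tape ls _ rs)       (c , stay)  = tape ls c rs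
  writeMove (tape [] _ rs)       (c , left)  = tape [] blank (c ∷ rs)
  writeMove (tape (l ∷ ls) _ rs) (c , left)  = tape ls l (c ∷ rs)
  writeMove (tape ls _ [])       (c , right) = tape (c ∷ ls) blank []
  writeMove (tape ls _ (r ∷ rs)) (c , right) = tape (c ∷ ls) r rs

  leadingBits : List (Symbol g) → Word
  leadingBits (bit b ∷ cs) = b ∷ leadingBits cs
  leadingBits _            = []

  -- The output word starts under the head and ends before the first non-bit.
  outputWord : Tape g → Word
  outputWord (tape _ c rs) = leadingBits (c ∷ rs)

record TuringMachine : Set where
  field
    states extraTapes auxSymbols : ℕ
    start : Fin states
    -- `nothing` means that the machine halts.
    δ : Fin states → Vec (Symbol auxSymbols) (suc extraTapes) →
        Maybe (Fin states × Vec (Symbol auxSymbols × Move) (suc extraTapes))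

  record Config : Set where
    eta-equality
    constructor config
    field
      state : Fin states
      tapes : Vec (Tape auxSymbols) (suc extraTapes)

  initial : Word → Config
  initial x = config start (inputTape x Vec.∷ Vec.replicate extraTapes emptyTape)

  step : Config → Maybe Config
  step (config q ts) = Maybe.map
    (λ (q′ , actions) → config q′ (zipWith writeMove ts actions))
    (δ q (Vec.map Tape.head ts))

  -- A halted configuration is left unchanged.
  run : ℕ → Config → Config
  run zero    c = c
  run (suc t) c with step c
  ... | nothing = c
  ... | just c′ = run t c′

  Halted : Config → Set
  Halted c = step c ≡ nothing

  output : Config → Word
  output (config _ ts) = outputWord (Vec.head ts)

------------------------------------------------------------------------
-- Polynomial time, NP and NP-completeness

-- The polynomial a₀ + a₁ n + a₂ n² + ⋯ given by its coefficients a₀ ∷ a₁ ∷ ⋯.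
Polynomial : Set
Polynomial = List ℕ

eval : Polynomial → ℕ → ℕ
eval p n = foldr (λ a r → a + n * r) 0 p

PolyTime : (Word → Word) → Set
PolyTime f =
  Σ[ T ∈ TuringMachine ] Σ[ p ∈ Polynomial ] ∀ x →
    let open TuringMachine T
        c = run (eval p (length x)) (initial x)
    in Halted c × output c ≡ f x

Language : Set₁
Language = Word → Set

pair : Word → Word → Word
pair x y = concatMap (λ b → true ∷ b ∷ []) x ++ false ∷ y

NP : Language → Set
NP 𝓛 =
  Σ[ V ∈ (Word → Bool) ] PolyTime (λ w → [ V w ]) × Σ[ p ∈ Polynomial ]
    ∀ x → 𝓛 x ⇔ (∃[ y ] length y ≤ eval p (length x) × V (pair x y) ≡ true)

_≤ₚ_ : Language → Language → Set
𝓛 ≤ₚ 𝓛′ = Σ[ f ∈ (Word → Word) ] PolyTime f × ∀ x → 𝓛 x ⇔ 𝓛′ (f x)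

NP-Hard : Language → Set₁
NP-Hard 𝓛 = ∀ 𝓚 → NP 𝓚 → 𝓚 ≤ₚ 𝓛

NP-Complete : Language → Set₁
NP-Complete 𝓛 = NP 𝓛 × NP-Hard 𝓛

------------------------------------------------------------------------
-- Turn-based synchronous game structures

-- The states form a subset S of Fin n, so that a structure and its
-- substructures draw their states from the same set.  The propositions are
-- Fin p and the players Fin k.  Entry s of R is the set of R-successors of s.
-- The values of L and σ outside S are meaningless.
record GameStructure (n p k : ℕ) : Set where
  field
    S  : Subset n
    s₀ : Fin n
    R  : Vec (Subset n) n
    L  : Vec (Subset p) n
    σ  : Vec (Fin k) n

  _⟶_ : Fin n → Fin n → Set
  s ⟶ t = t ∈ lookup R s

  field
    s₀∈S  : s₀ ∈ S
    R⊆S×S : ∀ {s t} → s ⟶ t → s ∈ S × t ∈ S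

  Total : Set
  Total = ∀ {s} → s ∈ S → ∃[ t ] s ⟶ t

  FinitePath : List (Fin n) → Set
  FinitePath w = All (_∈ S) w × Linked _⟶_ w

  FullPath : (ℕ → Fin n) → Set
  FullPath π = ∀ i → π i ⟶ π (suc i)

  record Strategy : Set where
    field
      move  : List (Fin n) → Fin n
      legal : ∀ {w s} → FinitePath (w ∷ʳ s) → s ⟶ move (w ∷ʳ s)

  StrategyFor : Subset k → Set
  StrategyFor A = ∀ a → a ∈ A → Strategy

  record Out {A : Subset k} (s : Fin n) (F : StrategyFor A) (π : ℕ → Fin n) : Set where
    field
      fullPath : FullPath π
      starts   : π 0 ≡ s
      -- applyUpTo π (suc i) is the prefix π[0,i].
      follows  : ∀ i (a∈A : lookup σ (π i) ∈ A) →
                 π (suc i) ≡ Strategy.move (F (lookup σ (π i)) a∈A) (applyUpTo π (suc i))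

record _⊑_ {n p k : ℕ} (M′ M : GameStructure n p k) : Set where
  private
    module M  = GameStructure M
    module M′ = GameStructure M′
  field
    S′⊆S : M′.S ⊆ M.S
    s₀′≡s₀ : M′.s₀ ≡ M.s₀
    R′⊆R : ∀ {s t} → s M′.⟶ t → s M.⟶ t
    L′≡L↾S′ : ∀ {s} → s ∈ M′.S → lookup M′.L s ≡ lookup M.L s
    σ′≡σ↾S′ : ∀ {s} → s ∈ M′.S → lookup M′.σ s ≡ lookup M.σ s

------------------------------------------------------------------------
-- ATL

data Formula (p k : ℕ) : Set where
  tt ff       : Formula p k
  atom        : Fin p → Formula p k
  ¬′_         : Formula p k → Formula p k
  _∧′_ _∨′_   : Formula p k → Formula p k → Formula p k
  ⟪_⟫X_       : Subset k → Formula p k → Formula p k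
  ⟪_⟫[_V_]    : Subset k → Formula p k → Formula p k → Formula p k

_,_⊨_ : ∀ {n p k} → GameStructure n p k → Fin n → Formula p k → Set
M , s ⊨ tt              = ⊤
M , s ⊨ ff              = ⊥
M , s ⊨ atom q          = q ∈ lookup (GameStructure.L M) s
M , s ⊨ (¬′ φ)          = ¬ (M , s ⊨ φ)
M , s ⊨ (φ ∧′ ψ)        = (M , s ⊨ φ) × (M , s ⊨ ψ)
M , s ⊨ (φ ∨′ ψ)        = (M , s ⊨ φ) ⊎ (M , s ⊨ ψ)
M , s ⊨ (⟪ A ⟫X φ)      =
  Σ[ F ∈ StrategyFor A ] ∀ π → Out s F π → M , π 1 ⊨ φ
  where open GameStructure M
M , s ⊨ ⟪ A ⟫[ φ V ψ ]  =
  Σ[ F ∈ StrategyFor A ] ∀ π → Out s F π →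
    ∀ i → (∀ j → j < i → ¬ (M , π j ⊨ φ)) → M , π i ⊨ ψ
  where open GameStructure M

------------------------------------------------------------------------
-- The model repair problem

record Instance : Set where
  field
    {n p k} : ℕ
    M       : GameStructure n p k
    total   : GameStructure.Total M
    η       : Formula p k

Repairable : Instance → Set
Repairable I = ∃[ M′ ] M′ ⊑ M × GameStructure.Total M′ × (M′ , GameStructure.s₀ M ⊨ η)
  where open Instance I

-- Every component below is self-delimiting once n, p and k are known, so the
-- encoding is injective on the data (M , η).  States, propositions and players
-- are written in unary; their numbers n, p and k are also the lengths of the
-- bit vectors for S, for the rows of L and for coalitions.

encodeℕ : ℕ → Word
encodeℕ m = replicate m true ++ [ false ]

encodeFin : ∀ {m} → Fin m → Word
encodeFin i = encodeℕ (toℕ i)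

encodeVec : ∀ {A : Set} {m} → (A → Word) → Vec A m → Word
encodeVec e v = concatMap e (toList v)

encodeSubset : ∀ {m} → Subset m → Word
encodeSubset = toList

encodeStructure : ∀ {n p k} → GameStructure n p k → Word
encodeStructure M =
  encodeSubset S ++ encodeFin s₀ ++ encodeVec encodeSubset R ++
  encodeVec encodeSubset L ++ encodeVec encodeFin σ
  where open GameStructure M

encodeFormula : ∀ {p k} → Formula p k → Word
encodeFormula tt             = false ∷ false ∷ false ∷ []
encodeFormula ff             = false ∷ false ∷ true  ∷ []
encodeFormula (atom q)       = false ∷ true  ∷ false ∷ encodeFin q
encodeFormula (¬′ φ)         = false ∷ true  ∷ true  ∷ encodeFormula φ
encodeFormula (φ ∧′ ψ)       = true  ∷ false ∷ false ∷ encodeFormula φ ++ encodeFormula ψ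
encodeFormula (φ ∨′ ψ)       = true  ∷ false ∷ true  ∷ encodeFormula φ ++ encodeFormula ψ
encodeFormula (⟪ A ⟫X φ)     = true  ∷ true  ∷ false ∷ encodeSubset A ++ encodeFormula φ
encodeFormula ⟪ A ⟫[ φ V ψ ] =
  true ∷ true ∷ true ∷ encodeSubset A ++ encodeFormula φ ++ encodeFormula ψ

encode : Instance → Word
encode I =
  encodeℕ n ++ encodeℕ p ++ encodeℕ k ++ encodeStructure M ++ encodeFormula η
  where open Instance I

ModelRepair : Language
ModelRepair w = Σ[ I ∈ Instance ] encode I ≡ w × Repairable I

-- The proof goes through existential second-order definability.  Call a language
-- definable if membership of x is expressed by a first-order formula about the
-- positions of x, with addition and multiplication, and an existentially
-- quantified table of bits.
--
-- Definable languages are in NP: the table is the certificate, and the formula is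
-- evaluated by nested loops over counters, hence in polynomial time.  Conversely,
-- the computation table of a verifier, with tape cells numbered relative to the
-- heads, is described by such a formula.
--
-- Model repair is definable: the table holds the substructure, the segments of the
-- code that are formulas, and the states that satisfy them, where a release
-- formula is given by the stages of its greatest fixpoint.
--
-- It is hard because the formula of a definable language, instantiated at x, is a
-- propositional formula in the bits of the table.  Bit j becomes ⟪ A ⟫X (atom j) at
-- a state with one removable edge to a state labelled j, for every j.
module Submission where

open import Defs
open import Data.Bool using (Bool; true; false; not; if_then_else_; T; _∧_)
import Data.Bool.Properties as Bool
open import Data.Empty using (⊥; ⊥-elim)
open import Data.Fin using (Fin; zero; suc; toℕ; fromℕ<)
import Data.Fin as Fin
import Data.Fin.Properties as Fin
open import Data.Fin.Subset using (Subset; _∈_; _∉_; ∣_∣)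
open import Data.Fin.Subset.Properties using (_∈?_)
import Data.Fin.Subset.Properties as Subset
open import Data.List using (List; []; _∷_; _++_; _∷ʳ_; [_]; length; map; replicate; downFrom; applyUpTo; drop; reverse; _ʳ++_)
import Data.List.Properties as List
import Data.List.Relation.Unary.All as ListAll
import Data.List.Relation.Unary.All.Properties as ListAll
open import Data.List.Relation.Unary.Linked as Linked using (Linked)
open import Data.Maybe using (Maybe; just; nothing; maybe′)
import Data.Maybe as Maybe
open import Data.Nat hiding (_/_; _%_)
open import Data.Nat.Properties
open import Data.Nat.DivMod using (_/_; _%_; [m+kn]%n≡m%n; m<n⇒m%n≡m; +-distrib-/-∣ʳ; m<n⇒m/n≡0; m*n/n≡m)
open import Data.Nat.Divisibility using (n∣m*n)
open import Data.Product using (Σ-syntax; ∃-syntax; _×_; _,_; proj₁; proj₂; map₁)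
open import Data.Sum using (_⊎_; inj₁; inj₂; [_,_]′)
open import Data.Unit using (⊤)
open import Data.Vec using (Vec; []; _∷_; lookup; tabulate; zipWith)
import Data.Vec as Vec
import Data.Vec.Properties as Vec
open import Data.Vec.Properties.WithK using ([]=-irrelevant)
open import Data.Vec.Relation.Unary.All as All using (All)
open import Function using (_∘_; id; _⇔_; mk⇔; Equivalence; _$_)
open import Data.Nat.Tactic.RingSolver using (solve-∀)
open import Relation.Binary.PropositionalEquality hiding ([_])
open import Relation.Nullary using (¬_; Dec; yes; no; does; proof; Reflects; ofʸ; ofⁿ)
open import Relation.Binary using (tri<; tri≈; tri>)
open import Relation.Nullary.Reflects using (¬-reflects; _×-reflects_)
open import Relation.Nullary.Decidable using (_×-dec_; _⊎-dec_; _→-dec_; ¬?; dec-true; dec-false; decidable-stable)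

-- Structured Turing machine programs

-- Polynomial time is defined by bare multi-tape machines, so each polynomial-time claim would call
-- for a machine of its own. Definability confines machine building to one lemma, `writer-PolyTime`:
-- the verifier of a definable language and the reduction to model repair are both programs of a
-- small language of bounded loops that print a word.
--
-- A table may hold more entries than intended, and soundness has to cope with every table. Where
-- the rules merely force entries into the table, the final conditions are therefore imposed on all
-- entries that could matter, not on one that exists. Completeness supplies a table whose support is
-- polynomially bounded. Entries have five components because satisfaction needs a tag, the two ends
-- of the segment of a subformula, a state and a stage.
--
-- Strategies may use the whole path, so both modalities are reduced to a one-step operator on
-- states; the stages of a release formula decrease, hence `n` of them suffice for `n` states. The
-- argument is constructive, so satisfaction has to be decidable before strategies can be built from
-- it.

Tapes : ℕ → ℕ → Set
Tapes g K = Vec (Tape g) (suc K)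

Heads : ℕ → ℕ → Set
Heads g K = Vec (Symbol g) (suc K)

-- Tapes are addressed by natural numbers instead of `Fin`, so that the same action makes sense for
-- every number of tapes; `nth` returns a default beyond the last one.
Action : ℕ → Set
Action g = ℕ → Symbol g × Move

nth : {A : Set} {n : ℕ} → A → Vec A n → ℕ → A
nth d []       _       = d
nth d (a ∷ _)  zero    = a
nth d (_ ∷ as) (suc j) = nth d as j

infixr 5 _⨾_

data Prog (g K : ℕ) : Set where
  act   : (Heads g K → Action g) → Prog g K
  _⨾_   : Prog g K → Prog g K → Prog g K
  while : (Heads g K → Bool) → Prog g K → Prog g K

module _ {g K : ℕ} where

  tapeAt : Tapes g K → ℕ → Tape g
  tapeAt = nth emptyTape

  headAt : Heads g K → ℕ → Symbol g
  headAt = nth blank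

  heads : Tapes g K → Heads g K
  heads = Vec.map Tape.head

  headAt-heads : (ts : Tapes g K) (j : ℕ) → headAt (heads ts) j ≡ Tape.head (tapeAt ts j)
  headAt-heads ts = go ts
    where
    go : ∀ {n} (ts : Vec (Tape g) n) j → nth blank (Vec.map Tape.head ts) j ≡ Tape.head (nth emptyTape ts j)
    go []       _       = refl
    go (_ ∷ _)  zero    = refl
    go (_ ∷ ts) (suc j) = go ts j

  actions : Action g → Vec (Symbol g × Move) (suc K)
  actions f = tabulate (f ∘ toℕ)

  perform : Tapes g K → Action g → Tapes g K
  perform ts f = zipWith writeMove ts (actions f)

  tapeAt-perform : (ts : Tapes g K) (f : Action g) {j : ℕ} → j ≤ K →
    tapeAt (perform ts f) j ≡ writeMove (tapeAt ts j) (f j)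
  tapeAt-perform ts f j≤K = go ts f (s≤s j≤K)
    where
    go : ∀ {n} (ts : Vec (Tape g) n) (f : Action g) {j} → j < n →
      nth emptyTape (zipWith writeMove ts (tabulate (f ∘ toℕ))) j ≡ writeMove (nth emptyTape ts j) (f j)
    go (_ ∷ _)  f {zero}  _         = refl
    go (_ ∷ ts) f {suc j} (s≤s j<n) = go ts (f ∘ suc) j<n

  idle : Heads g K → Action g
  idle h j = headAt h j , stay

  perform-idle : (ts : Tapes g K) → perform ts (idle (heads ts)) ≡ ts
  perform-idle ts = go ts
    where
    go : ∀ {n} (ts : Vec (Tape g) n) →
      zipWith writeMove ts (tabulate {n = n} (λ i → nth blank (Vec.map Tape.head ts) (toℕ i) , stay)) ≡ ts
    go []       = refl
    go (t ∷ ts) = cong (t ∷_) (go ts)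

  -- The control state `nothing` of a loop is its test.
  Control : Prog g K → Set
  Control (act _)     = ⊤
  Control (P ⨾ Q)     = Control P ⊎ Control Q
  Control (while _ P) = Maybe (Control P)

  entry : (P : Prog g K) → Control P
  entry (act _)     = _
  entry (P ⨾ _)     = inj₁ (entry P)
  entry (while _ _) = nothing

  -- The next control state is `nothing` when the program is left.
  next : (P : Prog g K) → Control P → Heads g K → Maybe (Control P) × Action g
  next (act f)     _        h = nothing , f h
  next (P ⨾ Q)     (inj₁ q) h = map₁ (just ∘ maybe′ inj₁ (inj₂ (entry Q))) (next P q h)
  next (P ⨾ Q)     (inj₂ q) h = map₁ (Maybe.map inj₂) (next Q q h)
  next (while b P) nothing  h = (if b h then just (just (entry P)) else nothing) , idle h
  next (while b P) (just q) h = map₁ just (next P q h)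

  -- Paths start in an arbitrary control state, because the embeddings of `P` into `P ⨾ Q` and
  -- `while b P` go by induction over what remains of a path. Leaving the program performs its last
  -- action and counts as a step.
  data Path (P : Prog g K) : Control P → Tapes g K → ℕ → Tapes g K → Set where
    leave : ∀ {q ts f} → next P q (heads ts) ≡ (nothing , f) → Path P q ts 1 (perform ts f)
    move  : ∀ {q q′ ts ts′ t f} → next P q (heads ts) ≡ (just q′ , f) →
            Path P q′ (perform ts f) t ts′ → Path P q ts (suc t) ts′

  infix 4 _⊢_↝[_]_

  _⊢_↝[_]_ : Prog g K → Tapes g K → ℕ → Tapes g K → Set
  P ⊢ ts ↝[ t ] ts′ = Path P (entry P) ts t ts′

  private
    variable
      t u : ℕ
      P Q : Prog g K
      ts ts′ ts″ : Tapes g K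

  act-path : (f : Heads g K → Action g) (ts : Tapes g K) → act f ⊢ ts ↝[ 1 ] perform ts (f (heads ts))
  act-path f ts = leave refl

  ⨾-path : P ⊢ ts ↝[ t ] ts′ → Q ⊢ ts′ ↝[ u ] ts″ → (P ⨾ Q) ⊢ ts ↝[ t + u ] ts″
  ⨾-path {P = P} {Q = Q} p q = first p q
    where
    second : ∀ {c ts t ts′} → Path Q c ts t ts′ → Path (P ⨾ Q) (inj₂ c) ts t ts′
    second (leave e)  = leave (cong (map₁ (Maybe.map inj₂)) e)
    second (move e p) = move (cong (map₁ (Maybe.map inj₂)) e) (second p)
    first : ∀ {c ts t ts′ u ts″} → Path P c ts t ts′ → Q ⊢ ts′ ↝[ u ] ts″ → Path (P ⨾ Q) (inj₁ c) ts (t + u) ts″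
    first (leave e)  q = move (cong (map₁ (just ∘ maybe′ inj₁ (inj₂ (entry Q)))) e) (second q)
    first (move e p) q = move (cong (map₁ (just ∘ maybe′ inj₁ (inj₂ (entry Q)))) e) (first p q)

  while-stop : {b : Heads g K → Bool} → b (heads ts) ≡ false → while b P ⊢ ts ↝[ 1 ] ts
  while-stop {ts = ts} {P = P} {b = b} eq = subst (while b P ⊢ ts ↝[ 1 ]_) (perform-idle ts)
    (leave (cong (λ c → (if c then just (just (entry P)) else nothing) , idle (heads ts)) eq))

  while-go : {b : Heads g K → Bool} → b (heads ts) ≡ true → P ⊢ ts ↝[ t ] ts′ →
    while b P ⊢ ts′ ↝[ u ] ts″ → while b P ⊢ ts ↝[ suc (t + u) ] ts″
  while-go {ts = ts} {P = P} {b = b} eq p q = move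
    (cong (λ c → (if c then just (just (entry P)) else nothing) , idle (heads ts)) eq)
    (subst (λ ts → Path (while b P) (just (entry P)) ts _ _) (sym (perform-idle ts)) (body p))
    where
    body : ∀ {c ts t} → Path P c ts t _ → Path (while b P) (just c) ts (t + _) _
    body (leave e)  = move (cong (map₁ just) e) q
    body (move e p) = move (cong (map₁ just) e) (body p)

  size : Prog g K → ℕ
  size (act _)     = 1
  size (P ⨾ Q)     = size P + size Q
  size (while _ P) = suc (size P)

  number : (P : Prog g K) → Control P → Fin (size P)
  number (act _)     _        = zero
  number (P ⨾ Q)     (inj₁ q) = number P q Fin.↑ˡ size Q
  number (P ⨾ Q)     (inj₂ q) = size P Fin.↑ʳ number Q q
  number (while _ P) nothing  = zero
  number (while _ P) (just q) = suc (number P q)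

  control : (P : Prog g K) → Fin (size P) → Control P
  control (act _)     _       = _
  control (P ⨾ Q)     i       = [ inj₁ ∘ control P , inj₂ ∘ control Q ]′ (Fin.splitAt (size P) i)
  control (while _ P) zero    = nothing
  control (while _ P) (suc i) = just (control P i)

  -- Machine states are numbers. For the simulation it is enough that the control states form a
  -- retract of them.
  control-number : (P : Prog g K) (q : Control P) → control P (number P q) ≡ q
  control-number (act _)     _        = refl
  control-number (P ⨾ Q)     (inj₁ q)
    rewrite Fin.splitAt-↑ˡ (size P) (number P q) (size Q) = cong inj₁ (control-number P q)
  control-number (P ⨾ Q)     (inj₂ q)
    rewrite Fin.splitAt-↑ʳ (size P) (size Q) (number Q q) = cong inj₂ (control-number Q q)
  control-number (while _ P) nothing  = refl
  control-number (while _ P) (just q) = cong just (control-number P q)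

  -- State zero is the halting state.
  machine : Prog g K → TuringMachine
  machine P = record
    { states = suc (size P) ; extraTapes = K ; auxSymbols = g
    ; start = suc (number P (entry P)) ; δ = δ }
    where
    δ : Fin (suc (size P)) → Heads g K → Maybe (Fin (suc (size P)) × Vec (Symbol g × Move) (suc K))
    δ zero    _ = nothing
    δ (suc i) h = let (r , f) = next P (control P i) h in just (maybe′ (suc ∘ number P) zero r , actions f)

  module _ (P : Prog g K) where
    open TuringMachine (machine P)

    run-halted : ∀ t {ts} → run t (config zero ts) ≡ config zero ts
    run-halted zero    = refl
    run-halted (suc t) = refl

    step-control : ∀ q {r f ts} → next P q (heads ts) ≡ (r , f) →
      step (config (suc (number P q)) ts) ≡ just (config (maybe′ (suc ∘ number P) zero r) (perform ts f))
    step-control q e rewrite control-number P q | e = refl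

    run-step : ∀ t {c c′} → step c ≡ just c′ → run (suc t) c ≡ run t c′
    run-step t {c} e with step c
    run-step t refl | _ = refl

    run-path : ∀ {q ts t ts′} n → Path P q ts t ts′ → run (t + n) (config (suc (number P q)) ts) ≡ config zero ts′
    run-path {q} n (leave e)          = trans (run-step n (step-control q e)) (run-halted n)
    run-path {q} n (move {t = t} e p) = trans (run-step (t + n) (step-control q e)) (run-path n p)

    -- A halted configuration is left unchanged, so an upper bound on the length of the path serves
    -- as well as the length itself.
    run-program : ∀ {x t ts′ n} → t ≤ n → P ⊢ inputTape x ∷ Vec.replicate K emptyTape ↝[ t ] ts′ →
      run n (initial x) ≡ config zero ts′
    run-program t≤n p = subst (λ n → run n _ ≡ _) (m+[n∸m]≡n t≤n) (run-path _ p)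

-- Counter programs

bit-at : Word → ℕ → Bool
bit-at []      _       = false
bit-at (b ∷ _) zero    = b
bit-at (_ ∷ x) (suc j) = bit-at x j

cell : Word → ℕ → Symbol 1
cell x       zero          = aux zero
cell []      (suc _)       = blank
cell (b ∷ _) (suc zero)    = bit b
cell (_ ∷ x) (suc (suc j)) = cell x (suc j)

symbolAt : {g : ℕ} → List (Symbol g) → ℕ → Symbol g
symbolAt []       _       = blank
symbolAt (c ∷ _)  zero    = c
symbolAt (_ ∷ cs) (suc j) = symbolAt cs j

-- The value v is the distance of the head from a marker, which the word x follows.
-- The tape of counter 0 holds the input in this way; on the others x is empty.
record Counter (x : Word) (v : ℕ) (tp : Tape 1) : Set where
  constructor counter
  field
    before-cells : Tape.before tp ≡ map (cell x) (downFrom v)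
    head-cell    : Tape.head tp ≡ cell x v
    after-cells  : ∀ j → symbolAt (Tape.after tp) j ≡ cell x (suc v + j)

-- The list to the right of the head may or may not spell out trailing blanks. As `Counter` compares
-- it only through `symbolAt`, the end of the list is no special case.
counter-right : ∀ {x v tp} → Counter x v tp → Counter x (suc v) (writeMove tp (Tape.head tp , right))
counter-right {x} {v} {tape ls c []} (counter p q r) = counter (cong₂ _∷_ q p)
  (trans (r 0) (cong (cell x) (+-identityʳ (suc v))))
  (λ j → trans (r (suc j)) (cong (cell x) (+-suc (suc v) j)))
counter-right {x} {v} {tape ls c (d ∷ rs)} (counter p q r) = counter (cong₂ _∷_ q p)
  (trans (r 0) (cong (cell x) (+-identityʳ (suc v))))
  (λ j → trans (r (suc j)) (cong (cell x) (+-suc (suc v) j)))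

counter-left : ∀ {x v tp} → Counter x (suc v) tp → Counter x v (writeMove tp (Tape.head tp , left))
counter-left {x} {v} {tape (l ∷ ls) c rs} (counter p q r) =
  counter (List.∷-injectiveʳ p) (List.∷-injectiveˡ p) after
  where
  after : ∀ j → symbolAt (c ∷ rs) j ≡ cell x (suc v + j)
  after zero    = trans q (cong (cell x) (sym (+-identityʳ (suc v))))
  after (suc j) = trans (r j) (cong (cell x) (sym (+-suc (suc v) j)))

-- The registers form a stack, listed from the top; register r is the one with
-- r others below it.  Registers beyond the top contain zero.
register : List ℕ → ℕ → ℕ
register []      _ = 0
register (a ∷ σ) r = if r ≡ᵇ length σ then a else register σ r

data Cmd : Set where
  inc dec load : ℕ → Cmd
  emit         : Bool → Cmd
  _⨾_          : Cmd → Cmd → Cmd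
  while        : ℕ → Cmd → Cmd

-- Tape 0 receives the output, tape suc r is register r.

isMark isOne : Symbol 1 → Bool
isMark (aux _) = true
isMark _       = false
isOne (bit b) = b
isOne _       = false

moving : {K : ℕ} → Heads 1 K → (ℕ → Move) → Action 1
moving h m j = headAt h j , m j

only : ℕ → Move → ℕ → Move
only r m j = if j ≡ᵇ suc r then m else stay

emitting : {K : ℕ} → Heads 1 K → Bool → Action 1
emitting h b zero    = bit b , right
emitting h b (suc j) = headAt h (suc j) , stay

-- `dec` does not move a head that is on its marker, and so computes the truncated predecessor.
-- `load` scans tape 1, which is both register 0 and the copy of the input, and counts up by the bit
-- found there.
compile : (K : ℕ) → Cmd → Prog 1 K
compile K (inc r)     = act λ h → moving h (only r right)
compile K (dec r)     = act λ h → moving h (only r (if isMark (headAt h (suc r)) then stay else left))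
compile K (load r)    = act λ h → moving h (only r (if isOne (headAt h 1) then right else stay))
compile K (emit b)    = act λ h → emitting h b
compile K (c ⨾ d)     = compile K c ⨾ compile K d
compile K (while r c) = while (λ h → not (isMark (headAt h (suc r)))) (compile K c)

Fits : ℕ → Cmd → Set
Fits K (inc r)     = r < K
Fits K (dec r)     = r < K
Fits K (load r)    = r < K
Fits K (emit _)    = ⊤
Fits K (c ⨾ d)     = Fits K c × Fits K d
Fits K (while r c) = r < K × Fits K c

registers : Cmd → ℕ
registers (inc r)     = suc r
registers (dec r)     = suc r
registers (load r)    = suc r
registers (emit _)    = 0
registers (c ⨾ d)     = registers c ⊔ registers d
registers (while r c) = suc r ⊔ registers c

fits : ∀ {K} c → registers c ≤ K → Fits K c
fits (inc r)     b = b
fits (dec r)     b = b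
fits (load r)    b = b
fits (emit _)    b = _
fits (c ⨾ d)     b = fits c (m⊔n≤o⇒m≤o (registers c) _ b) , fits d (m⊔n≤o⇒n≤o (registers c) _ b)
fits (while r c) b = m⊔n≤o⇒m≤o (suc r) (registers c) b , fits c (m⊔n≤o⇒n≤o (suc r) _ b)

content : Word → ℕ → Word
content x zero    = x
content x (suc _) = []

-- The output goes to the tape from which the input has been erased: the `z` blanks are the erased
-- cells. The word `out` is reversed, since the cells before a head are listed nearest first.
record Rep (K : ℕ) (x : Word) (z : ℕ) (σ : List ℕ) (out : Word) (ts : Tapes 1 K) : Set where
  constructor rep
  field
    outputTape : tapeAt ts 0 ≡ tape (map bit out ++ replicate z blank) blank []
    counters   : ∀ r → r < K → Counter (content x r) (register σ r) (tapeAt ts (suc r))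

-- The number of tapes and the earlier output are arbitrary, which makes executions composable. The
-- bound on `w` is kept because rewinding the output tape at the end takes time proportional to the
-- output.
record Exec (x : Word) (c : Cmd) (σ : List ℕ) (t : ℕ) (σ′ : List ℕ) (w : Word) : Set where
  constructor exec
  field
    path : ∀ {K z out ts} → 1 ≤ K → Fits K c → Rep K x z σ out ts →
      ∃[ u ] ∃[ ts′ ] u ≤ t × (compile K c ⊢ ts ↝[ u ] ts′) × Rep K x z σ′ (w ʳ++ out) ts′
    word-bound : length w ≤ t

-- Register r contains v in σ, and σ′ is σ with v replaced by v′.
data Upd : List ℕ → ℕ → ℕ → ℕ → List ℕ → Set where
  at  : ∀ {r v v′ σ} → r ≡ length σ → Upd (v ∷ σ) r v v′ (v′ ∷ σ)
  pop : ∀ {a r v v′ σ σ′} → Upd σ r v v′ σ′ → Upd (a ∷ σ) r v v′ (a ∷ σ′)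

top : ∀ {v v′ σ} → Upd (v ∷ σ) (length σ) v v′ (v′ ∷ σ)
top = at refl

≡ᵇ-refl : ∀ n → (n ≡ᵇ n) ≡ true
≡ᵇ-refl zero    = refl
≡ᵇ-refl (suc n) = ≡ᵇ-refl n

≢⇒≡ᵇ : ∀ m n → m ≢ n → (m ≡ᵇ n) ≡ false
≢⇒≡ᵇ zero    zero    m≢n = ⊥-elim (m≢n refl)
≢⇒≡ᵇ zero    (suc n) m≢n = refl
≢⇒≡ᵇ (suc m) zero    m≢n = refl
≢⇒≡ᵇ (suc m) (suc n) m≢n = ≢⇒≡ᵇ m n (m≢n ∘ cong suc)

upd-length : ∀ {σ r v v′ σ′} → Upd σ r v v′ σ′ → length σ ≡ length σ′
upd-length (at _)   = refl
upd-length (pop u) = cong suc (upd-length u)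

upd-< : ∀ {σ r v v′ σ′} → Upd σ r v v′ σ′ → r < length σ
upd-< (at refl)   = ≤-refl
upd-< (pop u) = m<n⇒m<1+n (upd-< u)

upd-old : ∀ {σ r v v′ σ′} → Upd σ r v v′ σ′ → register σ r ≡ v
upd-old {v ∷ σ} (at refl) rewrite ≡ᵇ-refl (length σ) = refl
upd-old {a ∷ σ} {r} (pop u) rewrite ≢⇒≡ᵇ r (length σ) (<⇒≢ (upd-< u)) = upd-old u

upd-sym : ∀ {σ r v v′ σ′} → Upd σ r v v′ σ′ → Upd σ′ r v′ v σ
upd-sym (at e)   = at e
upd-sym (pop u) = pop (upd-sym u)

upd-new : ∀ {σ r v v′ σ′} → Upd σ r v v′ σ′ → register σ′ r ≡ v′
upd-new u = upd-old (upd-sym u)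

upd-other : ∀ {σ r v v′ σ′} → Upd σ r v v′ σ′ → ∀ r′ → r′ ≢ r → register σ′ r′ ≡ register σ r′
upd-other {v ∷ σ} (at refl)   r′ r′≢r rewrite ≢⇒≡ᵇ r′ (length σ) r′≢r = refl
upd-other {a ∷ σ} (pop {σ′ = σ′} u) r′ r′≢r rewrite upd-length u with r′ ≡ᵇ length σ′
... | true  = refl
... | false = upd-other u r′ r′≢r

-- By the default value zero, allocating a register and releasing one that is zero cost no machine
-- step.
register-push : ∀ σ r → register (0 ∷ σ) r ≡ register σ r
register-push σ r with r ≡ᵇ length σ in eq
... | false = refl
... | true  = sym (beyond σ r (≤-reflexive (sym (≡ᵇ⇒≡ r (length σ) (subst T (sym eq) _)))))
  where
  beyond : ∀ σ r → length σ ≤ r → register σ r ≡ 0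
  beyond []      r _ = refl
  beyond (a ∷ σ) r l rewrite ≢⇒≡ᵇ r (length σ) (≢-sym (<⇒≢ l)) = beyond σ r (≤-trans (n≤1+n _) l)

module _ {x : Word} where

  private
    variable
      σ σ′ σ″ : List ℕ
      t u v v′ r : ℕ
      c d : Cmd
      w w′ : Word

  rep-register : ∀ {K z out ts} → (∀ r → register σ r ≡ register σ′ r) → Rep K x z σ out ts → Rep K x z σ′ out ts
  rep-register eq (rep o k) = rep o λ r r<K → subst (λ v → Counter _ v _) (eq r) (k r r<K)

  exec-weaken : t ≤ u → Exec x c σ t σ′ w → Exec x c σ u σ′ w
  exec-weaken t≤u (exec p b) = exec
    (λ K f R → let (n , ts′ , l , π , R′) = p K f R in n , ts′ , ≤-trans l t≤u , π , R′) (≤-trans b t≤u)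

  exec-end : σ′ ≡ σ″ → Exec x c σ t σ′ w → Exec x c σ t σ″ w
  exec-end refl e = e

  exec-word : w ≡ w′ → Exec x c σ t σ′ w → Exec x c σ t σ′ w′
  exec-word refl e = e

  exec-pushed : Exec x c (0 ∷ σ) t σ′ w → Exec x c σ t σ′ w
  exec-pushed {σ = σ} (exec p b) = exec (λ K f R → p K f (rep-register (sym ∘ register-push σ) R)) b

  exec-popped : Exec x c σ t (0 ∷ σ′) w → Exec x c σ t σ′ w
  exec-popped {σ′ = σ′} (exec p b) = exec
    (λ K f R → let (n , ts′ , l , π , R′) = p K f R in n , ts′ , l , π , rep-register (register-push σ′) R′) b

  exec-⨾ : Exec x c σ t σ′ w → Exec x d σ′ u σ″ w′ → Exec x (c ⨾ d) σ (t + u) σ″ (w ++ w′)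
  exec-⨾ {w = w} {w′ = w′} (exec p b) (exec q b′) = exec
    (λ K (f , f′) R →
      let (_ , _ , l , π , R′)   = p K f R
          (_ , _ , l′ , π′ , R″) = q K f′ R′
      in _ , _ , +-mono-≤ l l′ , ⨾-path π π′ , subst (λ o → Rep _ _ _ _ o _) (sym (List.++-ʳ++ w)) R″)
    (≤-trans (≤-reflexive (List.length-++ w)) (+-mono-≤ b b′))

  head-mark : ∀ {K z out} {ts : Tapes 1 K} → Rep K x z σ out ts → r < K →
    isMark (headAt (heads ts) (suc r)) ≡ (register σ r ≡ᵇ 0)
  head-mark {σ} {r} {ts = ts} (rep _ k) r<K =
    trans (cong isMark (trans (headAt-heads ts (suc r)) (Counter.head-cell (k r r<K)))) (mark (content x r) (register σ r))
    where
    mark : ∀ y v → isMark (cell y v) ≡ (v ≡ᵇ 0)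
    mark y       zero          = refl
    mark []      (suc v)       = refl
    mark (b ∷ y) (suc zero)    = refl
    mark (b ∷ y) (suc (suc v)) = mark y (suc v)

  exec-while-stop : register σ r ≡ 0 → Exec x (while r c) σ 1 σ []
  exec-while-stop eq = exec
    (λ { K (r<K , f) R → 1 , _ , ≤-refl , while-stop (trans (cong not (head-mark R r<K)) (cong (λ v → not (v ≡ᵇ 0)) eq)) , R }) z≤n

  exec-while-go : register σ r ≡ suc v → Exec x c σ t σ′ w → Exec x (while r c) σ′ u σ″ w′ →
    Exec x (while r c) σ (suc (t + u)) σ″ (w ++ w′)
  exec-while-go {w = w} {w′ = w′} eq (exec p b) (exec q b′) = exec
    (λ { K (r<K , f) R →
      let (_ , _ , l , π , R′)   = p K f R
          (_ , _ , l′ , π′ , R″) = q K (r<K , f) R′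
      in _ , _ , s≤s (+-mono-≤ l l′)
       , while-go (trans (cong not (head-mark R r<K)) (cong (λ v → not (v ≡ᵇ 0)) eq)) π π′
       , subst (λ o → Rep _ _ _ _ o _) (sym (List.++-ʳ++ w)) R″ })
    (≤-trans (≤-reflexive (List.length-++ w)) (m≤n⇒m≤1+n (+-mono-≤ b b′)))

  moving-rep : ∀ {K z out ts m} → Upd σ r v v′ σ′ → 
    (∀ {tp} → Counter (content x r) v tp → Counter (content x r) v′ (writeMove tp (Tape.head tp , m))) →
    Rep K x z σ out ts → Rep K x z σ′ out (perform ts (moving (heads ts) (only r m)))
  moving-rep {σ} {r} {v} {v′} {σ′} {K} {ts = ts} {m} U f (rep o k) = rep
    (trans (tapeAt-perform ts (moving (heads ts) (only r m)) z≤n) (trans (cong (λ c → writeMove (tapeAt ts 0) (c , stay)) (headAt-heads ts 0)) o))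
    counters
    where
    eq : ∀ j → j < K → tapeAt (perform ts (moving (heads ts) (only r m))) (suc j) ≡
         writeMove (tapeAt ts (suc j)) (Tape.head (tapeAt ts (suc j)) , only r m (suc j))
    eq j j<K = trans (tapeAt-perform ts (moving (heads ts) (only r m)) j<K)
      (cong (λ c → writeMove (tapeAt ts (suc j)) (c , only r m (suc j))) (headAt-heads ts (suc j)))
    counters : ∀ j → j < K → Counter (content x j) (register σ′ j) (tapeAt (perform ts (moving (heads ts) (only r m))) (suc j))
    counters j j<K with j ≟ r
    ... | yes refl rewrite eq j j<K | ≡ᵇ-refl j | upd-new U = f (subst (λ v → Counter _ v _) (upd-old U) (k j j<K))
    ... | no  j≢r  rewrite eq j j<K | ≢⇒≡ᵇ j r j≢r | upd-other U j j≢r = k j j<K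

  exec-inc : Upd σ r v (suc v) σ′ → Exec x (inc r) σ 1 σ′ []
  exec-inc U = exec (λ K f R → 1 , _ , ≤-refl , act-path _ _ , moving-rep U counter-right R) z≤n

  exec-dec : Upd σ r v (pred v) σ′ → Exec x (dec r) σ 1 σ′ []
  exec-dec {r = r} {v = v} U = exec (λ {K} {ts = ts} K≥1 f R → 1 , _ , ≤-refl , act-path _ _ ,
    moving-rep U (counter-dec v (trans (head-mark R f) (cong (_≡ᵇ 0) (upd-old U)))) R) z≤n
    where
    counter-dec : ∀ v {h y tp} → isMark h ≡ (v ≡ᵇ 0) → Counter y v tp →
      Counter y (pred v) (writeMove tp (Tape.head tp , (if isMark h then stay else left)))
    counter-dec zero    e k rewrite e = k
    counter-dec (suc v) e k rewrite e = counter-left k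

  exec-load : register σ 0 ≡ suc u → Upd σ r v (if bit-at x u then suc v else v) σ′ → Exec x (load r) σ 1 σ′ []
  exec-load {σ} {u} {r} {v} e U = exec (λ {K} {ts = ts} K≥1 f R → 1 , _ , ≤-refl , act-path _ _ ,
    moving-rep U (counter-load (bit-at x u) (trans (cong isOne (trans (headAt-heads ts 1)
      (trans (Counter.head-cell (Rep.counters R 0 K≥1)) (cong (cell x) e)))) (one x u))) R) z≤n
    where
    one : ∀ x u → isOne (cell x (suc u)) ≡ bit-at x u
    one []      u       = refl
    one (b ∷ x) zero    = refl
    one (b ∷ x) (suc u) = one x u
    counter-load : ∀ b {b′ v y tp} → b′ ≡ b → Counter y v tp →
      Counter y (if b then suc v else v) (writeMove tp (Tape.head tp , (if b′ then right else stay)))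
    counter-load false refl k = k
    counter-load true  refl k = counter-right k

  exec-emit : ∀ b → Exec x (emit b) σ 1 σ [ b ]
  exec-emit {σ} b = exec (λ {K} {z} {out} {ts} K≥1 f (rep o k) → 1 , _ , ≤-refl , act-path _ _ , rep
    (trans (tapeAt-perform ts (emitting (heads ts) b) z≤n) (cong (λ tp → writeMove tp (bit b , right)) o))
    (λ r r<K → subst (Counter (content x r) (register σ r))
      (sym (trans (tapeAt-perform ts (emitting (heads ts) b) r<K)
        (cong (λ c → writeMove (tapeAt ts (suc r)) (c , stay)) (headAt-heads ts (suc r))))) (k r r<K))) ≤-refl

iter : {A : Set} → ℕ → (A → A) → A → A
iter zero    f a = a
iter (suc n) f a = iter n f (f a)

iterWord : {A : Set} → ℕ → (A → A) → (A → Word) → A → Word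
iterWord zero    f w a = []
iterWord (suc n) f w a = w a ++ iterWord n f w (f a)

iterWord-[] : {A : Set} (n : ℕ) {f : A → A} {a : A} → iterWord n f (λ _ → []) a ≡ []
iterWord-[] zero    = refl
iterWord-[] (suc n) = iterWord-[] n

iter-+ : ∀ n b a → iter n (b +_) a ≡ n * b + a
iter-+ zero    b a = refl
iter-+ (suc n) b a = trans (iter-+ n b (b + a)) (trans (sym (+-assoc (n * b) b a)) (cong (_+ a) (+-comm (n * b) b)))

iter-suc : ∀ n a → iter n suc a ≡ n + a
iter-suc n a = trans (iter-+ n 1 a) (cong (_+ a) (*-identityʳ n))

iter-pred : ∀ n a → iter n pred a ≡ a ∸ n
iter-pred zero    a       = refl
iter-pred (suc n) zero    = trans (iter-pred n 0) (0∸n≡0 n)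
iter-pred (suc n) (suc a) = iter-pred n a

iter-suc₂ : ∀ n a b → iter n (λ (a , b) → suc a , suc b) (a , b) ≡ (n + a , n + b)
iter-suc₂ zero    a b = refl
iter-suc₂ (suc n) a b = trans (iter-suc₂ n (suc a) (suc b)) (cong₂ _,_ (+-suc n a) (+-suc n b))

drain : ℕ → ℕ → Cmd
drain s t = while s (dec s ⨾ inc t)

-- Reading a register destroys it, so the scratch register `u` takes a second copy from which `r` is
-- restored.
add : ℕ → ℕ → ℕ → Cmd
add r t u = while r (dec r ⨾ (inc t ⨾ inc u)) ⨾ drain u r

clear : ℕ → Cmd
clear s = while s (dec s)

-- With `u` empty, `s` becomes `1 ∸ s`. This negates a truth value, and applied twice it turns any
-- count into a truth value.
flip : ℕ → ℕ → Cmd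
flip s u = inc u ⨾ (while s (dec s ⨾ dec u) ⨾ drain u s)

module _ {x : Word} where

  -- The loop register counts down while `f` transforms the rest of the state. `Inv` ties the state
  -- to the number of remaining rounds; this is how an index that counts up is known to stay below
  -- the bound of the loop.
  exec-loop : {A : Set} {r : ℕ} {c : Cmd} {t : ℕ} (I : ℕ → A → List ℕ) (f : A → A) (w : A → Word) (Inv : ℕ → A → Set) →
    (∀ i a → register (I i a) r ≡ i) →
    (∀ i a → Inv (suc i) a → Inv i (f a) × Exec x c (I (suc i) a) t (I i (f a)) (w a)) →
    ∀ v a → Inv v a → Exec x (while r c) (I v a) (suc (v * suc t)) (I 0 (iter v f a)) (iterWord v f w a)
  exec-loop I f w Inv reg body zero a inv = exec-while-stop (reg 0 a)
  exec-loop {t = t} I f w Inv reg body (suc v) a inv =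
    let (inv′ , e) = body v a inv
    in exec-weaken (≤-reflexive (cong suc (+-suc t (v * suc t))))
         (exec-while-go (reg (suc v) a) e (exec-loop I f w Inv reg body v (f a) inv′))

  exec-silent-loop : {A : Set} {r : ℕ} {c : Cmd} {t : ℕ} (I : ℕ → A → List ℕ) (f : A → A) (Inv : ℕ → A → Set) →
    (∀ i a → register (I i a) r ≡ i) →
    (∀ i a → Inv (suc i) a → Inv i (f a) × Exec x c (I (suc i) a) t (I i (f a)) []) →
    ∀ v a → Inv v a → Exec x (while r c) (I v a) (suc (v * suc t)) (I 0 (iter v f a)) []
  exec-silent-loop I f Inv reg body v a inv =
    exec-word (iterWord-[] v) (exec-loop I f (λ _ → []) Inv reg body v a inv)

  exec-drain : ∀ {s t} (S : ℕ → ℕ → List ℕ) → (∀ {i i′ j} → Upd (S i j) s i i′ (S i′ j)) →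
    (∀ {i j j′} → Upd (S i j) t j j′ (S i j′)) → ∀ v a → Exec x (drain s t) (S v a) (suc (v * 3)) (S 0 (v + a)) []
  exec-drain S U V′ v a = exec-end (cong (λ n → S 0 n) (iter-suc v a))
    (exec-silent-loop S suc (λ _ _ → ⊤) (λ i a → upd-old (U {i} {i} {a})) (λ i a _ → _ , exec-⨾ (exec-dec U) (exec-inc V′)) v a _)

  exec-add : ∀ {r t u} (S : ℕ → ℕ → ℕ → List ℕ) → (∀ {i i′ j k} → Upd (S i j k) r i i′ (S i′ j k)) →
    (∀ {i j j′ k} → Upd (S i j k) t j j′ (S i j′ k)) → (∀ {i j k k′} → Upd (S i j k) u k k′ (S i j k′)) →
    ∀ v a → Exec x (add r t u) (S v a 0) (suc (v * 4) + suc (v * 3)) (S v (v + a) 0) []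
  exec-add S U V′ W v a = exec-⨾
    (exec-end (cong (λ (j , k) → S 0 j k) (trans (iter-suc₂ v a 0) (cong (v + a ,_) (+-identityʳ v))))
      (exec-silent-loop (λ i (j , k) → S i j k) _ (λ _ _ → ⊤) (λ i (j , k) → upd-old (U {i} {i} {j} {k}))
        (λ i a _ → _ , exec-⨾ (exec-dec U) (exec-⨾ (exec-inc V′) (exec-inc W))) v (a , 0) _))
    (exec-end (cong (λ n → S n (v + a) 0) (+-identityʳ v)) (exec-drain (λ k i → S i (v + a) k) W U v 0))

  exec-clear : ∀ {s} (S : ℕ → List ℕ) → (∀ {i i′} → Upd (S i) s i i′ (S i′)) →
    ∀ v → Exec x (clear s) (S v) (suc (v * 2)) (S 0) []
  exec-clear S U v = exec-silent-loop {A = ⊤} (λ i _ → S i) _ (λ _ _ → ⊤) (λ i _ → upd-old (U {i} {i}))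
    (λ i _ _ → _ , exec-dec U) v _ _

  exec-minus : ∀ {s u} (S : ℕ → ℕ → List ℕ) → (∀ {i i′ j} → Upd (S i j) s i i′ (S i′ j)) →
    (∀ {i j j′} → Upd (S i j) u j j′ (S i j′)) →
    ∀ v a → Exec x (while s (dec s ⨾ dec u)) (S v a) (suc (v * 3)) (S 0 (a ∸ v)) []
  exec-minus S U V′ v a = exec-end (cong (λ n → S 0 n) (iter-pred v a))
    (exec-silent-loop S pred (λ _ _ → ⊤) (λ i a → upd-old (U {i} {i} {a})) (λ i a _ → _ , exec-⨾ (exec-dec U) (exec-dec V′)) v a _)

  exec-flip : ∀ {s u} (S : ℕ → ℕ → List ℕ) → (∀ {i i′ j} → Upd (S i j) s i i′ (S i′ j)) →
    (∀ {i j j′} → Upd (S i j) u j j′ (S i j′)) → ∀ v → Exec x (flip s u) (S v 0) (v * 3 + 6) (S (1 ∸ v) 0) []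
  exec-flip S U V′ v = exec-end (cong (λ n → S n 0) (+-identityʳ (1 ∸ v))) $ exec-weaken bound
    (exec-⨾ (exec-inc V′) (exec-⨾ (exec-minus S U V′ v 1) (exec-drain (λ j i → S i j) V′ U (1 ∸ v) 0)))
    where
    bound : 1 + (suc (v * 3) + suc ((1 ∸ v) * 3)) ≤ v * 3 + 6
    bound = ≤-trans (s≤s (s≤s (+-monoʳ-≤ (v * 3) (s≤s (*-monoˡ-≤ 3 (m∸n≤m 1 v))))))
      (≤-reflexive (trans (cong (2 +_) (+-comm (v * 3) 4)) (+-comm 6 (v * 3))))

-- Arithmetic terms, conditions and word-producing programs

data Tm : Set where
  var     : ℕ → Tm
  lit     : ℕ → Tm
  _⊕_ _⊗_ : Tm → Tm → Tm

infixl 11 _⊗_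
infixl 10 _⊕_

-- Variables are de Bruijn levels, so that weakening is the identity: the
-- variable bound at depth d is var d.  A variable that is out of scope is zero.
get : ∀ {d} → Vec ℕ d → ℕ → ℕ
get []              j = 0
get (_∷_ {n} a ρ) j = if j ≡ᵇ n then a else get ρ j

-- A `flag` stands for an unknown bit of the table. Machines evaluate it as false; the reduction
-- turns it into a propositional variable.
data Cond (d : ℕ) : Set where
  bit flag  : Tm → Cond d
  _≺_       : Tm → Tm → Cond d
  neg       : Cond d → Cond d
  both      : Cond d → Cond d → Cond d
  each      : Tm → Cond (suc d) → Cond d

data Writer (d : ℕ) : Set where
  nil  : Writer d
  put  : Bool → Writer d
  _⊹_  : Writer d → Writer d → Writer d
  for  : Tm → Writer (suc d) → Writer d
  when : Cond d → Writer d → Writer d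

infixr 5 _⊹_

value : ∀ {d} → Tm → Vec ℕ d → ℕ
value (var j) ρ = get ρ j
value (lit c) ρ = c
value (a ⊕ b) ρ = value a ρ + value b ρ
value (a ⊗ b) ρ = value a ρ * value b ρ

allFrom : (ℕ → Bool) → ℕ → ℕ → Bool
allFrom f i zero    = true
allFrom f i (suc n) = f i ∧ allFrom f (suc i) n

wordFrom : (ℕ → Word) → ℕ → ℕ → Word
wordFrom f i zero    = []
wordFrom f i (suc n) = f i ++ wordFrom f (suc i) n

holds : ∀ {d} → Cond d → (ℕ → Bool) → (ℕ → Bool) → Vec ℕ d → Bool
holds (bit a)    x y ρ = x (value a ρ)
holds (flag a)   x y ρ = y (value a ρ)
holds (a ≺ b)    x y ρ = value a ρ <ᵇ value b ρ
holds (neg φ)    x y ρ = not (holds φ x y ρ)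
holds (both φ ψ) x y ρ = holds φ x y ρ ∧ holds ψ x y ρ
holds (each a φ) x y ρ = allFrom (λ i → holds φ x y (i ∷ ρ)) 0 (value a ρ)

noFlags : ℕ → Bool
noFlags _ = false

produce : ∀ {d} → Writer d → Word → Vec ℕ d → Word
produce nil        x ρ = []
produce (put b)    x ρ = b ∷ []
produce (V′ ⊹ W)    x ρ = produce V′ x ρ ++ produce W x ρ
produce (for a W)  x ρ = wordFrom (λ i → produce W x (i ∷ ρ)) 0 (value a ρ)
produce (when φ W) x ρ = if holds φ (bit-at x) noFlags ρ then produce W x ρ else []

-- E lists the registers of the variables; h is the first free register, which
-- receives the result.

evalTm : ∀ {d} → Tm → Vec ℕ d → ℕ → Cmd
evalTm (var j) E h = add (get E j) h (suc h)
evalTm (lit c) E h = counts c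
  where
  counts : ℕ → Cmd
  counts zero    = dec h
  counts (suc c) = counts c ⨾ inc h
evalTm (a ⊕ b) E h = evalTm a E h ⨾ (evalTm b E (suc h) ⨾ drain (suc h) h)
evalTm (a ⊗ b) E h =
  evalTm a E (1 + h) ⨾ (evalTm b E (2 + h) ⨾
  (while (1 + h) (dec (1 + h) ⨾ add (2 + h) h (3 + h)) ⨾ clear (2 + h)))

evalCond : ∀ {d} → Cond d → Vec ℕ d → ℕ → Cmd
-- Cell 0 of the input tape is the marker, so bit `v` is scanned at distance `suc v`; hence `inc 0`.
-- Clearing register 0 afterwards brings the head back to the marker.
evalCond (bit a)    E h = evalTm a E h ⨾ (inc 0 ⨾ (drain h 0 ⨾ (load h ⨾ clear 0)))
evalCond (flag a)   E h = dec h
evalCond (a ≺ b)    E h = evalTm b E h ⨾ (evalTm a E (1 + h) ⨾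
  (while (1 + h) (dec (1 + h) ⨾ dec h) ⨾ (flip h (1 + h) ⨾ flip h (1 + h))))
evalCond (neg φ)    E h = evalCond φ E h ⨾ flip h (1 + h)
-- A loop whose body first decrements a truth value runs at most once. It takes the place of a
-- conditional.
evalCond (both φ ψ) E h =
  evalCond φ E h ⨾ (while h (dec h ⨾ evalCond ψ E (1 + h)) ⨾ drain (1 + h) h)
-- Register `h` counts the indices at which `φ` fails, `1 + h` the rounds left, and `2 + h` is the
-- bound variable. The last `flip` yields one exactly when nothing failed.
evalCond (each a φ) E h =
  evalTm a E (1 + h) ⨾
  (while (1 + h) (dec (1 + h) ⨾ (evalCond φ ((2 + h) ∷ E) (3 + h) ⨾
     (flip (3 + h) (4 + h) ⨾ (drain (3 + h) h ⨾ inc (2 + h))))) ⨾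
  (clear (2 + h) ⨾ flip h (1 + h)))

execWriter : ∀ {d} → Writer d → Vec ℕ d → ℕ → Cmd
execWriter nil        E h = dec h
execWriter (put b)    E h = emit b
execWriter (V′ ⊹ W)    E h = execWriter V′ E h ⨾ execWriter W E h
execWriter (for a W)  E h =
  evalTm a E h ⨾
  (while h (dec h ⨾ (execWriter W ((1 + h) ∷ E) (2 + h) ⨾ inc (1 + h))) ⨾ clear (1 + h))
execWriter (when φ W) E h = evalCond φ E h ⨾ while h (dec h ⨾ execWriter W E (1 + h))

-- Here B bounds the values of the variables.
boundTm timeTm : Tm → ℕ → ℕ
boundTm (var j) B = B
boundTm (lit c) B = c
boundTm (a ⊕ b) B = boundTm a B + boundTm b B
boundTm (a ⊗ b) B = boundTm a B * boundTm b B

timeTm (var j) B = suc (B * 4) + suc (B * 3)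
timeTm (lit c) B = suc c
timeTm (a ⊕ b) B = timeTm a B + (timeTm b B + suc (boundTm b B * 3))
timeTm (a ⊗ b) B = timeTm a B + (timeTm b B +
  (suc (boundTm a B * suc (1 + (suc (boundTm b B * 4) + suc (boundTm b B * 3)))) + suc (boundTm b B * 2)))

timeCond : ∀ {d} → Cond d → ℕ → ℕ
timeCond (bit a)    B = timeTm a B + (1 + (suc (boundTm a B * 3) + (1 + suc (suc (boundTm a B) * 2))))
timeCond (flag a)   B = 1
timeCond (a ≺ b)    B = timeTm b B + (timeTm a B + (suc (boundTm a B * 3) + ((boundTm b B * 3 + 6) + 9)))
timeCond (neg φ)    B = timeCond φ B + 9
timeCond (both φ ψ) B = timeCond φ B + (suc (suc (1 + timeCond ψ B)+ 1) + 4)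
timeCond (each a φ) B = timeTm a B + (suc (boundTm a B * suc (1 + (timeCond φ (B + boundTm a B) + (9 + (4 + 1))))) +
  (suc (boundTm a B * 2) + (boundTm a B * 3 + 6)))

timeWriter : ∀ {d} → Writer d → ℕ → ℕ
timeWriter nil        B = 1
timeWriter (put b)    B = 1
timeWriter (V′ ⊹ W)    B = timeWriter V′ B + timeWriter W B
timeWriter (for a W)  B = timeTm a B + (suc (boundTm a B * suc (1 + (timeWriter W (B + boundTm a B) + 1))) + suc (boundTm a B * 2))
timeWriter (when φ W) B = timeCond φ B + suc (suc (1 + timeWriter W B) + 1)

b2n : Bool → ℕ
b2n false = 0
b2n true  = 1

record Holds (σ : List ℕ) (r v : ℕ) : Set where
  constructor split
  field
    {above below} : List ℕ
    stack    : σ ≡ above ++ v ∷ below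
    position : r ≡ length below

holds-push : ∀ {σ r v a} → Holds σ r v → Holds (a ∷ σ) r v
holds-push {a = a} (split {above} refl q) = split {above = a ∷ above} refl q

upd-++ : ∀ {v v′} above {below} → Upd (above ++ v ∷ below) (length below) v v′ (above ++ v′ ∷ below)
upd-++ []          = top
upd-++ (a ∷ above) = pop (upd-++ above)

-- The input pointer, register 0, is zero between reads. It can thus represent every variable that
-- is out of scope, and `vars` holds for all `j`.
record Env {d : ℕ} (E ρ : Vec ℕ d) (σ : List ℕ) : Set where
  constructor env
  field
    bottom : Holds σ 0 0
    vars   : ∀ j → Holds σ (get E j) (get ρ j)

env-push : ∀ {d} {E ρ : Vec ℕ d} {σ a} → Env E ρ σ → Env E ρ (a ∷ σ)
env-push (env b v) = env (holds-push b) (holds-push ∘ v)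

env-bind : ∀ {d} {E ρ : Vec ℕ d} {σ a} → Env E ρ σ → Env (length σ ∷ E) (a ∷ ρ) (a ∷ σ)
env-bind {d} {E} {ρ} {σ} {a} (env b v) = env (holds-push b) vars
  where
  vars : ∀ j → Holds (a ∷ σ) (get (length σ ∷ E) j) (get (a ∷ ρ) j)
  vars j with j ≡ᵇ d
  ... | true  = split {above = []} refl refl
  ... | false = holds-push (v j)

Bounded : ∀ {d} → Vec ℕ d → ℕ → Set
Bounded ρ B = ∀ j → get ρ j ≤ B

bounded-bind : ∀ {d} {ρ : Vec ℕ d} {B i v} → Bounded ρ B → i ≤ v → Bounded (i ∷ ρ) (B + v)
bounded-bind {d} {B = B} {v = v} b i≤v j with j ≡ᵇ d
... | true  = ≤-trans i≤v (m≤n+m v B)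
... | false = ≤-trans (b j) (m≤m+n B v)

value≤ : ∀ {d} a {ρ : Vec ℕ d} {B} → Bounded ρ B → value a ρ ≤ boundTm a B
value≤ (var j) b = b j
value≤ (lit c) b = ≤-refl
value≤ (a ⊕ c) b = +-mono-≤ (value≤ a b) (value≤ c b)
value≤ (a ⊗ c) b = *-mono-≤ (value≤ a b) (value≤ c b)

loop≤ : ∀ {v V′} k → v ≤ V′ → suc (v * k) ≤ suc (V′ * k)
loop≤ k l = s≤s (*-monoˡ-≤ k l)

module _ {x : Word} where

  -- The first free register is the height of the stack, so writing the result there amounts to
  -- pushing it.
  exec-Tm : ∀ {d} a {E ρ : Vec ℕ d} {σ B} → Env E ρ σ → Bounded ρ B →
    Exec x (evalTm a E (length σ)) σ (timeTm a B) (value a ρ ∷ σ) []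
  exec-Tm (var j) {E} {ρ} {σ} (env _ vars) b with get E j | get ρ j | vars j | b j
  ... | _ | v | split {above} {below} refl refl | v≤B = exec-weaken (+-mono-≤ (loop≤ 4 v≤B) (loop≤ 3 v≤B))
    (exec-pushed (exec-pushed (exec-popped (exec-end (cong (λ n → 0 ∷ n ∷ above ++ v ∷ below) (+-identityʳ v))
      (exec-add (λ i j k → k ∷ j ∷ above ++ i ∷ below) (pop (pop (upd-++ above)))
        (pop (at (upd-length (upd-++ above)))) (at (cong suc (upd-length (upd-++ above)))) v 0)))))
  exec-Tm (lit c) {σ = σ} e b = exec-pushed (counts c)
    where
    counts : ∀ c → Exec x (evalTm (lit c) (Vec.[]) (length σ)) (0 ∷ σ) (suc c) (c ∷ σ) []
    counts zero    = exec-dec top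
    counts (suc c) = exec-weaken (≤-reflexive (+-comm (suc c) 1)) (exec-⨾ (counts c) (exec-inc top))
  exec-Tm (a ⊕ c) {ρ = ρ} {σ} e b = exec-⨾ (exec-Tm a e b) (exec-⨾ (exec-Tm c (env-push e) b)
    (exec-popped (exec-end (cong (λ n → 0 ∷ n ∷ σ) (+-comm (value c ρ) (value a ρ)))
      (exec-weaken (loop≤ 3 (value≤ c b)) (exec-drain (λ i j → i ∷ j ∷ σ) top (pop top) (value c ρ) (value a ρ))))))
  exec-Tm (a ⊗ c) {ρ = ρ} {σ} e b = exec-pushed (exec-⨾ (exec-Tm a (env-push e) b) (exec-⨾ (exec-Tm c (env-push (env-push e)) b)
    (exec-⨾ (exec-end (cong (λ n → value c ρ ∷ 0 ∷ n ∷ σ) (trans (iter-+ (value a ρ) (value c ρ) 0) (+-identityʳ _)))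
      (exec-weaken (loop≤ _ (value≤ a b)) (exec-silent-loop (λ i j → value c ρ ∷ i ∷ j ∷ σ) (value c ρ +_) (λ _ _ → ⊤)
        (λ i j → upd-old (pop {a = value c ρ} (top {v = i} {v′ = i} {j ∷ σ})))
        (λ i j _ → _ , exec-⨾ (exec-dec (pop top)) (exec-weaken (+-mono-≤ (loop≤ 4 (value≤ c b)) (loop≤ 3 (value≤ c b)))
          (exec-pushed (exec-popped (exec-add (λ v j k → k ∷ v ∷ i ∷ j ∷ σ) (pop top) (pop (pop (pop top))) top (value c ρ) j)))))
        (value a ρ) 0 _)))
      (exec-popped (exec-popped (exec-weaken (loop≤ 2 (value≤ c b))
        (exec-clear (λ i → i ∷ 0 ∷ _ ∷ σ) top (value c ρ))))))))

  exec-flip-bool : ∀ {σ} b → Exec x (flip (length σ) (suc (length σ))) (b2n b ∷ σ) 9 (b2n (not b) ∷ σ) []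
  exec-flip-bool {σ} false = exec-weaken (m≤m+n 6 3) (exec-pushed (exec-popped (exec-flip (λ i k → k ∷ i ∷ σ) (pop top) top 0)))
  exec-flip-bool {σ} true  = exec-pushed (exec-popped (exec-flip (λ i k → k ∷ i ∷ σ) (pop top) top 1))

  private
    b2n≤1 : ∀ b → b2n b ≤ 1
    b2n≤1 false = z≤n
    b2n≤1 true  = ≤-refl

    positive : ℕ → Bool
    positive v = 0 <ᵇ v

    flip-bool : ∀ v → 1 ∸ v ≡ b2n (not (positive v))
    flip-bool zero    = refl
    flip-bool (suc v) = 0∸n≡0 v

    positive-∸ : ∀ a b → positive (b ∸ a) ≡ (a <ᵇ b)
    positive-∸ zero    b       = refl
    positive-∸ (suc a) zero    = refl
    positive-∸ (suc a) (suc b) = positive-∸ a b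

    not-not : ∀ b → not (not b) ≡ b
    not-not false = refl
    not-not true  = refl

    -- One round of the loop for `each`: next index, number of failures so far.
    round : (ℕ → Bool) → ℕ × ℕ → ℕ × ℕ
    round f (i , k) = suc i , b2n (not (f i)) + k

    failures : (f : ℕ → Bool) → ∀ n i k → not (positive (proj₂ (iter n (round f) (i , k)))) ≡ not (positive k) ∧ allFrom f i n
    failures f zero    i zero    = refl
    failures f zero    i (suc k) = refl
    failures f (suc n) i k with f i
    ... | true  = failures f n (suc i) k
    ... | false = trans (failures f n (suc i) (suc k)) (∧-false k)
      where
      ∧-false : ∀ k → false ≡ not (positive k) ∧ false
      ∧-false zero    = refl
      ∧-false (suc _) = refl

    index : (f : ℕ → Bool) → ∀ n i k → proj₁ (iter n (round f) (i , k)) ≡ n + i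
    index f zero    i k = refl
    index f (suc n) i k = trans (index f n (suc i) _) (+-suc n i)

    failures≤ : (f : ℕ → Bool) → ∀ n i k → proj₂ (iter n (round f) (i , k)) ≤ n + k
    failures≤ f zero    i k = ≤-refl
    failures≤ f (suc n) i k = ≤-trans (failures≤ f n (suc i) _)
      (≤-trans (+-monoʳ-≤ n (+-monoˡ-≤ k (b2n≤1 (not (f i))))) (≤-reflexive (+-suc n k)))

    iterWord-from : (f : ℕ → Word) → ∀ n i → iterWord n suc f i ≡ wordFrom f i n
    iterWord-from f zero    i = refl
    iterWord-from f (suc n) i = cong (f i ++_) (iterWord-from f n (suc i))

  exec-Cond : ∀ {d} φ {E ρ : Vec ℕ d} {σ B} → Env E ρ σ → Bounded ρ B →
    Exec x (evalCond φ E (length σ)) σ (timeCond φ B) (b2n (holds φ (bit-at x) noFlags ρ) ∷ σ) []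
  exec-Cond (bit a) {E} {ρ} {σ} e@(env (split {above} {[]} refl _) _) b =
    exec-⨾ (exec-Tm a e b) (exec-⨾ (exec-inc (U {j = 0}))
      (exec-⨾ (exec-weaken (loop≤ 3 v≤) (exec-drain (λ i j → i ∷ above ++ j ∷ []) (at (upd-length (upd-++ above))) U v 1))
      (exec-⨾ (exec-load (trans (upd-new (U {j = 0})) (+-comm v 1)) (at (upd-length (upd-++ above))))
        (exec-weaken (loop≤ 2 (≤-trans (≤-reflexive (+-comm v 1)) (s≤s v≤)))
          (exec-end (cong (λ n → n ∷ _) (load-bit (bit-at x v)))
            (exec-clear (λ j → (if bit-at x v then 1 else 0) ∷ above ++ j ∷ []) U (v + 1)))))))
    where
    v  = value a ρ
    v≤ = value≤ a b
    U : ∀ {i j j′} → Upd (i ∷ above ++ j ∷ []) 0 j j′ (i ∷ above ++ j′ ∷ [])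
    U = pop (upd-++ above)
    load-bit : ∀ b → (if b then 1 else 0) ≡ b2n b
    load-bit false = refl
    load-bit true  = refl
  exec-Cond (flag a) e b = exec-pushed (exec-dec top)
  exec-Cond (a ≺ c) {ρ = ρ} {σ} {B} e b = exec-⨾ (exec-Tm c e b) (exec-⨾ (exec-Tm a (env-push e) b)
    (exec-⨾ (exec-popped (exec-weaken (loop≤ 3 (value≤ a b)) (exec-minus (λ i j → i ∷ j ∷ σ) top (pop top) (value a ρ) (value c ρ))))
    (exec-⨾ (exec-end (cong (λ n → n ∷ σ) (flip-bool w)) (exec-weaken
       (+-monoˡ-≤ 6 (*-monoˡ-≤ 3 (≤-trans (m∸n≤m (value c ρ) (value a ρ)) (value≤ c b))))
       (exec-pushed (exec-popped (exec-flip (λ i k → k ∷ i ∷ σ) (pop top) top w)))))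
      (exec-end (cong (λ c → b2n c ∷ σ) (trans (not-not (positive w)) (positive-∸ (value a ρ) (value c ρ))))
        (exec-flip-bool (not (positive w)))))))
    where w = value c ρ ∸ value a ρ
  exec-Cond (neg φ) e b = exec-⨾ (exec-Cond φ e b) (exec-flip-bool _)
  exec-Cond (both φ ψ) {ρ = ρ} {σ} {B} e b = exec-⨾ (exec-Cond φ e b) (second (holds φ (bit-at x) noFlags ρ))
    where
    p = holds ψ (bit-at x) noFlags ρ
    second : ∀ c → Exec x (while (length σ) (dec (length σ) ⨾ evalCond ψ _ (suc (length σ))) ⨾ drain (suc (length σ)) (length σ))
      (b2n c ∷ σ) (suc (suc (1 + timeCond ψ B) + 1) + 4) (b2n (c ∧ p) ∷ σ) []
    second false = exec-weaken (+-mono-≤ {1} {suc (suc (1 + timeCond ψ B) + 1)} {1} {4} (s≤s z≤n) (s≤s z≤n))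
      (exec-⨾ (exec-while-stop (upd-old (top {v = 0} {v′ = 0} {σ})))
      (exec-pushed (exec-popped (exec-drain (λ i j → i ∷ j ∷ σ) top (pop top) 0 0))))
    second true  = exec-weaken (+-monoʳ-≤ (suc (suc (1 + timeCond ψ B) + 1)) (loop≤ 3 (b2n≤1 p)))
      (exec-⨾ (exec-weaken (s≤s (n≤1+n _)) (exec-while-go (upd-old (top {v = 1} {v′ = 1} {σ})) (exec-⨾ (exec-dec top) (exec-Cond ψ (env-push e) b))
         (exec-while-stop (upd-old (pop {a = b2n p} (top {v = 0} {v′ = 0} {σ}))))))
       (exec-popped (exec-end (cong (λ n → 0 ∷ n ∷ σ) (+-identityʳ (b2n p)))
         (exec-drain (λ i j → i ∷ j ∷ σ) top (pop top) (b2n p) 0))))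
  exec-Cond (each a φ) {ρ = ρ} {σ} {B} e b = exec-pushed (exec-⨾ (exec-Tm a (env-push e) b)
    (exec-⨾ (exec-pushed (exec-weaken (loop≤ _ v≤) (exec-silent-loop (λ c (i , k) → i ∷ c ∷ k ∷ σ) (round f) (λ c (i , _) → c + i ≡ v)
        (λ c (i , k) → upd-old (pop {a = i} (top {v = c} {v′ = c} {k ∷ σ}))) body v (0 , 0) (+-identityʳ v))))
    (exec-⨾ (exec-popped (exec-popped (exec-weaken (loop≤ 2 (≤-trans (≤-reflexive (trans (index f v 0 0) (+-identityʳ v))) v≤))
        (exec-clear (λ i → i ∷ 0 ∷ proj₂ end ∷ σ) top (proj₁ end)))))
      (exec-end (cong (λ n → n ∷ σ) (trans (flip-bool (proj₂ end)) (cong b2n (failures f v 0 0))))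
        (exec-weaken (+-monoˡ-≤ 6 (*-monoˡ-≤ 3 (≤-trans (≤-trans (failures≤ f v 0 0) (≤-reflexive (+-identityʳ v))) v≤)))
          (exec-pushed (exec-popped (exec-flip (λ i k → k ∷ i ∷ σ) (pop top) top (proj₂ end)))))))))
    where
    v   = value a ρ
    v≤  = value≤ a b
    f   = λ i → holds φ (bit-at x) noFlags (i ∷ ρ)
    end = iter v (round f) (0 , 0)
    body : ∀ c ((i , k) : ℕ × ℕ) → suc c + i ≡ v → c + suc i ≡ v × Exec x _ (i ∷ suc c ∷ k ∷ σ) _ (suc i ∷ c ∷ b2n (not (f i)) + k ∷ σ) []
    body c (i , k) inv = trans (+-suc c i) inv , exec-⨾ (exec-dec (pop top))
      (exec-⨾ (exec-Cond φ (env-bind (env-push (env-push e)))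
        (bounded-bind {ρ = ρ} b (≤-trans (≤-trans (m≤n+m i (suc c)) (≤-reflexive inv)) v≤)))
      (exec-⨾ (exec-flip-bool (f i)) (exec-⨾
        (exec-popped (exec-weaken (loop≤ 3 (b2n≤1 (not (f i)))) (exec-drain (λ p q → p ∷ i ∷ c ∷ q ∷ σ) top (pop (pop (pop top))) (b2n (not (f i))) k)))
        (exec-inc top))))

  exec-Writer : ∀ {d} W {E ρ : Vec ℕ d} {σ B} → Env E ρ σ → Bounded ρ B →
    Exec x (execWriter W E (length σ)) σ (timeWriter W B) σ (produce W x ρ)
  exec-Writer nil        e b = exec-pushed (exec-popped (exec-dec top))
  exec-Writer (put c)    e b = exec-emit c
  exec-Writer (V′ ⊹ W)    e b = exec-⨾ (exec-Writer V′ e b) (exec-Writer W e b)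
  exec-Writer (for a W) {ρ = ρ} {σ} {B} e b = exec-⨾ (exec-Tm a e b)
    (exec-word (List.++-identityʳ _) (exec-⨾
      (exec-pushed (exec-word (iterWord-from f v 0) (exec-weaken (loop≤ _ v≤) (exec-loop (λ c i → i ∷ c ∷ σ) suc f
        (λ c i → c + i ≡ v) (λ c i → upd-old (pop {a = i} (top {v = c} {v′ = c} {σ}))) body v 0 (+-identityʳ v)))))
      (exec-popped (exec-popped (exec-weaken (loop≤ 2 (≤-trans (≤-reflexive (trans (iter-suc v 0) (+-identityʳ v))) v≤))
        (exec-clear (λ i → i ∷ 0 ∷ σ) top (iter v suc 0)))))))
    where
    v   = value a ρ
    v≤  = value≤ a b
    f   = λ i → produce W x (i ∷ ρ)
    body : ∀ c i → suc c + i ≡ v → c + suc i ≡ v × Exec x _ (i ∷ suc c ∷ σ) _ (suc i ∷ c ∷ σ) (f i)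
    body c i inv = trans (+-suc c i) inv , exec-⨾ (exec-dec (pop top))
      (exec-word (List.++-identityʳ _) (exec-⨾ (exec-Writer W (env-bind (env-push e))
        (bounded-bind {ρ = ρ} b (≤-trans (≤-trans (m≤n+m i (suc c)) (≤-reflexive inv)) v≤)))
        (exec-inc top)))
  exec-Writer (when φ W) {ρ = ρ} {σ} {B} e b = exec-⨾ (exec-Cond φ e b) (branch (holds φ (bit-at x) noFlags ρ))
    where
    branch : ∀ c → Exec x (while (length σ) (dec (length σ) ⨾ execWriter W _ (suc (length σ)))) (b2n c ∷ σ)
      (suc (suc (1 + timeWriter W B) + 1)) σ (if c then produce W x ρ else [])
    branch false = exec-weaken (s≤s z≤n) (exec-popped (exec-while-stop (upd-old (top {v = 0} {v′ = 0} {σ}))))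
    branch true  = exec-popped (exec-word (List.++-identityʳ _) (exec-weaken (s≤s (n≤1+n _))
      (exec-while-go (upd-old (top {v = 1} {v′ = 1} {σ})) (exec-⨾ (exec-dec top) (exec-Writer W (env-push e) b))
        (exec-while-stop (upd-old (top {v = 0} {v′ = 0} {σ}))))))

-- Polynomials

_+ₚ_ _*ₚ_ _∘ₚ_ : Polynomial → Polynomial → Polynomial
[]      +ₚ q       = q
(a ∷ p) +ₚ []      = a ∷ p
(a ∷ p) +ₚ (b ∷ q) = a + b ∷ (p +ₚ q)
[]      *ₚ q = []
(a ∷ p) *ₚ q = map (a *_) q +ₚ (0 ∷ (p *ₚ q))
[]      ∘ₚ q = []
(a ∷ p) ∘ₚ q = (a ∷ []) +ₚ (q *ₚ (p ∘ₚ q))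

eval-+ₚ : ∀ p q n → eval (p +ₚ q) n ≡ eval p n + eval q n
eval-+ₚ []      q       n = refl
eval-+ₚ (a ∷ p) []      n = sym (+-identityʳ _)
eval-+ₚ (a ∷ p) (b ∷ q) n rewrite eval-+ₚ p q n = lemma a b n (eval p n) (eval q n)
  where
  lemma : ∀ a b n p q → a + b + n * (p + q) ≡ a + n * p + (b + n * q)
  lemma = solve-∀

eval-scale : ∀ a q n → eval (map (a *_) q) n ≡ a * eval q n
eval-scale a []      n = sym (*-zeroʳ a)
eval-scale a (b ∷ q) n rewrite eval-scale a q n = lemma a b n (eval q n)
  where
  lemma : ∀ a b n q → a * b + n * (a * q) ≡ a * (b + n * q)
  lemma = solve-∀

eval-*ₚ : ∀ p q n → eval (p *ₚ q) n ≡ eval p n * eval q n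
eval-*ₚ []      q n = refl
eval-*ₚ (a ∷ p) q n
  rewrite eval-+ₚ (map (a *_) q) (0 ∷ (p *ₚ q)) n | eval-scale a q n | eval-*ₚ p q n = lemma a n (eval p n) (eval q n)
  where
  lemma : ∀ a n p q → a * q + n * (p * q) ≡ (a + n * p) * q
  lemma = solve-∀

eval-∘ₚ : ∀ p q n → eval (p ∘ₚ q) n ≡ eval p (eval q n)
eval-∘ₚ []      q n = refl
eval-∘ₚ (a ∷ p) q n rewrite eval-+ₚ (a ∷ []) (q *ₚ (p ∘ₚ q)) n | eval-*ₚ q (p ∘ₚ q) n | eval-∘ₚ p q n | *-zeroʳ n =
  cong (_+ eval q n * eval p (eval q n)) (+-identityʳ a)

eval-mono : ∀ p {m n} → m ≤ n → eval p m ≤ eval p n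
eval-mono []      l = ≤-refl
eval-mono (a ∷ p) l = +-monoʳ-≤ a (*-mono-≤ l (eval-mono p l))

idₚ : Polynomial
idₚ = 0 ∷ 1 ∷ []

eval-idₚ : ∀ n → eval idₚ n ≡ n
eval-idₚ n = trans (cong (λ z → n * (1 + z)) (*-zeroʳ n)) (*-identityʳ n)

eval-constₚ : ∀ c n → eval (c ∷ []) n ≡ c
eval-constₚ c n = trans (cong (c +_) (*-zeroʳ n)) (+-identityʳ c)

IsPoly : (ℕ → ℕ) → Set
IsPoly f = Σ[ p ∈ Polynomial ] ∀ n → f n ≤ eval p n

poly-id : IsPoly id
poly-id = idₚ , λ n → ≤-reflexive (sym (eval-idₚ n))

poly-const : ∀ c → IsPoly (λ _ → c)
poly-const c = c ∷ [] , λ n → ≤-reflexive (sym (eval-constₚ c n))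

infixl 6 _poly-+_
infixl 7 _poly-*_

_poly-+_ : ∀ {f g} → IsPoly f → IsPoly g → IsPoly (λ n → f n + g n)
(p , f≤) poly-+ (q , g≤) = p +ₚ q , λ n → ≤-trans (+-mono-≤ (f≤ n) (g≤ n)) (≤-reflexive (sym (eval-+ₚ p q n)))

_poly-*_ : ∀ {f g} → IsPoly f → IsPoly g → IsPoly (λ n → f n * g n)
(p , f≤) poly-* (q , g≤) = p *ₚ q , λ n → ≤-trans (*-mono-≤ (f≤ n) (g≤ n)) (≤-reflexive (sym (eval-*ₚ p q n)))

poly-∘ : ∀ {f g} → IsPoly f → IsPoly g → IsPoly (f ∘ g)
poly-∘ {g = g} (p , f≤) (q , g≤) = p ∘ₚ q , λ n →
  ≤-trans (f≤ (g n)) (≤-trans (eval-mono p (g≤ n)) (≤-reflexive (sym (eval-∘ₚ p q n))))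

poly-suc : ∀ {f} → IsPoly f → IsPoly (suc ∘ f)
poly-suc = poly-const 1 poly-+_

poly-loop : ∀ {f} c → IsPoly f → IsPoly (λ n → suc (f n * c))
poly-loop c p = poly-suc (p poly-* poly-const c)

poly-boundTm : ∀ a → IsPoly (boundTm a)
poly-boundTm (var j) = poly-id
poly-boundTm (lit c) = poly-const c
poly-boundTm (a ⊕ b) = poly-boundTm a poly-+ poly-boundTm b
poly-boundTm (a ⊗ b) = poly-boundTm a poly-* poly-boundTm b

poly-timeTm : ∀ a → IsPoly (timeTm a)
poly-timeTm (var j) = poly-loop 4 poly-id poly-+ poly-loop 3 poly-id
poly-timeTm (lit c) = poly-const (suc c)
poly-timeTm (a ⊕ b) = poly-timeTm a poly-+ (poly-timeTm b poly-+ poly-loop 3 (poly-boundTm b))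
poly-timeTm (a ⊗ b) = poly-timeTm a poly-+ (poly-timeTm b poly-+
  (poly-suc (poly-boundTm a poly-* poly-suc (poly-suc (poly-loop 4 (poly-boundTm b) poly-+ poly-loop 3 (poly-boundTm b))))
    poly-+ poly-loop 2 (poly-boundTm b)))

-- Under a binder with bound `a` all variables are at most `B + boundTm a B`. Each nesting level
-- therefore composes with one more polynomial, and the nesting depth is fixed by the program.
poly-body : ∀ {f} a → IsPoly f → IsPoly (λ B → f (B + boundTm a B))
poly-body a p = poly-∘ p (poly-id poly-+ poly-boundTm a)

poly-timeCond : ∀ {d} (φ : Cond d) → IsPoly (timeCond φ)
poly-timeCond (bit a)    = poly-timeTm a poly-+ poly-suc (poly-loop 3 (poly-boundTm a) poly-+
  poly-suc (poly-loop 2 (poly-suc (poly-boundTm a))))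
poly-timeCond (flag a)   = poly-const 1
poly-timeCond (a ≺ b)    = poly-timeTm b poly-+ (poly-timeTm a poly-+ (poly-loop 3 (poly-boundTm a) poly-+
  (poly-boundTm b poly-* poly-const 3 poly-+ poly-const 6 poly-+ poly-const 9)))
poly-timeCond (neg φ)    = poly-timeCond φ poly-+ poly-const 9
poly-timeCond (both φ ψ) = poly-timeCond φ poly-+
  (poly-suc (poly-suc (poly-suc (poly-timeCond ψ)) poly-+ poly-const 1) poly-+ poly-const 4)
poly-timeCond (each a φ) = poly-timeTm a poly-+
  (poly-suc (poly-boundTm a poly-* poly-suc (poly-suc (poly-body a (poly-timeCond φ) poly-+ poly-const 14)))
    poly-+ (poly-loop 2 (poly-boundTm a) poly-+ (poly-boundTm a poly-* poly-const 3 poly-+ poly-const 6)))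

poly-timeWriter : ∀ {d} (W : Writer d) → IsPoly (timeWriter W)
poly-timeWriter nil         = poly-const 1
poly-timeWriter (put b)     = poly-const 1
poly-timeWriter (W₁ ⊹ W₂)   = poly-timeWriter W₁ poly-+ poly-timeWriter W₂
poly-timeWriter (for a W)   = poly-timeTm a poly-+
  (poly-suc (poly-boundTm a poly-* poly-suc (poly-suc (poly-body a (poly-timeWriter W) poly-+ poly-const 1)))
    poly-+ poly-loop 2 (poly-boundTm a))
poly-timeWriter (when φ W)  = poly-timeCond φ poly-+
  poly-suc (poly-suc (poly-suc (poly-timeWriter W)) poly-+ poly-const 1)

-- Writers run in polynomial time

isBit : Symbol 1 → Bool
isBit (bit _) = true
isBit _       = false

module _ {K : ℕ} where

  -- Copying erases the input from tape 0, rebuilds it behind the marker of tape 1 and advances the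
  -- head of tape 2, so that register 1 ends up with the length of the input.
  placeMarks copy back forth : Heads 1 K → Action 1
  placeMarks h zero          = headAt h 0 , stay
  placeMarks h (suc zero)    = aux zero , right
  placeMarks h (suc (suc j)) = aux zero , stay
  copy h zero                = blank , right
  copy h (suc zero)          = headAt h 0 , right
  copy h (suc (suc zero))    = headAt h 2 , right
  copy h (suc (suc (suc j))) = headAt h (3 + j) , stay
  back h j                   = headAt h j , left
  forth h j                  = headAt h j , right

  load-input rewind : Prog 1 K
  load-input = act placeMarks ⨾ while (λ h → isBit (headAt h 0)) (act copy)
  rewind     = act back ⨾ (while (λ h → isBit (headAt h 0)) (act back) ⨾ act forth)

  record Loading (x : Word) (m : ℕ) (v : Word) (ts : Tapes 1 K) : Set where
    constructor loading
    field
      rest   : tapeAt ts 0 ≡ record (inputTape v) { before = replicate m blank }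
      copied : tapeAt ts 1 ≡ tape (map (cell x) (downFrom (suc m))) blank []
      count  : Counter [] m (tapeAt ts 2)
      others : ∀ j → 3 + j ≤ K → Counter [] 0 (tapeAt ts (3 + j))

  copy-all : ∀ {x} → 2 ≤ K → ∀ m v {ts} → (∀ j → cell x (suc m + j) ≡ cell v (suc j)) → Loading x m v ts →
    ∃[ ts′ ] (while (λ h → isBit (headAt h 0)) (act copy) ⊢ ts ↝[ suc (length v * 2) ] ts′) ×
      Rep K x (m + length v) ((m + length v) ∷ suc (m + length v) ∷ []) [] ts′
  copy-all {x} 2≤K m [] {ts} eq (loading r c k o) rewrite +-identityʳ m =
    ts , while-stop (cong isBit (trans (headAt-heads ts 0) (cong Tape.head r))) , rep r counters
    where
    counters : ∀ j → j < K → Counter (content x j) (register (m ∷ suc m ∷ []) j) (tapeAt ts (suc j))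
    counters zero          _ rewrite c = counter refl (trans (sym (eq 0)) (cong (cell x) (+-identityʳ (suc m))))
      λ j → trans (sym (eq (suc j))) (cong (cell x) (+-suc (suc m) j))
    counters (suc zero)    _ = k
    counters (suc (suc j)) l = o j l
  copy-all {x} 2≤K m (b ∷ v) {ts} eq (loading r c k o) =
    let (ts′ , p , R) = copy-all 2≤K (suc m) v (λ j → trans (cong (cell x) (sym (+-suc (suc m) j))) (eq (suc j)))
          (loading (rest′ v refl) copied′ count′ others′)
    in ts′ , while-go (cong isBit (trans (headAt-heads ts 0) (cong Tape.head r))) (act-path copy ts) p
     , subst (λ n → Rep K x n (n ∷ suc n ∷ []) [] ts′) (sym (+-suc m (length v))) R
    where
    at-tape : ∀ j → j ≤ K → tapeAt (perform ts (copy (heads ts))) j ≡ writeMove (tapeAt ts j) (copy (heads ts) j)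
    at-tape j l = tapeAt-perform ts (copy (heads ts)) l
    rest′ : ∀ u → u ≡ v → tapeAt (perform ts (copy (heads ts))) 0 ≡ record (inputTape u) { before = replicate (suc m) blank }
    rest′ []      refl = trans (at-tape 0 z≤n) (cong (λ tp → writeMove tp (blank , right)) r)
    rest′ (_ ∷ _) refl = trans (at-tape 0 z≤n) (cong (λ tp → writeMove tp (blank , right)) r)
    copied′ : tapeAt (perform ts (copy (heads ts))) 1 ≡ tape (map (cell x) (downFrom (2 + m))) blank []
    copied′ = trans (at-tape 1 (≤-trans (n≤1+n 1) 2≤K)) (trans (cong₂ (λ tp c → writeMove tp (c , right)) c
      (trans (headAt-heads ts 0) (trans (cong Tape.head r) (sym (eq 0)))))
      (cong (λ i → tape (cell x i ∷ map (cell x) (downFrom (suc m))) blank []) (+-identityʳ (suc m))))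
    count′ : Counter [] (suc m) (tapeAt (perform ts (copy (heads ts))) 2)
    count′ rewrite at-tape 2 2≤K | headAt-heads ts 2 = counter-right k
    others′ : ∀ j → 3 + j ≤ K → Counter [] 0 (tapeAt (perform ts (copy (heads ts))) (3 + j))
    others′ j l rewrite at-tape (3 + j) l | headAt-heads ts (3 + j) = o j l

  empty-tape : ∀ j → tapeAt {K = K} (inputTape [] ∷ Vec.replicate K emptyTape) j ≡ emptyTape {1}
  empty-tape zero    = refl
  empty-tape (suc j) = go K j
    where
    go : ∀ k j → nth (emptyTape {1}) (Vec.replicate k emptyTape) j ≡ emptyTape
    go zero    j       = refl
    go (suc k) zero    = refl
    go (suc k) (suc j) = go k j

  load-input-path : ∀ x → 2 ≤ K → ∃[ ts ] (load-input ⊢ inputTape x ∷ Vec.replicate K emptyTape ↝[ 1 + suc (length x * 2) ] ts) ×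
    Rep K x (length x) (length x ∷ suc (length x) ∷ []) [] ts
  load-input-path x 2≤K =
    let (ts , p , R) = copy-all 2≤K 0 x (λ _ → refl)
          (loading (rest x) marked (unmoved 0 2≤K) (λ j → unmoved (suc j)))
    in ts , ⨾-path (act-path placeMarks (ts₀ x)) p , R
    where
    ts₀ ts₁ : Word → Tapes 1 K
    ts₀ x = inputTape x ∷ Vec.replicate K emptyTape
    ts₁ x = perform (ts₀ x) (placeMarks (heads (ts₀ x)))
    at-tape : ∀ x j → j ≤ K → tapeAt (ts₁ x) j ≡ writeMove (tapeAt (ts₀ x) j) (placeMarks (heads (ts₀ x)) j)
    at-tape x j l = tapeAt-perform (ts₀ x) (placeMarks (heads (ts₀ x))) l
    rest : ∀ x → tapeAt (ts₁ x) 0 ≡ record (inputTape x) { before = [] }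
    rest []      = at-tape [] 0 z≤n
    rest (b ∷ x) = at-tape (b ∷ x) 0 z≤n
    marked : tapeAt (ts₁ x) 1 ≡ tape (aux zero ∷ []) blank []
    marked = trans (at-tape x 1 (≤-trans (n≤1+n 1) 2≤K)) (cong (λ tp → writeMove tp (aux zero , right)) (empty-tape 1))
    unmoved : ∀ j → 2 + j ≤ K → Counter [] 0 (tapeAt (ts₁ x) (2 + j))
    unmoved j l rewrite at-tape x (2 + j) l | empty-tape (2 + j) = counter refl refl λ _ → refl

  -- The cell to the left of the output is either an erased input cell or lies beyond the list. It
  -- is blank in both cases, so the rewinding loop stops there.
  leftTape : Word → ℕ → List (Symbol 1) → Tape 1
  leftTape (b ∷ out) z       rs = tape (map bit out ++ replicate z blank) (bit b) rs
  leftTape []        (suc z) rs = tape (replicate z blank) blank rs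
  leftTape []        zero    rs = tape [] blank rs

  leftTape-move : ∀ out z c rs → writeMove (tape (map bit out ++ replicate z blank) c rs) (c , left) ≡ leftTape out z (c ∷ rs)
  leftTape-move (b ∷ out) z       c rs = refl
  leftTape-move []        (suc z) c rs = refl
  leftTape-move []        zero    c rs = refl

  back-tape : ∀ {out z c rs} {ts : Tapes 1 K} → tapeAt ts 0 ≡ tape (map bit out ++ replicate z blank) c rs →
    tapeAt (perform ts (back (heads ts))) 0 ≡ leftTape out z (c ∷ rs)
  back-tape {out} {z} {c} {rs} {ts} eq = trans (tapeAt-perform ts (back (heads ts)) z≤n)
    (trans (cong₂ (λ tp c → writeMove tp (c , left)) eq (trans (headAt-heads ts 0) (cong Tape.head eq))) (leftTape-move out z c rs))

  rewind-loop : ∀ out ws {z ts} → tapeAt ts 0 ≡ leftTape out z (map bit ws ++ blank ∷ []) →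
    ∃[ ts′ ] (while (λ h → isBit (headAt h 0)) (act back) ⊢ ts ↝[ suc (length out * 2) ] ts′) ×
      ∃[ ls ] tapeAt ts′ 0 ≡ tape ls blank (map bit (out ʳ++ ws) ++ blank ∷ [])
  rewind-loop []        ws {zero}  {ts} eq = ts , while-stop (cong isBit (trans (headAt-heads ts 0) (cong Tape.head eq))) , _ , eq
  rewind-loop []        ws {suc z} {ts} eq = ts , while-stop (cong isBit (trans (headAt-heads ts 0) (cong Tape.head eq))) , _ , eq
  rewind-loop (b ∷ out) ws {z} {ts} eq =
    let (ts′ , p , ls , e) = rewind-loop out (b ∷ ws) (back-tape {out} {z} {ts = ts} eq)
    in ts′ , while-go (cong isBit (trans (headAt-heads ts 0) (cong Tape.head eq))) (act-path back ts) p , ls , e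

  leadingBits-word : ∀ w → leadingBits {1} (map bit w ++ blank ∷ []) ≡ w
  leadingBits-word []      = refl
  leadingBits-word (b ∷ w) = cong (b ∷_) (leadingBits-word w)

  rewind-path : ∀ out {z ts} → tapeAt ts 0 ≡ tape (map bit out ++ replicate z blank) blank [] →
    ∃[ ts′ ] (rewind ⊢ ts ↝[ 1 + (suc (length out * 2) + 1) ] ts′) × outputWord (tapeAt ts′ 0) ≡ reverse out
  rewind-path out {z} {ts} eq =
    let (ts′ , p , ls , e) = rewind-loop out [] (back-tape {out} {z} {ts = ts} eq)
    in _ , ⨾-path (act-path back ts) (⨾-path p (act-path forth ts′)) , final ts′ (out ʳ++ []) ls e
    where
    final : ∀ ts w ls → tapeAt ts 0 ≡ tape ls blank (map bit w ++ blank ∷ []) →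
      outputWord (tapeAt (perform ts (forth (heads ts))) 0) ≡ w
    final ts w ls e = trans (cong outputWord (trans (tapeAt-perform ts (forth (heads ts)) z≤n)
      (cong₂ (λ tp c → writeMove tp (c , right)) e (trans (headAt-heads ts 0) (cong Tape.head e))))) (first w)
      where
      first : ∀ w → outputWord (writeMove (tape ls blank (map bit w ++ blank ∷ [])) (blank , right)) ≡ w
      first []      = refl
      first (b ∷ w) = cong (b ∷_) (leadingBits-word w)

env-replicate : ∀ e v → Env (Vec.replicate e 1) (Vec.replicate e v) (v ∷ 0 ∷ [])
env-replicate zero    v = env (split {above = v ∷ []} refl refl) λ _ → split {above = v ∷ []} refl refl
env-replicate (suc e) v = env (split {above = v ∷ []} refl refl) vars
  where
  vars : ∀ j → Holds (v ∷ 0 ∷ []) (get (1 ∷ Vec.replicate e 1) j) (get (v ∷ Vec.replicate e v) j)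
  vars j with j ≡ᵇ e
  ... | true  = split {above = []} refl refl
  ... | false = Env.vars (env-replicate e v) j

bounded-replicate : ∀ e v → Bounded (Vec.replicate e v) v
bounded-replicate zero    v j = z≤n
bounded-replicate (suc e) v j with j ≡ᵇ e
... | true  = ≤-refl
... | false = bounded-replicate e v j

-- All `e` free variables share register 1, which holds the length of the input. The machine loads
-- the input, runs the compiled writer and rewinds, and each of the three times is polynomially
-- bounded.
writer-PolyTime : ∀ e (W : Writer e) → PolyTime (λ x → produce W x (Vec.replicate e (length x)))
writer-PolyTime e W = machine P , proj₁ bound , computes
  where
  c : Cmd
  -- Copying leaves the input pointer behind the last bit; `clear 0` sends it back to the marker, as
  -- `Env` demands.
  c = clear 0 ⨾ execWriter W (Vec.replicate e 1) 2
  K : ℕ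
  K = 2 ⊔ registers c
  P : Prog 1 K
  P = load-input ⨾ (compile K c ⨾ rewind)
  time : ℕ → ℕ
  time n = suc (suc n * 2) + timeWriter W n
  bound : IsPoly (λ n → 1 + suc (n * 2) + (time n + (1 + (suc (time n * 2) + 1))))
  bound = poly-suc (poly-loop 2 poly-id) poly-+ (poly-time poly-+ poly-suc (poly-loop 2 poly-time poly-+ poly-const 1))
    where
    poly-time : IsPoly time
    poly-time = poly-loop 2 (poly-suc poly-id) poly-+ poly-timeWriter W
  computes : ∀ x → let open TuringMachine (machine P)
                       end = run (eval (proj₁ bound) (length x)) (initial x)
                   in Halted end × output end ≡ produce W x (Vec.replicate e (length x))
  computes x =
    let n = length x
        w = produce W x (Vec.replicate e n)
        (ts₁ , p₁ , R₁) = load-input-path {K} x (m≤m⊔n 2 (registers c))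
        E : Exec x c (n ∷ suc n ∷ []) (time n) (n ∷ 0 ∷ []) w
        E = exec-⨾ (exec-clear (λ i → n ∷ i ∷ []) (pop top) (suc n))
              (exec-Writer W (env-replicate e n) (bounded-replicate e n))
        (t , ts₂ , t≤ , p₂ , R₂) = Exec.path E (≤-trans (n≤1+n 1) (m≤m⊔n 2 (registers c))) (fits c (m≤n⊔m 2 (registers c))) R₁
        (ts₃ , p₃ , out₃) = rewind-path {K} (w ʳ++ []) {n} {ts₂} (Rep.outputTape R₂)
        ends = run-program P (≤-trans (+-monoʳ-≤ (1 + suc (n * 2)) (+-mono-≤ t≤ (s≤s (+-monoˡ-≤ 1 (s≤s (*-monoˡ-≤ 2
          (≤-trans (≤-reflexive (List.length-reverse w)) (Exec.word-bound E)))))))) (proj₂ bound n)) (⨾-path p₁ (⨾-path p₂ p₃))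
    in subst (λ c → TuringMachine.Halted (machine P) c × TuringMachine.output (machine P) c ≡ w) (sym ends)
         (refl , trans (head-output ts₃) (trans out₃ (List.reverse-involutive w)))
    where
    head-output : (ts : Tapes 1 K) → TuringMachine.output (machine P) (TuringMachine.config zero ts) ≡ outputWord (tapeAt ts 0)
    head-output (_ ∷ _) = refl

-- Existential second-order definability

data Fm (d : ℕ) : Set where
  X       : Tm → Fm d
  G       : Vec Tm 5 → Fm d
  _⊏_ _≐_ : Tm → Tm → Fm d
  ∼_      : Fm d → Fm d
  _⊓ᶠ_ _⊔ᶠ_ _⇒_ : Fm d → Fm d → Fm d
  ∀ᶠ ∃ᶠ   : Tm → Fm (suc d) → Fm d

infix  8 _⊏_ _≐_
infix  7 ∼_
infixr 6 _⊓ᶠ_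
infixr 5 _⊔ᶠ_
infixr 4 _⇒_
infixr 4 all< ex<

all< ex< : ∀ {d} → Tm → (Tm → Fm (suc d)) → Fm d
all< {d} a φ = ∀ᶠ a (φ (var d))
ex<  {d} a φ = ∃ᶠ a (φ (var d))

syntax all< a (λ i → φ) = ⋀[ i < a ] φ
syntax ex<  a (λ i → φ) = ⋁[ i < a ] φ

values : ∀ {d m} → Vec Tm m → Vec ℕ d → Vec ℕ m
values []       ρ = []
values (a ∷ as) ρ = value a ρ ∷ values as ρ

Table : Set
Table = Vec ℕ 5 → Bool

⟦_⟧ : ∀ {d} → Fm d → Word → Table → Vec ℕ d → Set
⟦ X a ⟧     x g ρ = bit-at x (value a ρ) ≡ true
⟦ G as ⟧    x g ρ = g (values as ρ) ≡ true
⟦ a ⊏ b ⟧   x g ρ = value a ρ < value b ρ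
⟦ a ≐ b ⟧   x g ρ = value a ρ ≡ value b ρ
⟦ ∼ φ ⟧     x g ρ = ¬ ⟦ φ ⟧ x g ρ
⟦ φ ⊓ᶠ ψ ⟧  x g ρ = ⟦ φ ⟧ x g ρ × ⟦ ψ ⟧ x g ρ
⟦ φ ⊔ᶠ ψ ⟧  x g ρ = ⟦ φ ⟧ x g ρ ⊎ ⟦ ψ ⟧ x g ρ
⟦ φ ⇒ ψ ⟧   x g ρ = ⟦ φ ⟧ x g ρ → ⟦ ψ ⟧ x g ρ
⟦ ∀ᶠ a φ ⟧  x g ρ = ∀ i → i < value a ρ → ⟦ φ ⟧ x g (i ∷ ρ)
⟦ ∃ᶠ a φ ⟧  x g ρ = ∃[ i ] i < value a ρ × ⟦ φ ⟧ x g (i ∷ ρ)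

-- With a polynomial `D` this keeps the certificate short, and keeps the number of propositional
-- variables in the reduction polynomial.
Supported : ℕ → Table → Set
Supported D g = ∀ as → g as ≡ true → All (_< D) as

-- Variable 1 is the length of the input.  Variable 0 is unspecified, so that
-- the formula can be evaluated on longer words that contain the input.
record Definable (𝓛 : Language) : Set where
  field
    formula  : Fm 2
    side     : Polynomial
    sound    : ∀ l x g → ⟦ formula ⟧ x g (length x ∷ l ∷ []) → 𝓛 x
    complete : ∀ x → 𝓛 x → Σ[ g ∈ Table ] Supported (eval side (length x)) g × ∀ l → ⟦ formula ⟧ x g (length x ∷ l ∷ [])

polyTm : Polynomial → Tm → Tm
polyTm []      a = lit 0
polyTm (c ∷ p) a = lit c ⊕ a ⊗ polyTm p a

value-polyTm : ∀ {d} p a (ρ : Vec ℕ d) → value (polyTm p a) ρ ≡ eval p (value a ρ)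
value-polyTm []      a ρ = refl
value-polyTm (c ∷ p) a ρ = cong (λ v → c + value a ρ * v) (value-polyTm p a ρ)

-- Tables as bit sequences

module _ (D : ℕ) where

  -- A number written in base `suc D`. Taking `suc D` instead of `D` makes the divisor in `digits`
  -- nonzero.
  index : ∀ {m} → Vec ℕ m → ℕ
  index []       = 0
  index (a ∷ as) = a + index as * suc D

  digits : ∀ m → ℕ → Vec ℕ m
  digits zero    v = []
  digits (suc m) v = v % suc D ∷ digits m (v / suc D)

  digits-index : ∀ {m} {as : Vec ℕ m} → All (_< suc D) as → digits m (index as) ≡ as
  digits-index All.[] = refl
  digits-index {as = a ∷ as} (a< All.∷ as<) = cong₂ _∷_
    (trans ([m+kn]%n≡m%n a (index as) (suc D)) (m<n⇒m%n≡m a<))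
    (trans (cong (digits _) (trans (+-distrib-/-∣ʳ a (n∣m*n (index as)))
      (cong₂ _+_ (m<n⇒m/n≡0 a<) (m*n/n≡m (index as) (suc D))))) (digits-index as<))

  index< : ∀ {m} {as : Vec ℕ m} → All (_< suc D) as → index as < suc D ^ m
  index< All.[] = ≤-refl
  index< {suc m} {a ∷ as} (a< All.∷ as<) = ≤-trans (+-monoˡ-≤ (index as * suc D) a<)
    (≤-trans (*-monoˡ-≤ (suc D) (index< as<)) (≤-reflexive (*-comm (suc D ^ m) (suc D))))

  within : ∀ {m} → Vec ℕ m → Bool → Bool
  within []       b = b
  within (a ∷ as) b = (a <ᵇ suc D) ∧ within as b

  within-true : ∀ {m} {as : Vec ℕ m} {b} → All (_< suc D) as → within as b ≡ b
  within-true All.[] = refl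
  within-true {as = a ∷ _} (a< All.∷ as<) with a <ᵇ suc D | <⇒<ᵇ a<
  ... | true | _ = within-true as<

  within-all : ∀ {m} (as : Vec ℕ m) {b} → within as b ≡ true → All (_< suc D) as
  within-all []       e = All.[]
  within-all (a ∷ as) e with a <ᵇ suc D in eq
  ... | true = <ᵇ⇒< a (suc D) (subst T (sym eq) _) All.∷ within-all as e

  -- Tuples with too large components share their index with others, so `within` sets them to false.
  table : (ℕ → Bool) → Table
  table y as = within as (y (index as))

  table-of : ∀ {g} → Supported (suc D) g → ∀ {y} → (∀ v → v < suc D ^ 5 → y v ≡ g (digits 5 v)) → ∀ as → g as ≡ table y as
  table-of {g} supp {y} eq as with All.all? (_<? suc D) as
  ... | yes as< = trans (cong g (sym (digits-index as<))) (trans (sym (eq _ (index< as<))) (sym (within-true as<)))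
  ... | no ¬as< = trans (not-true (g as) (¬as< ∘ supp as)) (sym (not-true _ (¬as< ∘ within-all as)))
    where
    not-true : ∀ b → ¬ b ≡ true → b ≡ false
    not-true false _ = refl
    not-true true  n = ⊥-elim (n refl)

indexTm : ∀ {m} → Tm → Vec Tm m → Tm
indexTm D []       = lit 0
indexTm D (a ∷ as) = a ⊕ indexTm D as ⊗ (lit 1 ⊕ D)

guard : ∀ {d m} → Tm → Vec Tm m → Cond d → Cond d
guard D []       φ = φ
guard D (a ∷ as) φ = both (a ≺ (lit 1 ⊕ D)) (guard D as φ)

value-indexTm : ∀ {d m} D (as : Vec Tm m) (ρ : Vec ℕ d) → value (indexTm D as) ρ ≡ index (value D ρ) (values as ρ)
value-indexTm D []       ρ = refl
value-indexTm D (a ∷ as) ρ = cong (λ v → value a ρ + v * suc (value D ρ)) (value-indexTm D as ρ)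

holds-guard : ∀ {d m} D (as : Vec Tm m) (φ : Cond d) {x y} ρ →
  holds (guard D as φ) x y ρ ≡ within (value D ρ) (values as ρ) (holds φ x y ρ)
holds-guard D []       φ ρ = refl
holds-guard D (a ∷ as) φ ρ = cong ((value a ρ <ᵇ suc (value D ρ)) ∧_) (holds-guard D as φ ρ)

-- From formulas to conditions

data Extends {e : ℕ} (ρ₀ : Vec ℕ e) : ∀ {d} → Vec ℕ d → Set where
  base : Extends ρ₀ ρ₀
  bind : ∀ {d i} {ρ : Vec ℕ d} → Extends ρ₀ ρ → Extends ρ₀ (i ∷ ρ)

extends-depth : ∀ {e d} {ρ₀ : Vec ℕ e} {ρ : Vec ℕ d} → Extends ρ₀ ρ → e ≤ d
extends-depth base     = ≤-refl
extends-depth (bind E) = m≤n⇒m≤1+n (extends-depth E)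

-- Since variables are levels, `var 1` still denotes the length of the input under any number of
-- binders.
get-extends : ∀ {e d} {ρ₀ : Vec ℕ e} {ρ : Vec ℕ d} → Extends ρ₀ ρ → ∀ {j} → j < e → get ρ j ≡ get ρ₀ j
get-extends base     j< = refl
get-extends (bind {d} E) {j} j< rewrite ≢⇒≡ᵇ j d (<⇒≢ (≤-trans j< (extends-depth E))) = get-extends E j<

reflects-map : {P Q : Set} {b : Bool} → (P → Q) → (Q → P) → Reflects P b → Reflects Q b
reflects-map f g (ofʸ p) = ofʸ (f p)
reflects-map f g (ofⁿ n) = ofⁿ (n ∘ g)

reflects-true : ∀ b → Reflects (b ≡ true) b
reflects-true true  = ofʸ refl
reflects-true false = ofⁿ λ ()

reflects-⇔ : {P : Set} {b : Bool} → Reflects P b → P ⇔ b ≡ true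
reflects-⇔ (ofʸ p) = mk⇔ (λ _ → refl) (λ _ → p)
reflects-⇔ (ofⁿ n) = mk⇔ (λ p → ⊥-elim (n p)) λ ()

reflects-¬¬ : {P : Set} {b : Bool} → Reflects P b → ¬ ¬ P → P
reflects-¬¬ (ofʸ p) nn = p
reflects-¬¬ (ofⁿ n) nn = ⊥-elim (nn n)

reflects-all : {P : ℕ → Set} {f : ℕ → Bool} → (∀ i → Reflects (P i) (f i)) → ∀ n →
  Reflects (∀ i → i < n → P i) (allFrom f 0 n)
reflects-all {P} {f} R n = reflects-map (λ h j → h j z≤n) (λ h j _ → h j) (go 0 n)
  where
  go : ∀ i n → Reflects (∀ j → i ≤ j → j < i + n → P j) (allFrom f i n)
  go i zero    = ofʸ λ j i≤j j< → ⊥-elim (<⇒≱ j< (≤-trans (≤-reflexive (+-identityʳ i)) i≤j))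
  go i (suc n) = reflects-map
    (λ (p , all) j i≤j j< → [ (λ i<j → all j i<j (≤-trans j< (≤-reflexive (+-suc i n)))) , (λ { refl → p }) ]′ (m≤n⇒m<n∨m≡n i≤j))
    (λ all → all i ≤-refl (m<m+n i (s≤s z≤n)) , λ j i<j j< → all j (<⇒≤ i<j) (≤-trans j< (≤-reflexive (sym (+-suc i n)))))
    (R i ×-reflects go (suc i) n)

reflects-any : {P : ℕ → Set} {f : ℕ → Bool} → (∀ i → Reflects (P i) (f i)) → ∀ n →
  Reflects (∃[ i ] i < n × P i) (not (allFrom (not ∘ f) 0 n))
reflects-any {P} {f} R n = reflects-map (search n) (λ (i , i< , p) h → h i i< p) (¬-reflects (reflects-all (¬-reflects ∘ R) n))
  where
  search : ∀ n → ¬ (∀ i → i < n → ¬ P i) → ∃[ i ] i < n × P i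
  search zero    h = ⊥-elim (h λ _ ())
  search (suc n) h with f n | R n
  ... | true  | ofʸ p = n , ≤-refl , p
  ... | false | ofⁿ p =
    let (i , i< , q) = search n (λ none → h λ j j< → [ none j , (λ { refl → p }) ]′ (m≤n⇒m<n∨m≡n (≤-pred j<))) in i , m<n⇒m<1+n i< , q

-- The parameters say where input and table are found. The verifier reads both from the bits of a
-- pair; the reduction reads the input from its own word and leaves the table bits as flags.
module Translation (xᶜ : ∀ {d} → Tm → Cond d) (gᶜ : ∀ {d} → Vec Tm 5 → Cond d) where

  tr : ∀ {d} → Fm d → Cond d
  tr (X a)     = xᶜ a
  tr (G as)    = gᶜ as
  tr (a ⊏ b)   = a ≺ b
  tr (a ≐ b)   = both (neg (a ≺ b)) (neg (b ≺ a))
  tr (∼ φ)     = neg (tr φ)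
  tr (φ ⊓ᶠ ψ)  = both (tr φ) (tr ψ)
  tr (φ ⊔ᶠ ψ)  = neg (both (neg (tr φ)) (neg (tr ψ)))
  tr (φ ⇒ ψ)   = neg (both (tr φ) (neg (tr ψ)))
  tr (∀ᶠ a φ)  = each a (tr φ)
  tr (∃ᶠ a φ)  = neg (each a (neg (tr φ)))

  module _ {x : Word} {g : Table} {x′ y′ : ℕ → Bool} {e : ℕ} {ρ₀ : Vec ℕ e}
    (xᶜ-ok : ∀ {d} {ρ : Vec ℕ d} → Extends ρ₀ ρ → ∀ a → bit-at x (value a ρ) ≡ holds (xᶜ a) x′ y′ ρ)
    (gᶜ-ok : ∀ {d} {ρ : Vec ℕ d} → Extends ρ₀ ρ → ∀ as → g (values as ρ) ≡ holds (gᶜ as) x′ y′ ρ) where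

    -- All quantifiers are bounded, so every formula is decidable, and disjunction, implication and
    -- existence may be expressed classically by `neg`, `both` and `each`.
    tr-reflects : ∀ {d} {ρ : Vec ℕ d} → Extends ρ₀ ρ → ∀ φ → Reflects (⟦ φ ⟧ x g ρ) (holds (tr φ) x′ y′ ρ)
    tr-reflects E (X a)    = subst (Reflects _) (xᶜ-ok E a) (reflects-true _)
    tr-reflects E (G as)   = subst (Reflects _) (gᶜ-ok E as) (reflects-true _)
    tr-reflects E (a ⊏ b)  = <ᵇ-reflects-< _ _
    tr-reflects E (a ≐ b)  = reflects-map (λ (a≮b , b≮a) → ≤-antisym (≮⇒≥ b≮a) (≮⇒≥ a≮b))
      (λ eq → <-irrefl eq , <-irrefl (sym eq)) (¬-reflects (<ᵇ-reflects-< _ _) ×-reflects ¬-reflects (<ᵇ-reflects-< _ _))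
    tr-reflects E (∼ φ)    = ¬-reflects (tr-reflects E φ)
    tr-reflects E (φ ⊓ᶠ ψ) = tr-reflects E φ ×-reflects tr-reflects E ψ
    tr-reflects E (φ ⊔ᶠ ψ) = disjunction (tr-reflects E φ) (tr-reflects E ψ)
      where
      disjunction : {P Q : Set} {b c : Bool} → Reflects P b → Reflects Q c → Reflects (P ⊎ Q) (not (not b ∧ not c))
      disjunction (ofʸ p) _       = ofʸ (inj₁ p)
      disjunction (ofⁿ _) (ofʸ q) = ofʸ (inj₂ q)
      disjunction (ofⁿ p) (ofⁿ q) = ofⁿ [ p , q ]′
    tr-reflects E (φ ⇒ ψ)  = let r = tr-reflects E φ ; s = tr-reflects E ψ in reflects-map
      (λ n p → reflects-¬¬ s λ ¬q → n (p , ¬q)) (λ f (p , ¬q) → ¬q (f p)) (¬-reflects (r ×-reflects ¬-reflects s))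
    tr-reflects E (∀ᶠ a φ) = reflects-all (λ i → tr-reflects (bind E) φ) _
    tr-reflects E (∃ᶠ a φ) = reflects-any (λ i → tr-reflects (bind E) φ) _

    tr-correct : ∀ φ → ⟦ φ ⟧ x g ρ₀ ⇔ holds (tr φ) x′ y′ ρ₀ ≡ true
    tr-correct φ = reflects-⇔ (tr-reflects base φ)

-- Definable languages are in NP

bit-at-pair-odd : ∀ x y j → bit-at x j ≡ (j <ᵇ length x) ∧ bit-at (pair x y) (1 + (j + j))
bit-at-pair-odd []      y j       = refl
bit-at-pair-odd (b ∷ x) y zero    = refl
bit-at-pair-odd (b ∷ x) y (suc j) rewrite +-suc j j = bit-at-pair-odd x y j

bit-at-pair-even : ∀ x y j → j < length x → bit-at (pair x y) (j + j) ≡ true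
bit-at-pair-even (b ∷ x) y zero    _       = refl
bit-at-pair-even (b ∷ x) y (suc j) (s≤s l) rewrite +-suc j j = bit-at-pair-even x y j l

bit-at-pair-separator : ∀ x y → bit-at (pair x y) (length x + length x) ≡ false
bit-at-pair-separator []      y = refl
bit-at-pair-separator (b ∷ x) y rewrite +-suc (length x) (length x) = bit-at-pair-separator x y

bit-at-pair-second : ∀ x y v → bit-at (pair x y) (1 + (length x + length x) + v) ≡ bit-at y v
bit-at-pair-second []      y v = refl
bit-at-pair-second (b ∷ x) y v rewrite +-suc (length x) (length x) = bit-at-pair-second x y v

length-pair : ∀ x y → length (pair x y) ≡ length x + length x + suc (length y)
length-pair []      y = refl
length-pair (b ∷ x) y rewrite +-suc (length x) (length x) = cong (2 +_) (length-pair x y)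

PolyTime-≗ : ∀ {f g} → (∀ x → f x ≡ g x) → PolyTime f → PolyTime g
PolyTime-≗ eq (M , p , ok) = M , p , λ x → proj₁ (ok x) , trans (proj₂ (ok x)) (eq x)

decider-PolyTime : (φ : Cond 1) → PolyTime (λ w → [ holds φ (bit-at w) noFlags (length w ∷ []) ])
decider-PolyTime φ = PolyTime-≗ eq (writer-PolyTime 1 (when φ (put true) ⊹ when (neg φ) (put false)))
  where
  eq : ∀ w → produce (when φ (put true) ⊹ when (neg φ) (put false)) w (length w ∷ []) ≡ [ holds φ (bit-at w) noFlags (length w ∷ []) ]
  eq w with holds φ (bit-at w) noFlags (length w ∷ [])
  ... | true  = refl
  ... | false = refl

bit-at-applyUpTo : ∀ (f : ℕ → Bool) n {v} → v < n → bit-at (applyUpTo f n) v ≡ f v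
bit-at-applyUpTo f (suc n) {zero}  _       = refl
bit-at-applyUpTo f (suc n) {suc v} (s≤s l) = bit-at-applyUpTo (f ∘ suc) n l

^ₚ : ℕ → Polynomial → Polynomial
^ₚ zero    p = 1 ∷ []
^ₚ (suc m) p = p *ₚ ^ₚ m p

eval-^ₚ : ∀ m p n → eval (^ₚ m p) n ≡ eval p n ^ m
eval-^ₚ zero    p n = eval-constₚ 1 n
eval-^ₚ (suc m) p n = trans (eval-*ₚ p (^ₚ m p) n) (cong (eval p n *_) (eval-^ₚ m p n))

definable⇒NP : ∀ {𝓛} → Definable 𝓛 → NP 𝓛
-- The certificate has one bit for each tuple of five digits in base `suc D`.
definable⇒NP {𝓛} def = V-of , decider-PolyTime verifier , ^ₚ 5 side′ , λ x → mk⇔ (certificate x) (λ (y , _ , ok) → accepted x y ok)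
  where
  open Definable def
  side′ : Polynomial
  side′ = (1 ∷ []) +ₚ side
  eval-side′ : ∀ n → eval side′ n ≡ suc (eval side n)
  eval-side′ n = trans (eval-+ₚ (1 ∷ []) side n) (cong (_+ eval side n) (eval-constₚ 1 n))
  D : Tm
  D = polyTm side (var 1)
  xᶜ : ∀ {d} → Tm → Cond d
  xᶜ a = both (a ≺ var 1) (bit (lit 1 ⊕ (a ⊕ a)))
  gᶜ : ∀ {d} → Vec Tm 5 → Cond d
  gᶜ as = guard D as (bit (lit 1 ⊕ (var 1 ⊕ var 1) ⊕ indexTm D as))
  open Translation xᶜ gᶜ
  -- Variable 0 is the length of the word, variable 1 that of its first component.
  separator : Cond 2
  separator = both (neg (bit (var 1 ⊕ var 1))) (each (var 1) (bit (var 2 ⊕ var 2)))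
  -- The word does not state the length of its first component. It is the only `m` such that
  -- position `m + m` is the first even position holding false; bounded search finds it.
  verifier : Cond 1
  verifier = neg (each (var 0 ⊕ lit 1) (neg (both separator (tr formula))))
  V-of : Word → Bool
  V-of w = holds verifier (bit-at w) noFlags (length w ∷ [])

  module _ (x y : Word) where
    w   = pair x y
    l   = length w
    ρ₀  = length x ∷ l ∷ []
    g′  = table (eval side (length x)) (bit-at y)

    correct : ∀ {g} → (∀ as → g as ≡ g′ as) → ⟦ formula ⟧ x g ρ₀ ⇔ holds (tr formula) (bit-at w) noFlags ρ₀ ≡ true
    correct {g} eq = tr-correct x-ok g-ok formula
      where
      x-ok : ∀ {d} {ρ : Vec ℕ d} → Extends ρ₀ ρ → ∀ a → bit-at x (value a ρ) ≡ holds (xᶜ a) (bit-at w) noFlags ρ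
      x-ok {ρ = ρ} E a rewrite get-extends E {1} ≤-refl = bit-at-pair-odd x y (value a ρ)
      g-ok : ∀ {d} {ρ : Vec ℕ d} → Extends ρ₀ ρ → ∀ as → g (values as ρ) ≡ holds (gᶜ as) (bit-at w) noFlags ρ
      g-ok {ρ = ρ} E as rewrite holds-guard D as (bit (lit 1 ⊕ (var 1 ⊕ var 1) ⊕ indexTm D as)) {bit-at w} {noFlags} ρ
        | value-indexTm D as ρ | value-polyTm side (var 1) ρ | get-extends E {1} ≤-refl
        | bit-at-pair-second x y (index (eval side (length x)) (values as ρ)) = eq (values as ρ)

    separates : ∀ m → Reflects (¬ bit-at w (m + m) ≡ true × (∀ j → j < m → bit-at w (j + j) ≡ true))
      (holds separator (bit-at w) noFlags (m ∷ l ∷ []))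
    separates m = ¬-reflects (reflects-true _) ×-reflects reflects-all (λ j → reflects-true _) m

    separator-unique : ∀ m → ¬ bit-at w (m + m) ≡ true × (∀ j → j < m → bit-at w (j + j) ≡ true) → m ≡ length x
    separator-unique m (zero-here , ones) = ≤-antisym
      (≮⇒≥ λ n<m → Bool.not-¬ (bit-at-pair-separator x y) (ones (length x) n<m))
      (≮⇒≥ λ m<n → zero-here (bit-at-pair-even x y m m<n))

    verifies : Reflects (∃[ m ] m < l + 1 × (¬ bit-at w (m + m) ≡ true × (∀ j → j < m → bit-at w (j + j) ≡ true)) ×
      holds (tr formula) (bit-at w) noFlags (m ∷ l ∷ []) ≡ true) (V-of w)
    verifies = reflects-any (λ m → separates m ×-reflects reflects-true _) (l + 1)

    accepted : V-of w ≡ true → 𝓛 x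
    accepted ok
      with m , _ , sep , h ← Equivalence.from (reflects-⇔ verifies) ok
      with refl ← separator-unique m sep
      = sound l x g′ (Equivalence.from (correct λ _ → refl) h)

    accept : ∀ {g} → (∀ as → g as ≡ g′ as) → ⟦ formula ⟧ x g ρ₀ → V-of w ≡ true
    accept eq h = Equivalence.to (reflects-⇔ verifies) (length x , x<l ,
      (Bool.not-¬ (bit-at-pair-separator x y) , bit-at-pair-even x y) , Equivalence.to (correct eq) h)
      where
      x<l : length x < l + 1
      x<l rewrite length-pair x y = ≤-trans (s≤s (≤-trans (m≤m+n (length x) (length x)) (m≤m+n _ _))) (≤-reflexive (+-comm 1 _))

  certificate : ∀ x → 𝓛 x → ∃[ y ] length y ≤ eval (^ₚ 5 side′) (length x) × V-of (pair x y) ≡ true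
  certificate x x∈𝓛 = y , ≤-reflexive (trans (List.length-applyUpTo f N) (sym (trans (eval-^ₚ 5 side′ (length x)) (cong (_^ 5) (eval-side′ (length x))))))
                    , accept x y (table-of D′ {g} supp′ (λ v v< → bit-at-applyUpTo f N v<)) (proj₂ (proj₂ (complete x x∈𝓛)) (length (pair x y)))
    where
    D′ = eval side (length x)
    N  = suc D′ ^ 5
    g  = proj₁ (complete x x∈𝓛)
    f  = λ v → g (digits D′ 5 v)
    y  = applyUpTo f N
    supp′ : Supported (suc D′) g
    supp′ as e = All.map m<n⇒m<1+n (proj₁ (proj₂ (complete x x∈𝓛)) as e)

-- Languages in NP are definable

record Finite (A : Set) : Set where
  field
    card        : ℕ
    code        : A → Fin card
    decode      : Fin card → A
    decode-code : ∀ a → decode (code a) ≡ a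

open Finite

finite-Bool : Finite Bool
finite-Bool = record
  { card = 2
  ; code = λ { false → zero ; true → suc zero }
  ; decode = λ { zero → false ; (suc zero) → true }
  ; decode-code = λ { false → refl ; true → refl } }

finite-Fin : ∀ n → Finite (Fin n)
finite-Fin n = record { card = n ; code = id ; decode = id ; decode-code = λ _ → refl }

finite-Symbol : ∀ g → Finite (Symbol g)
finite-Symbol g = record
  { card = 3 + g
  ; code = λ { blank → zero ; (bit false) → suc zero ; (bit true) → suc (suc zero) ; (aux i) → suc (suc (suc i)) }
  ; decode = λ { zero → blank ; (suc zero) → bit false ; (suc (suc zero)) → bit true ; (suc (suc (suc i))) → aux i }
  ; decode-code = λ { blank → refl ; (bit false) → refl ; (bit true) → refl ; (aux i) → refl } }

infixr 2 _×ᶠ_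

_×ᶠ_ : ∀ {A B} → Finite A → Finite B → Finite (A × B)
F ×ᶠ F′ = record
  { card = card F * card F′
  ; code = λ (a , b) → Fin.combine (code F a) (code F′ b)
  ; decode = λ i → let (j , k) = Fin.remQuot (card F′) i in decode F j , decode F′ k
  ; decode-code = λ (a , b) → trans (cong (λ (j , k) → decode F j , decode F′ k) (Fin.remQuot-combine (code F a) (code F′ b)))
      (cong₂ _,_ (decode-code F a) (decode-code F′ b)) }

finite-Vec : ∀ {A} → Finite A → ∀ n → Finite (Vec A n)
finite-Vec F zero    = record { card = 1 ; code = λ _ → zero ; decode = λ _ → [] ; decode-code = λ { [] → refl } }
finite-Vec F (suc n) = let F′ = F ×ᶠ finite-Vec F n in record
  { card = card F′
  ; code = λ { (a ∷ as) → code F′ (a , as) }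
  ; decode = λ i → let (a , as) = decode F′ i in a ∷ as
  ; decode-code = λ { (a ∷ as) → cong (λ (a , as) → a ∷ as) (decode-code F′ (a , as)) } }

number-of : ∀ {A} → Finite A → A → ℕ
number-of F a = toℕ (code F a)

⋀Fin : ∀ {d} n → (Fin n → Fm d) → Fm d
⋀Fin zero    φ = lit 0 ≐ lit 0
⋀Fin (suc n) φ = φ zero ⊓ᶠ ⋀Fin n (φ ∘ suc)

⋀all : ∀ {d A} → Finite A → (A → Fm d) → Fm d
⋀all F φ = ⋀Fin (card F) (φ ∘ decode F)

module _ {x : Word} {g : Table} {d : ℕ} {ρ : Vec ℕ d} where

  ⋀Fin-elim : ∀ {n} (φ : Fin n → Fm d) → ⟦ ⋀Fin n φ ⟧ x g ρ → ∀ i → ⟦ φ i ⟧ x g ρ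
  ⋀Fin-elim φ (p , _)  zero    = p
  ⋀Fin-elim φ (_ , ps) (suc i) = ⋀Fin-elim (φ ∘ suc) ps i

  ⋀Fin-intro : ∀ {n} (φ : Fin n → Fm d) → (∀ i → ⟦ φ i ⟧ x g ρ) → ⟦ ⋀Fin n φ ⟧ x g ρ
  ⋀Fin-intro {zero}  φ h = refl
  ⋀Fin-intro {suc n} φ h = h zero , ⋀Fin-intro (φ ∘ suc) (h ∘ suc)

  ⋀all-elim : ∀ {A} (F : Finite A) (φ : A → Fm d) → ⟦ ⋀all F φ ⟧ x g ρ → ∀ a → ⟦ φ a ⟧ x g ρ
  ⋀all-elim F φ h a = subst (λ a → ⟦ φ a ⟧ x g ρ) (decode-code F a) (⋀Fin-elim (φ ∘ decode F) h (code F a))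

  ⋀all-intro : ∀ {A} (F : Finite A) (φ : A → Fm d) → (∀ a → ⟦ φ a ⟧ x g ρ) → ⟦ ⋀all F φ ⟧ x g ρ
  ⋀all-intro F φ h = ⋀Fin-intro (φ ∘ decode F) (h ∘ decode F)

isZero : ℕ → Bool
isZero zero    = true
isZero (suc _) = false

-- A configuration is viewed as a sequence of cells: cell i holds the state, the
-- i-th symbol before each head and the i-th symbol from each head onwards, and a
-- flag marking cell 0.  With positions taken relative to the heads, one step
-- changes cell i depending only on the cells 0, i ∸ 1, i and i + 1.

module _ {g : ℕ} where

  Two : Set
  Two = Symbol g × Symbol g

  view : ℕ → Tape g → Two
  view i (tape ls c rs) = symbolAt ls i , symbolAt (c ∷ rs) i

  -- A move shifts the two halves of the tape against each other. The flag `f` marks cell 0, where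
  -- symbols cross over; `fˡ` marks cell 1, whose left neighbour is the head cell and has just been
  -- overwritten by `c`.
  local : Symbol g × Move → Bool → Bool → Two → Two → Two → Two
  local (c , stay)  fˡ f l       (b₋ , b₊) r         = b₋ , (if f then c else b₊)
  local (c , left)  fˡ f (_ , l) (b₋ , b₊) (r , _)   = r , (if f then b₋ else if fˡ then c else l)
  local (c , right) fˡ f (l , _) b         (_ , r)   = (if f then c else l) , r

  view-writeMove : ∀ tp a i →
    view i (writeMove tp a) ≡ local a (isZero (pred i)) (isZero i) (view (pred i) tp) (view i tp) (view (suc i) tp)
  view-writeMove (tape ls h rs)       (c , stay)  zero          = refl
  view-writeMove (tape ls h rs)       (c , stay)  (suc i)       = refl
  view-writeMove (tape [] h rs)       (c , left)  zero          = refl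
  view-writeMove (tape [] h rs)       (c , left)  (suc zero)    = refl
  view-writeMove (tape [] h rs)       (c , left)  (suc (suc i)) = refl
  view-writeMove (tape (l ∷ ls) h rs) (c , left)  zero          = refl
  view-writeMove (tape (l ∷ ls) h rs) (c , left)  (suc zero)    = refl
  view-writeMove (tape (l ∷ ls) h rs) (c , left)  (suc (suc i)) = refl
  view-writeMove (tape ls h [])       (c , right) zero          = refl
  view-writeMove (tape ls h [])       (c , right) (suc i)       = refl
  view-writeMove (tape ls h (r ∷ rs)) (c , right) zero          = refl
  view-writeMove (tape ls h (r ∷ rs)) (c , right) (suc i)       = refl

  symbol : Word → ℕ → Symbol g
  symbol w i = symbolAt (map bit w) i

  view-inputTape : ∀ w i → view i (inputTape w) ≡ (blank , symbol w i)
  view-inputTape []      zero    = refl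
  view-inputTape []      (suc i) = refl
  view-inputTape (b ∷ w) i       = refl

  symbol-even : ∀ x y j → j < length x → symbol (pair x y) (j + j) ≡ bit true
  symbol-even (b ∷ x) y zero    _       = refl
  symbol-even (b ∷ x) y (suc j) (s≤s l) rewrite +-suc j j = symbol-even x y j l

  symbol-odd : ∀ x y j → j < length x → symbol (pair x y) (suc (j + j)) ≡ bit (bit-at x j)
  symbol-odd (b ∷ x) y zero    _       = refl
  symbol-odd (b ∷ x) y (suc j) (s≤s l) rewrite +-suc j j = symbol-odd x y j l

  symbol-separator : ∀ x y → symbol (pair x y) (length x + length x) ≡ bit false
  symbol-separator []      y = refl
  symbol-separator (b ∷ x) y rewrite +-suc (length x) (length x) = symbol-separator x y

  symbol-second : ∀ x y v → symbol (pair x y) (length x + length x + 1 + v) ≡ symbol y v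
  symbol-second []      y v = refl
  symbol-second (b ∷ x) y v rewrite +-suc (length x) (length x) = symbol-second x y v

  symbol-beyond : ∀ w i → length w ≤ i → symbol w i ≡ blank
  symbol-beyond []      i       l       = refl
  symbol-beyond (b ∷ w) (suc i) (s≤s l) = symbol-beyond w i l

  isTrue : Symbol g → Bool
  isTrue (bit b) = b
  isTrue _       = false

  output-bit : ∀ tp {b} → outputWord tp ≡ b ∷ [] → isTrue (proj₂ (view 0 tp)) ≡ b
  output-bit (tape _ (bit b) _) e = List.∷-injectiveˡ e

-- Computation tables and the local rule for one step

module Trace (T : TuringMachine) where
  open TuringMachine T

  Cell : Set
  Cell = Bool × Fin states × Vec (Two {auxSymbols}) (suc extraTapes)

  abstract
    finite-Cell : Finite Cell
    finite-Cell = finite-Bool ×ᶠ finite-Fin states ×ᶠ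
      finite-Vec (finite-Symbol auxSymbols ×ᶠ finite-Symbol auxSymbols) (suc extraTapes)

    finite-Cell⁴ : Finite (Cell × Cell × Cell × Cell)
    finite-Cell⁴ = finite-Cell ×ᶠ finite-Cell ×ᶠ finite-Cell ×ᶠ finite-Cell

  cellOf : Config → ℕ → Cell
  cellOf (config q ts) i = isZero i , q , Vec.map (view i) ts

  δᶜ : Cell → Cell → Cell → Cell → Cell
  δᶜ (_ , q , a) (fˡ , _ , l) (f , q₁ , b) (_ , _ , r) with δ q (Vec.map proj₂ a)
  ... | nothing        = f , q₁ , b
  ... | just (q′ , as) = f , q′ , tabulate λ j → local (lookup as j) fˡ f (lookup l j) (lookup b j) (lookup r j)

  advance : Config → Config
  advance c = Maybe.fromMaybe c (step c)

  heads-view : ∀ {n} (ts : Vec (Tape auxSymbols) n) → Vec.map proj₂ (Vec.map (view 0) ts) ≡ Vec.map Tape.head ts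
  heads-view []       = refl
  heads-view (t ∷ ts) = cong (_ ∷_) (heads-view ts)

  -- Cell 0 holds the state and all scanned symbols, so it determines the action at every cell. For
  -- `i = 0` the left neighbour is cell 0 itself, which does no harm: `local` checks `f` before it
  -- looks to the left.
  cellOf-advance : ∀ c i → cellOf (advance c) i ≡ δᶜ (cellOf c 0) (cellOf c (pred i)) (cellOf c i) (cellOf c (suc i))
  cellOf-advance (config q ts) i rewrite heads-view ts with δ q (Vec.map Tape.head ts)
  ... | nothing        = refl
  ... | just (q′ , as) = cong (λ v → isZero i , q′ , v) (trans (sym (Vec.tabulate∘lookup _)) (Vec.tabulate-cong at-tape))
    where
    at-tape : ∀ j → lookup (Vec.map (view i) (zipWith writeMove ts as)) j ≡
      local (lookup as j) (isZero (pred i)) (isZero i) (lookup (Vec.map (view (pred i)) ts) j)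
        (lookup (Vec.map (view i) ts) j) (lookup (Vec.map (view (suc i)) ts) j)
    at-tape j rewrite Vec.lookup-map j (view i) (zipWith writeMove ts as) | Vec.lookup-zipWith writeMove j ts as
      | Vec.lookup-map j (view (pred i)) ts | Vec.lookup-map j (view i) ts | Vec.lookup-map j (view (suc i)) ts
      = view-writeMove (lookup ts j) (lookup as j) i

  run-advance : ∀ t c → run (suc t) c ≡ advance (run t c)
  run-advance zero    c with step c
  ... | nothing = refl
  ... | just c′ = refl
  run-advance (suc t) c with step c in eq
  ... | just c′ = run-advance t c′
  ... | nothing rewrite eq = refl

  run-extend : ∀ {t c} u → Halted (run t c) → run (u + t) c ≡ run t c
  run-extend         zero    h = refl
  run-extend {t} {c} (suc u) h = trans (run-advance (u + t) c) (trans (cong advance (run-extend u h)) (cong (Maybe.fromMaybe _) h))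

  letter : Bool → Symbol auxSymbols → Cell
  letter f z = f , start , (blank , z) ∷ Vec.replicate extraTapes (blank , blank)

  cellOf-initial : ∀ w i → cellOf (initial w) i ≡ letter (isZero i) (symbol w i)
  cellOf-initial w i = cong (λ v → isZero i , start , v) (cong₂ _∷_ (view-inputTape w i) (empty extraTapes i))
    where
    empty : ∀ n i → Vec.map (view i) (Vec.replicate n emptyTape) ≡ Vec.replicate n (blank , blank)
    empty zero    i       = refl
    empty (suc n) zero    = cong (_ ∷_) (empty n zero)
    empty (suc n) (suc i) = cong (_ ∷_) (empty n (suc i))

  accepting : Cell → Bool
  accepting (_ , _ , v) = isTrue (proj₂ (Vec.head v))

  accepting-output : ∀ c {b} → output c ≡ b ∷ [] → accepting (cellOf c 0) ≡ b
  accepting-output (config q (tp ∷ ts)) e = output-bit tp e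

  -- The table contains (t, i, code of cell i at time t).
  is : ∀ {d} → Tm → Tm → Cell → Fm d
  is t i a = G (t ∷ i ∷ lit (number-of finite-Cell a) ∷ lit 0 ∷ lit 0 ∷ [])

  starts-with : ∀ {d} → Tm → Symbol auxSymbols → Fm d
  starts-with i z = (i ≐ lit 0 ⇒ is (lit 0) i (letter true z)) ⊓ᶠ (∼ (i ≐ lit 0) ⇒ is (lit 0) i (letter false z))

  transition : ∀ {d} → Tm → Tm → Tm → Tm → Cell × Cell × Cell × Cell → Fm d
  transition t l b r (a , l′ , b′ , r′) =
    is t (lit 0) a ⊓ᶠ is t l l′ ⊓ᶠ is t b b′ ⊓ᶠ is t r r′ ⇒ is (lit 1 ⊕ t) b (δᶜ a l′ b′ r′)

  rule : ∀ {d} → Tm → Tm → Tm → Tm → Fm d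
  rule t l b r = ⋀all finite-Cell⁴ (transition t l b r)

  rejecting : ∀ {d} → Tm → Cell → Fm d
  rejecting t a = if accepting a then lit 0 ≐ lit 0 else ∼ is t (lit 0) a

even-or-odd : ∀ i → ∃[ j ] (i ≡ j + j ⊎ i ≡ suc (j + j))
even-or-odd zero = 0 , inj₁ refl
even-or-odd (suc i) with even-or-odd i
... | j , inj₁ e = j , inj₂ (cong suc e)
... | j , inj₂ e = suc j , inj₁ (trans (cong suc e) (cong suc (sym (+-suc j j))))

-- A table may list several symbols for one cell, so one is picked for each position. Once a blank
-- is picked, padding allows blanks at all later positions, and the symbols picked before it form a
-- word.
read-word : ∀ {g} (P : ℕ → Symbol g → Set) n →
  (∀ j → j < n → P j (bit true) ⊎ P j (bit false) ⊎ P j blank) → (∀ j → j < n → P j blank → P (suc j) blank) →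
  P n blank → ∃[ y ] length y ≤ n × ∀ j → j ≤ n → P j (symbol y j)
read-word P zero    choice pad end = [] , z≤n , λ { zero z≤n → end }
read-word P (suc n) choice pad end with read-word (P ∘ suc) n (λ j l → choice (suc j) (s≤s l)) (λ j l → pad (suc j) (s≤s l)) end
                                     | choice 0 (s≤s z≤n)
... | y , y≤ , h | inj₁ p        = true ∷ y , s≤s y≤ , λ { zero _ → p ; (suc j) (s≤s l) → h j l }
... | y , y≤ , h | inj₂ (inj₁ p) = false ∷ y , s≤s y≤ , λ { zero _ → p ; (suc j) (s≤s l) → h j l }
... | y , y≤ , h | inj₂ (inj₂ p) = [] , z≤n , blanks
  where
  blanks : ∀ j → j ≤ suc n → P j blank
  blanks zero    _ = p
  blanks (suc j) l = pad j l (blanks j (<⇒≤ l))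

-- The formula for an accepting computation

Computes : TuringMachine → Polynomial → (Word → Word) → Set
Computes T p f = ∀ w →
  let open TuringMachine T
      c = run (eval p (length w)) (initial w)
  in Halted c × output c ≡ f w

module CookLevin {𝓛 : Language} (verifier : Word → Bool) (T : TuringMachine) (p q : Polynomial)
  (computes : Computes T p (λ w → [ verifier w ]))
  (certified : ∀ x → 𝓛 x ⇔ (∃[ y ] length y ≤ eval q (length x) × verifier (pair x y) ≡ true)) where

  open TuringMachine T
  open Trace T

  N Y Len τ W : Tm
  N   = var 1
  Y   = polyTm q N
  Len = N ⊕ N ⊕ lit 1 ⊕ Y
  τ   = polyTm p Len
  -- A cell depends on its right neighbour one step earlier, so the part of a row that is known
  -- shrinks by one cell per step. With `τ` spare cells, cell 0 is still known at time `τ`.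
  W   = Len ⊕ τ

  -- Row 0 is to be `pair x y`: `phase₁` and `phase₂` fix the doubled bits of `x` and the separator,
  -- `phase₃` and `phase₄` leave `y` free up to its length bound, and `phase₅` supplies blanks.
  phase₁ phase₂ phase₃ phase₄ phase₅ phase₆ phase₇ φ : Fm 2
  phase₁ = ⋀[ j < N ] starts-with (j ⊕ j) (bit true)
             ⊓ᶠ (X j ⇒ starts-with (lit 1 ⊕ (j ⊕ j)) (bit true)) ⊓ᶠ (∼ X j ⇒ starts-with (lit 1 ⊕ (j ⊕ j)) (bit false))
  phase₂ = starts-with (N ⊕ N) (bit false)
  phase₃ = ⋀[ j < Y ] starts-with (N ⊕ N ⊕ lit 1 ⊕ j) (bit true) ⊔ᶠ starts-with (N ⊕ N ⊕ lit 1 ⊕ j) (bit false)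
             ⊔ᶠ starts-with (N ⊕ N ⊕ lit 1 ⊕ j) blank
  phase₄ = ⋀[ j < Y ] (starts-with (N ⊕ N ⊕ lit 1 ⊕ j) blank ⇒ starts-with (N ⊕ N ⊕ lit 1 ⊕ (lit 1 ⊕ j)) blank)
  phase₅ = ⋀[ i < lit 1 ⊕ W ] (∼ (i ⊏ Len) ⇒ starts-with i blank)
  phase₆ = ⋀[ t < τ ] rule t (lit 0) (lit 0) (lit 1) ⊓ᶠ (⋀[ j < W ] rule t j (lit 1 ⊕ j) (lit 2 ⊕ j))
  -- The rules force the true contents of cell 0 into the table but exclude no others. Hence every
  -- rejecting content must be absent; the presence of an accepting one would prove nothing.
  phase₇ = ⋀all finite-Cell (rejecting τ)
  φ      = phase₁ ⊓ᶠ phase₂ ⊓ᶠ phase₃ ⊓ᶠ phase₄ ⊓ᶠ phase₅ ⊓ᶠ phase₆ ⊓ᶠ phase₇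

  module _ (x : Word) where

    n len τ′ w′ : ℕ
    n   = length x
    len = n + n + 1 + eval q n
    τ′  = eval p len
    w′  = len + τ′

    module _ {d : ℕ} (ρ : Vec ℕ d) (ρ-n : get ρ 1 ≡ n) where

      value-Y : value Y ρ ≡ eval q n
      value-Y = trans (value-polyTm q N ρ) (cong (eval q) ρ-n)

      value-Len : value Len ρ ≡ len
      value-Len = cong₂ (λ n y → n + n + 1 + y) ρ-n value-Y

      value-τ : value τ ρ ≡ τ′
      value-τ = trans (value-polyTm p Len ρ) (cong (eval p) value-Len)

      value-W : value W ρ ≡ w′
      value-W = cong₂ _+_ value-Len value-τ

    ρ : ℕ → Vec ℕ 2
    ρ l = n ∷ l ∷ []

    conf : Word → ℕ → Config
    conf y t = run t (initial (pair x y))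

    conf-advance : ∀ y t i → cellOf (conf y (suc t)) i ≡
      δᶜ (cellOf (conf y t) 0) (cellOf (conf y t) (pred i)) (cellOf (conf y t) i) (cellOf (conf y t) (suc i))
    conf-advance y t i = trans (cong (λ c → cellOf c i) (run-advance t (initial (pair x y)))) (cellOf-advance (conf y t) i)

    -- `τ′` is the running time allowed for the longest certificate. A shorter one halts earlier,
    -- and its configuration no longer changes.
    accepting-conf : ∀ y → length y ≤ eval q n → accepting (cellOf (conf y τ′) 0) ≡ verifier (pair x y)
    accepting-conf y y≤ = accepting-output (conf y τ′) (trans (cong output same) (proj₂ (computes (pair x y))))
      where
      t₀ = eval p (length (pair x y))
      t₀≤ : t₀ ≤ τ′
      t₀≤ = eval-mono p (≤-trans (≤-reflexive (length-pair x y))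
        (≤-trans (+-monoʳ-≤ (n + n) (s≤s y≤)) (≤-reflexive (sym (+-assoc (n + n) 1 (eval q n))))))
      same : conf y τ′ ≡ conf y t₀
      same = trans (cong (conf y) (sym (m∸n+n≡m t₀≤))) (run-extend (τ′ ∸ t₀) (proj₁ (computes (pair x y))))

    module Sound (l : ℕ) (g : Table) (h : ⟦ φ ⟧ x g (ρ l)) where

      In : ℕ → ℕ → Cell → Set
      In t i a = g (t ∷ i ∷ number-of finite-Cell a ∷ 0 ∷ 0 ∷ []) ≡ true

      Starts : ℕ → Symbol auxSymbols → Set
      Starts i z = In 0 i (letter (isZero i) z)

      starts : ∀ {d} (ρ : Vec ℕ d) i z → ⟦ starts-with i z ⟧ x g ρ → Starts (value i ρ) z
      starts ρ i z (f , f′) with value i ρ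
      ... | zero  = f refl
      ... | suc _ = f′ λ ()

      h₁ = proj₁ h
      h₂ = proj₁ (proj₂ h)
      h₃ = proj₁ (proj₂ (proj₂ h))
      h₄ = proj₁ (proj₂ (proj₂ (proj₂ h)))
      h₅ = proj₁ (proj₂ (proj₂ (proj₂ (proj₂ h))))
      h₆ = proj₁ (proj₂ (proj₂ (proj₂ (proj₂ (proj₂ h)))))
      h₇ = proj₂ (proj₂ (proj₂ (proj₂ (proj₂ (proj₂ h)))))

      beyond : ∀ i → i ≤ w′ → len ≤ i → Starts i blank
      beyond i i≤ len≤ = starts (i ∷ ρ l) (var 2) blank (h₅ i (s≤s (≤-trans i≤ (≤-reflexive (sym (value-W (ρ l) refl)))))
        λ i< → <⇒≱ i< (≤-trans (≤-reflexive (value-Len (i ∷ ρ l) refl)) len≤))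

      len≤w : len ≤ w′
      len≤w = m≤m+n len τ′

      certificate : ∃[ y ] length y ≤ eval q n × ∀ j → j ≤ eval q n → Starts (n + n + 1 + j) (symbol y j)
      certificate = read-word (λ j → Starts (n + n + 1 + j)) (eval q n)
        (λ j j< → [ inj₁ ∘ starts (j ∷ ρ l) b _ , [ inj₂ ∘ inj₁ ∘ starts (j ∷ ρ l) b _ , inj₂ ∘ inj₂ ∘ starts (j ∷ ρ l) b _ ]′ ]′ (h₃ j (≤-trans j< (≤-reflexive (sym (value-Y (ρ l) refl))))))
        (λ j j< p → starts (j ∷ ρ l) b′ blank (h₄ j (≤-trans j< (≤-reflexive (sym (value-Y (ρ l) refl)))) (again j p)))
        (beyond len len≤w ≤-refl)
        where
        b b′ : Tm
        b  = N ⊕ N ⊕ lit 1 ⊕ var 2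
        b′ = N ⊕ N ⊕ lit 1 ⊕ (lit 1 ⊕ var 2)
        again : ∀ j → Starts (n + n + 1 + j) blank → ⟦ starts-with b blank ⟧ x g (j ∷ ρ l)
        again j p with n + n + 1 + j
        ... | zero  = (λ _ → p) , λ ne → ⊥-elim (ne refl)
        ... | suc _ = (λ ()) , λ _ → p

      y = proj₁ certificate

      initial-cells : ∀ i → i ≤ w′ → Starts i (symbol (pair x y) i)
      initial-cells i i≤ with <-cmp i (n + n)
      initial-cells i i≤ | tri< i< _ _ with even-or-odd i
      ... | j , inj₁ refl = subst (Starts (j + j)) (sym (symbol-even x y j j<)) (starts (j ∷ ρ l) (var 2 ⊕ var 2) _ (proj₁ (h₁ j j<)))
        where
        j< : j < n
        j< = ≰⇒> λ n≤j → <⇒≱ i< (+-mono-≤ n≤j n≤j)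
      ... | j , inj₂ refl = subst (Starts (suc (j + j))) (sym (symbol-odd x y j j<)) (bit-case (proj₂ (h₁ j j<)))
        where
        j< : j < n
        j< = ≰⇒> λ n≤j → <⇒≱ i< (m≤n⇒m≤1+n (+-mono-≤ n≤j n≤j))
        bit-case : ⟦ (X (var 2) ⇒ starts-with (lit 1 ⊕ (var 2 ⊕ var 2)) (bit true)) ⊓ᶠ (∼ X (var 2) ⇒ starts-with (lit 1 ⊕ (var 2 ⊕ var 2)) (bit false)) ⟧ x g (j ∷ ρ l) →
          Starts (suc (j + j)) (bit (bit-at x j))
        bit-case (f , f′) with bit-at x j
        ... | true  = starts (j ∷ ρ l) (lit 1 ⊕ (var 2 ⊕ var 2)) (bit true) (f refl)
        ... | false = starts (j ∷ ρ l) (lit 1 ⊕ (var 2 ⊕ var 2)) (bit false) (f′ λ ())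
      initial-cells i i≤ | tri≈ _ refl _ = subst (Starts (n + n)) (sym (symbol-separator x y)) (starts (ρ l) (N ⊕ N) _ h₂)
      initial-cells i i≤ | tri> _ _ i> = subst₂ Starts eq (sym (trans (cong (symbol (pair x y)) (sym eq)) (symbol-second x y v))) (second (v ≤? eval q n))
        where
        v = i ∸ (n + n + 1)
        eq : n + n + 1 + v ≡ i
        eq = m+[n∸m]≡n (≤-trans (≤-reflexive (+-comm (n + n) 1)) i>)
        second : Dec (v ≤ eval q n) → Starts (n + n + 1 + v) (symbol y v)
        second (yes v≤) = proj₂ (proj₂ certificate) v v≤
        second (no  v≰) = subst (Starts _) (sym (symbol-beyond y v (≤-trans (proj₁ (proj₂ certificate)) (<⇒≤ (≰⇒> v≰)))))
          (beyond _ (≤-trans (≤-reflexive eq) i≤) (+-monoʳ-≤ (n + n + 1) (<⇒≤ (≰⇒> v≰))))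

      cells : ∀ t → t ≤ τ′ → ∀ i → i + t ≤ w′ → In t i (cellOf (conf y t) i)
      cells zero    t≤ i i≤ = subst (In 0 i) (sym (cellOf-initial (pair x y) i)) (initial-cells i (≤-trans (≤-reflexive (sym (+-identityʳ i))) i≤))
      cells (suc t) t≤ i i≤ = subst (In (suc t) i) (sym (conf-advance y t i)) (apply i i≤)
        where
        c = cellOf (conf y t)
        previous : ∀ i → i + t ≤ w′ → In t i (c i)
        previous = cells t (<⇒≤ t≤)
        rules = h₆ t (≤-trans t≤ (≤-reflexive (sym (value-τ (ρ l) refl))))
        apply : ∀ i → i + suc t ≤ w′ → In (suc t) i (δᶜ (c 0) (c (pred i)) (c i) (c (suc i)))
        apply zero    i≤ = ⋀all-elim finite-Cell⁴ (transition (var 2) (lit 0) (lit 0) (lit 1)) (proj₁ rules) (c 0 , c 0 , c 0 , c 1)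
          (previous 0 (<⇒≤ i≤) , previous 0 (<⇒≤ i≤) , previous 0 (<⇒≤ i≤) , previous 1 i≤)
        apply (suc j) i≤ = ⋀all-elim finite-Cell⁴ (transition (var 2) (var 3) (lit 1 ⊕ var 3) (lit 2 ⊕ var 3))
          (proj₂ rules j (≤-trans j<w (≤-reflexive (sym (value-W (t ∷ ρ l) refl))))) (c 0 , c j , c (suc j) , c (2 + j))
          (previous 0 (≤-trans (m≤n+m t (2 + j)) i≤′) , previous j (<⇒≤ (<⇒≤ i≤′)) , previous (suc j) (<⇒≤ i≤′) , previous (2 + j) i≤′)
          where
          i≤′ : 2 + j + t ≤ w′
          i≤′ = ≤-trans (≤-reflexive (cong suc (sym (+-suc j t)))) i≤
          j<w : j < w′
          j<w = ≤-trans (m≤m+n (suc j) (suc t)) i≤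

      member : 𝓛 x
      member = Equivalence.from (certified x) (y , proj₁ (proj₂ certificate) , trans (sym (accepting-conf y (proj₁ (proj₂ certificate)))) final)
        where
        a = cellOf (conf y τ′) 0
        final : accepting a ≡ true
        final with accepting a | ⋀all-elim finite-Cell (rejecting τ) h₇ a
        ... | true  | _ = refl
        ... | false | no-a = ⊥-elim (no-a (subst (λ t → In t 0 a) (sym (value-τ (ρ l) refl)) (cells τ′ ≤-refl 0 (m≤n+m τ′ len))))

    module Complete (y : Word) (y≤ : length y ≤ eval q n) (accepted : verifier (pair x y) ≡ true) where

      Listed : Vec ℕ 5 → Set
      Listed (t ∷ i ∷ a ∷ u ∷ v ∷ []) =
        t ≤ τ′ × i ≤ suc w′ × a ≡ number-of finite-Cell (cellOf (conf y t) i) × u ≡ 0 × v ≡ 0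

      Listed? : ∀ as → Dec (Listed as)
      Listed? (t ∷ i ∷ a ∷ u ∷ v ∷ []) =
        t ≤? τ′ ×-dec i ≤? suc w′ ×-dec a ≟ number-of finite-Cell (cellOf (conf y t) i) ×-dec u ≟ 0 ×-dec v ≟ 0

      g : Table
      g as = does (Listed? as)

      listed : ∀ as → g as ≡ true → Listed as
      listed as e with yes p ← Listed? as = p

      supported : ∀ {D} → 3 + card finite-Cell + w′ ≤ D → Supported D g
      supported D≥ as@(t ∷ i ∷ a ∷ u ∷ v ∷ []) e with listed as e
      ... | t≤ , i≤ , refl , refl , refl =
        fits′ (s≤s (≤-trans t≤ (≤-trans (m≤n+m τ′ len) (m≤n+m w′ (2 + card finite-Cell))))) All.∷
        fits′ (s≤s (≤-trans i≤ (s≤s (m≤n+m w′ (1 + card finite-Cell))))) All.∷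
        fits′ (m<n⇒m<o+n 3 (≤-trans (Fin.toℕ<n (code finite-Cell (cellOf (conf y t) i))) (m≤m+n (card finite-Cell) w′))) All.∷
        fits′ (s≤s z≤n) All.∷ fits′ (s≤s z≤n) All.∷ All.[]
        where
        fits′ : ∀ {v} → v < 3 + card finite-Cell + w′ → v < _
        fits′ l = ≤-trans l D≥
        m<n⇒m<o+n : ∀ {m n} o → m < n → m < o + n
        m<n⇒m<o+n o l = ≤-trans l (m≤n+m _ o)

      In : ℕ → ℕ → Cell → Set
      In t i a = g (t ∷ i ∷ number-of finite-Cell a ∷ 0 ∷ 0 ∷ []) ≡ true

      in-intro : ∀ t i {a} → t ≤ τ′ → i ≤ suc w′ → cellOf (conf y t) i ≡ a → In t i a
      in-intro t i t≤ i≤ refl = dec-true (Listed? _) (t≤ , i≤ , refl , refl , refl)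

      in-elim : ∀ t i {a} → In t i a → cellOf (conf y t) i ≡ a
      in-elim t i {a} e =
        let c = cellOf (conf y t) i
            (_ , _ , eq , _) = listed (t ∷ i ∷ number-of finite-Cell a ∷ 0 ∷ 0 ∷ []) e
        in sym (trans (sym (decode-code finite-Cell a)) (trans (cong (decode finite-Cell) (Fin.toℕ-injective eq)) (decode-code finite-Cell c)))

      s : ℕ → Symbol auxSymbols
      s = symbol (pair x y)

      starts : ∀ {d} (ρ : Vec ℕ d) i {z} → value i ρ ≤ suc w′ → s (value i ρ) ≡ z → ⟦ starts-with i z ⟧ x g ρ
      starts ρ i i≤ refl with value i ρ | in-intro 0 (value i ρ) z≤n i≤ (cellOf-initial (pair x y) (value i ρ))
      ... | zero  | p = (λ _ → p) , λ ne → ⊥-elim (ne refl)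
      ... | suc _ | p = (λ ()) , λ _ → p

      starts-elim : ∀ {d} (ρ : Vec ℕ d) i {z} → ⟦ starts-with i z ⟧ x g ρ → s (value i ρ) ≡ z
      starts-elim ρ i {z} (f , f′) = letter-injective (trans (sym (cellOf-initial (pair x y) (value i ρ))) (in-elim 0 (value i ρ) (start′ f f′)))
        where
        start′ : (value i ρ ≡ 0 → In 0 (value i ρ) (letter true z)) → (value i ρ ≢ 0 → In 0 (value i ρ) (letter false z)) →
          In 0 (value i ρ) (letter (isZero (value i ρ)) z)
        start′ f f′ with value i ρ
        ... | zero  = f refl
        ... | suc _ = f′ λ ()
        letter-injective : ∀ {f z z′} → letter f z ≡ letter f z′ → z ≡ z′
        letter-injective refl = refl

      len≤ : len ≤ suc w′
      len≤ = m≤n⇒m≤1+n (m≤m+n len τ′)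

      base≤ : ∀ {j} → j ≤ eval q n → n + n + 1 + j ≤ suc w′
      base≤ j≤ = ≤-trans (+-monoʳ-≤ (n + n + 1) j≤) len≤

      n+n≤ : suc (n + n) ≤ suc w′
      n+n≤ = ≤-trans (≤-reflexive (sym (trans (+-identityʳ _) (+-comm (n + n) 1)))) (base≤ z≤n)

      phase₁-holds : ∀ l → ⟦ phase₁ ⟧ x g (ρ l)
      phase₁-holds l j j< =
        starts ρ′ (var 2 ⊕ var 2) (≤-trans (<⇒≤ (<⇒≤ odd<)) n+n≤) (symbol-even x y j j<) ,
        (λ e → starts ρ′ (lit 1 ⊕ (var 2 ⊕ var 2)) (≤-trans (<⇒≤ odd<) n+n≤) (trans (symbol-odd x y j j<) (cong bit e))) ,
        (λ ne → starts ρ′ (lit 1 ⊕ (var 2 ⊕ var 2)) (≤-trans (<⇒≤ odd<) n+n≤) (trans (symbol-odd x y j j<) (cong bit (Bool.¬-not ne))))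
        where
        ρ′ = j ∷ ρ l
        odd< : suc (suc (j + j)) ≤ suc (n + n)
        odd< = s≤s (+-mono-≤ j< (<⇒≤ j<))

      phase₃-holds : ∀ l → ⟦ phase₃ ⟧ x g (ρ l)
      phase₃-holds l j j< with symbol y j in eq | symbol-second x y j
      ... | bit true  | e = inj₁ (starts (j ∷ ρ l) (N ⊕ N ⊕ lit 1 ⊕ var 2) (base≤ j≤) (trans e eq))
        where j≤ = <⇒≤ (≤-trans j< (≤-reflexive (value-Y (ρ l) refl)))
      ... | bit false | e = inj₂ (inj₁ (starts (j ∷ ρ l) (N ⊕ N ⊕ lit 1 ⊕ var 2) (base≤ j≤) (trans e eq)))
        where j≤ = <⇒≤ (≤-trans j< (≤-reflexive (value-Y (ρ l) refl)))
      ... | blank     | e = inj₂ (inj₂ (starts (j ∷ ρ l) (N ⊕ N ⊕ lit 1 ⊕ var 2) (base≤ j≤) (trans e eq)))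
        where j≤ = <⇒≤ (≤-trans j< (≤-reflexive (value-Y (ρ l) refl)))
      ... | aux _     | e = ⊥-elim (symbol-aux y j eq)
        where
        symbol-aux : ∀ y j {a} → ¬ symbol y j ≡ aux a
        symbol-aux (b ∷ y) (suc j) e = symbol-aux y j e

      phase₄-holds : ∀ l → ⟦ phase₄ ⟧ x g (ρ l)
      phase₄-holds l j j< p = starts (j ∷ ρ l) (N ⊕ N ⊕ lit 1 ⊕ (lit 1 ⊕ var 2)) (base≤ (≤-trans j< (≤-reflexive (value-Y (ρ l) refl))))
        (trans (symbol-second x y (suc j)) (blank-suc y j
          (trans (sym (symbol-second x y j)) (starts-elim (j ∷ ρ l) (N ⊕ N ⊕ lit 1 ⊕ var 2) p))))
        where
        blank-suc : ∀ y j → symbol {auxSymbols} y j ≡ blank → symbol {auxSymbols} y (suc j) ≡ blank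
        blank-suc []      j       e = refl
        blank-suc (b ∷ y) (suc j) e = blank-suc y j e

      phase₅-holds : ∀ l → ⟦ phase₅ ⟧ x g (ρ l)
      phase₅-holds l i i< i≮ = starts (i ∷ ρ l) (var 2) (≤-trans (<⇒≤ i<) (s≤s (≤-reflexive (value-W (ρ l) refl))))
        (symbol-beyond (pair x y) i (≤-trans (≤-reflexive (length-pair x y)) (≤-trans
          (≤-trans (+-monoʳ-≤ (n + n) (s≤s y≤)) (≤-reflexive (sym (+-assoc (n + n) 1 (eval q n)))))
          (≤-trans (≤-reflexive (sym (value-Len (i ∷ ρ l) refl))) (≮⇒≥ i≮)))))

      phase₆-holds : ∀ l → ⟦ phase₆ ⟧ x g (ρ l)
      phase₆-holds l t t< =
        ⋀all-intro finite-Cell⁴ (transition (var 2) (lit 0) (lit 0) (lit 1)) (λ { (a , l′ , b′ , r′) (ha , hl , hb , hr) →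
          in-intro (suc t) 0 t<′ z≤n (trans (conf-advance y t 0) (δ-cong (in-elim t 0 ha) (in-elim t 0 hl) (in-elim t 0 hb) (in-elim t 1 hr))) }) ,
        λ j j< → ⋀all-intro finite-Cell⁴ (transition (var 2) (var 3) (lit 1 ⊕ var 3) (lit 2 ⊕ var 3)) λ { (a , l′ , b′ , r′) (ha , hl , hb , hr) →
          in-intro (suc t) (suc j) t<′ (m≤n⇒m≤1+n (≤-trans j< (≤-reflexive (value-W (t ∷ ρ l) refl))))
            (trans (conf-advance y t (suc j)) (δ-cong (in-elim t 0 ha) (in-elim t j hl) (in-elim t (suc j) hb) (in-elim t (2 + j) hr))) }
        where
        t<′ : t < τ′
        t<′ = ≤-trans t< (≤-reflexive (value-τ (ρ l) refl))
        δ-cong : ∀ {a a′ b b′ c c′ d d′} → a ≡ a′ → b ≡ b′ → c ≡ c′ → d ≡ d′ → δᶜ a b c d ≡ δᶜ a′ b′ c′ d′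
        δ-cong refl refl refl refl = refl

      phase₇-holds : ∀ l → ⟦ phase₇ ⟧ x g (ρ l)
      phase₇-holds l = ⋀all-intro finite-Cell (rejecting τ) rejected
        where
        rejected : ∀ a → ⟦ rejecting τ a ⟧ x g (ρ l)
        rejected a with accepting a in eq
        ... | true  = refl
        ... | false rewrite value-τ (ρ l) refl = λ p → Bool.not-¬ eq
          (trans (cong accepting (sym (in-elim τ′ 0 p))) (trans (accepting-conf y y≤) accepted))

      φ-holds : ∀ l → ⟦ φ ⟧ x g (ρ l)
      φ-holds l = phase₁-holds l , starts (ρ l) (N ⊕ N) (<⇒≤ n+n≤) (symbol-separator x y) , phase₃-holds l , phase₄-holds l ,
        phase₅-holds l , phase₆-holds l , phase₇-holds l

  definable : Definable 𝓛
  definable = record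
    { formula  = φ
    ; side     = proj₁ bound
    ; sound    = λ l x g h → Sound.member x l g h
    ; complete = λ x x∈𝓛 → let (y , y≤ , ok) = Equivalence.to (certified x) x∈𝓛 in
        Complete.g x y y≤ ok , Complete.supported x y y≤ ok (proj₂ bound (length x)) , Complete.φ-holds x y y≤ ok
    }
    where
    length-poly : IsPoly (λ n → n + n + 1 + eval q n)
    length-poly = poly-id poly-+ poly-id poly-+ poly-const 1 poly-+ (q , λ _ → ≤-refl)
    bound : IsPoly (λ n → 3 + card finite-Cell + (n + n + 1 + eval q n + eval p (n + n + 1 + eval q n)))
    bound = poly-const (3 + card finite-Cell) poly-+ (length-poly poly-+ poly-∘ {eval p} (p , λ _ → ≤-refl) length-poly)

NP⇒definable : ∀ {𝓛} → NP 𝓛 → Definable 𝓛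
NP⇒definable (verifier , (T , p , computes) , q , certified) = CookLevin.definable verifier T p q computes certified

-- Model checking

-- Each unstable stage loses a state, so `∣ stage r ∣ + r ≤ n` as long as no stable stage has
-- occurred. This is impossible for `r = suc n`.
stabilises : ∀ {n} (D : ℕ → Fin n → Set) → (∀ r s → Dec (D r s)) → (∀ r s → D (suc r) s → D r s) →
  ∃[ r ] r ≤ n × (∀ s → D r s → D (suc r) s)
stabilises {n} D D? anti = [ id , (λ l → ⊥-elim (<⇒≱ ≤-refl (≤-trans (m≤n+m (suc n) ∣ stage (suc n) ∣) l))) ]′ (search (suc n) ≤-refl)
  where
  stage : ℕ → Subset n
  stage r = tabulate λ s → does (D? r s)
  ∈-stage : ∀ {r s} → D r s → s ∈ stage r
  ∈-stage {r} {s} d = Vec.lookup⇒[]= s _ (trans (Vec.lookup∘tabulate _ s) (dec-true (D? r s) d))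
  stage-∈ : ∀ {r s} → s ∈ stage r → D r s
  stage-∈ {r} {s} e with D? r s | trans (sym (Vec.lookup∘tabulate (λ s → does (D? r s)) s)) (Vec.[]=⇒lookup e)
  ... | yes d | _ = d
  Stable : ℕ → Set
  Stable r = ∀ s → D r s → D (suc r) s
  search : ∀ r → r ≤ suc n → (∃[ r′ ] r′ ≤ n × Stable r′) ⊎ ∣ stage r ∣ + r ≤ n
  search zero    _ = inj₂ (≤-trans (≤-reflexive (+-identityʳ _)) (Subset.∣p∣≤n (stage 0)))
  search (suc r) (s≤s r≤) with search r (m≤n⇒m≤1+n r≤)
  ... | inj₁ found = inj₁ found
  ... | inj₂ l with Fin.any? (λ s → D? r s ×-dec ¬? (D? (suc r) s))
  ...   | no none = inj₁ (r , r≤ , λ s d → decidable-stable (D? (suc r) s) λ nd → none (s , d , nd))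
  ...   | yes (s , d , nd) = inj₂ (≤-trans (≤-reflexive (+-suc _ r)) (≤-trans (+-monoˡ-≤ r (Subset.p⊂q⇒∣p∣<∣q∣
            ((λ e → ∈-stage (anti r _ (stage-∈ e))) , s , ∈-stage d , nd ∘ stage-∈))) l))

lastOf : {A : Set} → A → List A → A
lastOf d []      = d
lastOf d (a ∷ w) = lastOf a w

lastOf-∷ʳ : {A : Set} (d : A) (w : List A) {s : A} → lastOf d (w ∷ʳ s) ≡ s
lastOf-∷ʳ d []      = refl
lastOf-∷ʳ d (a ∷ w) = lastOf-∷ʳ a w

linked-∷ʳ : {A : Set} {R : A → A → Set} (w : List A) {s t : A} → Linked R (w ∷ʳ s) → R s t → Linked R ((w ∷ʳ s) ∷ʳ t)
linked-∷ʳ []          _        r = r Linked.∷ Linked.[-]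
linked-∷ʳ (a ∷ [])    (q Linked.∷ l) r = q Linked.∷ linked-∷ʳ [] l r
linked-∷ʳ (a ∷ b ∷ w) (q Linked.∷ l) r = q Linked.∷ linked-∷ʳ (b ∷ w) l r

-- Strategies, outcomes and the fixpoint characterisation

module Game {n p k : ℕ} (M : GameStructure n p k) (total : GameStructure.Total M) where
  open GameStructure M

  successor : Fin n → Fin n
  successor s with s ∈? S
  ... | yes s∈S = proj₁ (total s∈S)
  ... | no  _   = s₀

  ⟶-successor : ∀ {s} → s ∈ S → s ⟶ successor s
  ⟶-successor {s} s∈S with s ∈? S
  ... | yes s∈S′ = proj₂ (total s∈S′)
  ... | no  s∉S  = ⊥-elim (s∉S s∈S)

  ⟶-source : ∀ {s t} → s ⟶ t → s ∈ S
  ⟶-source r = proj₁ (R⊆S×S r)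

  ⟶-target : ∀ {s t} → s ⟶ t → t ∈ S
  ⟶-target r = proj₂ (R⊆S×S r)

  Legal : (ℕ → Fin n → Fin n) → Set
  Legal f = ∀ m s → s ∈ S → s ⟶ f m s

  -- A strategy that depends only on the current state and on the length of the
  -- path so far.
  strategy : (f : ℕ → Fin n → Fin n) → Legal f → Strategy
  strategy f legal = record
    { move  = λ w → f (length w) (lastOf s₀ w)
    ; legal = λ {w} {s} (in-S , _) → subst (λ u → s ⟶ f (length (w ∷ʳ s)) u) (sym (lastOf-∷ʳ s₀ w))
        (legal _ s (proj₂ (ListAll.∷ʳ⁻ in-S))) }

  abstract
    -- A strategy must be legal on every path, including those on which no desired successor exists;
    -- there it falls back to `successor`.
    prefer : (P : ℕ → Fin n → Fin n → Set) → (∀ m s → Dec (∃[ t ] s ⟶ t × P m s t)) → ℕ → Fin n → Fin n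
    prefer P r m s with r m s
    ... | yes (t , _) = t
    ... | no  _       = successor s

    prefer-legal : (P : ℕ → Fin n → Fin n → Set) (r : ∀ m s → Dec (∃[ t ] s ⟶ t × P m s t)) → Legal (prefer P r)
    prefer-legal P r m s s∈S with r m s
    ... | yes (_ , s⟶t , _) = s⟶t
    ... | no  _             = ⟶-successor s∈S

    prefer-good : (P : ℕ → Fin n → Fin n → Set) (r : ∀ m s → Dec (∃[ t ] s ⟶ t × P m s t)) → ∀ m s {t} → s ⟶ t → P m s t → P m s (prefer P r m s)
    prefer-good P r m s s⟶t q with r m s
    ... | yes (_ , _ , q′) = q′
    ... | no  none         = ⊥-elim (none (_ , s⟶t , q))

  -- What a winning strategy implies about `s` is read off one of its outcomes, which is constructed
  -- here. One `opponent` moves for all players outside `A`, and the history is carried along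
  -- because moves may depend on all of it.
  module Play {A : Subset k} (F : StrategyFor A) (opponent : Strategy) {s : Fin n} (s∈S : s ∈ S) where

    advance : List (Fin n) → Fin n → Fin n
    advance w u with lookup σ u ∈? A
    ... | yes a∈A = Strategy.move (F (lookup σ u) a∈A) (w ∷ʳ u)
    ... | no  _   = Strategy.move opponent (w ∷ʳ u)

    history : ℕ → List (Fin n) × Fin n
    history zero    = [] , s
    history (suc i) = let (w , u) = history i in w ∷ʳ u , advance w u

    π : ℕ → Fin n
    π i = proj₂ (history i)

    prefix : ∀ i → applyUpTo π i ≡ proj₁ (history i)
    prefix zero    = refl
    prefix (suc i) = trans (sym (List.applyUpTo-∷ʳ π i)) (cong (_∷ʳ π i) (prefix i))

    advance-legal : ∀ w u → FinitePath (w ∷ʳ u) → u ⟶ advance w u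
    advance-legal w u path with lookup σ u ∈? A
    ... | yes a∈A = Strategy.legal (F (lookup σ u) a∈A) path
    ... | no  _   = Strategy.legal opponent path

    finitePath : ∀ i → FinitePath (proj₁ (history i) ∷ʳ π i)
    finitePath zero    = s∈S ListAll.∷ ListAll.[] , Linked.[-]
    finitePath (suc i) =
      let (w , u) = history i
          path    = finitePath i
          u⟶t     = advance-legal w u path
      in ListAll.∷ʳ⁺ (proj₁ path) (⟶-target u⟶t) , linked-∷ʳ w (proj₂ path) u⟶t

    outcome : Out s F π
    outcome = record
      { fullPath = λ i → advance-legal _ _ (finitePath i)
      ; starts   = refl
      ; follows  = λ i a∈A → trans (own (proj₁ (history i)) (π i) a∈A)
          (cong (Strategy.move (F (lookup σ (π i)) a∈A)) (sym (prefix (suc i)))) }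
      where
      own : ∀ w u (a∈A : lookup σ u ∈ A) → advance w u ≡ Strategy.move (F (lookup σ u) a∈A) (w ∷ʳ u)
      own w u a∈A with lookup σ u ∈? A
      -- `F` receives the membership proof as an argument, so the two strategies coincide only
      -- because such proofs are equal.
      ... | yes a∈A′ = cong (λ a → Strategy.move (F (lookup σ u) a) (w ∷ʳ u)) ([]=-irrelevant a∈A′ a∈A)
      ... | no  a∉A  = ⊥-elim (a∉A a∈A)

    opponent-moves : ∀ i → lookup σ (π i) ∉ A → π (suc i) ≡ Strategy.move opponent (applyUpTo π (suc i))
    opponent-moves i a∉A = trans (other (proj₁ (history i)) (π i) a∉A) (cong (Strategy.move opponent) (sym (prefix (suc i))))
      where
      other : ∀ w u → lookup σ u ∉ A → advance w u ≡ Strategy.move opponent (w ∷ʳ u)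
      other w u a∉A with lookup σ u ∈? A
      ... | yes a∈A = ⊥-elim (a∉A a∈A)
      ... | no  _   = refl

  strategy-move : ∀ f (legal : Legal f) π i → Strategy.move (strategy f legal) (applyUpTo π (suc i)) ≡ f (suc i) (π i)
  strategy-move f legal π i = cong₂ f (List.length-applyUpTo π (suc i))
    (trans (cong (lastOf s₀) (sym (List.applyUpTo-∷ʳ π i))) (lastOf-∷ʳ s₀ (applyUpTo π i)))

  -- The controllable predecessor of `Z`: as the game is turn-based, the coalition either chooses
  -- the successor or has no influence on it.
  Controls : Subset k → (Fin n → Set) → Fin n → Set
  Controls A Z s = (lookup σ s ∈ A → ∃[ t ] s ⟶ t × Z t) × (lookup σ s ∉ A → ∀ t → s ⟶ t → Z t)

  Controls-dec : ∀ A {Z} → (∀ s → Dec (Z s)) → ∀ s → Dec (Controls A Z s)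
  Controls-dec A Z? s = (lookup σ s ∈? A →-dec Fin.any? λ t → t ∈? lookup R s ×-dec Z? t) ×-dec
    (¬? (lookup σ s ∈? A) →-dec Fin.all? λ t → t ∈? lookup R s →-dec Z? t)

  Controls-mono : ∀ A {Z Z′ : Fin n → Set} → (∀ s → Z s → Z′ s) → ∀ s → Controls A Z s → Controls A Z′ s
  Controls-mono A h s (own , other) = (λ a → let (t , r , z) = own a in t , r , h t z) , λ a t r → h t (other a t r)

  X-correct : ∀ A {Z : Fin n → Set} → (∀ s → Dec (Z s)) → ∀ {s} → s ∈ S →
    (Σ[ F ∈ StrategyFor A ] ∀ π → Out s F π → Z (π 1)) ⇔ Controls A Z s
  X-correct A {Z} Z? {s} s∈S = mk⇔ to from
    where
    to : (Σ[ F ∈ StrategyFor A ] ∀ π → Out s F π → Z (π 1)) → Controls A Z s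
    to (F , win) = own , other
      where
      own : lookup σ s ∈ A → ∃[ t ] s ⟶ t × Z t
      own a∈A = π 1 , Out.fullPath outcome 0 , win π outcome
        where open Play F (strategy (λ _ → successor) λ _ _ → ⟶-successor) s∈S
      other : lookup σ s ∉ A → ∀ t → s ⟶ t → Z t
      other a∉A t s⟶t = subst Z (trans (opponent-moves 0 a∉A) (prefer-good (λ _ _ t′ → t′ ≡ t) to-t 1 s s⟶t refl)) (win π outcome)
        where
        to-t : ∀ (_ : ℕ) u → Dec (∃[ t′ ] u ⟶ t′ × t′ ≡ t)
        to-t _ u = Fin.any? λ t′ → t′ ∈? lookup R u ×-dec t′ Fin.≟ t
        open Play F (strategy (prefer (λ _ _ t′ → t′ ≡ t) to-t) (prefer-legal (λ _ _ t′ → t′ ≡ t) to-t)) s∈S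
    from : Controls A Z s → Σ[ F ∈ StrategyFor A ] ∀ π → Out s F π → Z (π 1)
    from (own , other) = (λ _ _ → strategy (prefer (λ _ _ → Z) to-Z) (prefer-legal (λ _ _ → Z) to-Z)) , λ π o → win π o (lookup σ s ∈? A)
      where
      to-Z : ∀ (_ : ℕ) u → Dec (∃[ t ] u ⟶ t × Z t)
      to-Z _ u = Fin.any? λ t → t ∈? lookup R u ×-dec Z? t
      win : ∀ π → Out s _ π → Dec (lookup σ s ∈ A) → Z (π 1)
      win π o (yes a∈A) with Out.starts o
      ... | refl = let (t , r , z) = own a∈A in
        subst Z (sym (trans (Out.follows o 0 a∈A) (strategy-move (prefer (λ _ _ → Z) to-Z) (prefer-legal (λ _ _ → Z) to-Z) π 0))) (prefer-good (λ _ _ → Z) to-Z 1 s r z)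
      win π o (no  a∉A) = other a∉A (π 1) (subst (_⟶ π 1) (Out.starts o) (Out.fullPath o 0))

  -- The stages of the greatest fixpoint that characterises ⟪ A ⟫[ P V Q ].
  Stage : Subset k → (P Q : Fin n → Set) → ℕ → Fin n → Set
  Stage A P Q zero    s = ⊤
  Stage A P Q (suc r) s = Q s × (P s ⊎ Controls A (Stage A P Q r) s)

  module Release (A : Subset k) {P Q : Fin n → Set} (P? : ∀ s → Dec (P s)) (Q? : ∀ s → Dec (Q s)) where

    Z : ℕ → Fin n → Set
    Z = Stage A P Q

    Z? : ∀ r s → Dec (Z r s)
    Z? zero    s = yes _
    Z? (suc r) s = Q? s ×-dec (P? s ⊎-dec Controls-dec A (Z? r) s)

    Z-step : ∀ {r r′} → (∀ s → Z r s → Z r′ s) → ∀ s → Z (suc r) s → Z (suc r′) s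
    Z-step h s (q , inj₁ p) = q , inj₁ p
    Z-step h s (q , inj₂ c) = q , inj₂ (Controls-mono A h s c)

    Z-anti : ∀ r s → Z (suc r) s → Z r s
    Z-anti zero    s z = _
    Z-anti (suc r) s z = Z-step (Z-anti r) s z

    Z-stable : ∀ s → Z n s → Z (suc n) s
    Z-stable with stabilises Z Z? Z-anti
    ... | r , r≤n , stable = subst (λ m → ∀ s → Z m s → Z (suc m) s) (m∸n+n≡m r≤n) (later (n ∸ r))
      where
      later : ∀ d s → Z (d + r) s → Z (suc (d + r)) s
      later zero    = stable
      later (suc d) = Z-step (later d)

    Wins : Fin n → Set
    Wins s = Σ[ F ∈ StrategyFor A ] ∀ π → Out s F π → ∀ i → (∀ j → j < i → ¬ P (π j)) → Q (π i)

    -- Stage `n` is stable, so from each of its states where `P` fails the coalition can remain in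
    -- it. The memoryless strategy that does so keeps `Q` true until `P` has released it.
    wins : ∀ {s} → Z n s → Wins s
    wins {s} z₀ = (λ _ _ → strategy (prefer (λ _ _ → Z n) to-Z) (prefer-legal (λ _ _ → Z n) to-Z)) , λ π o i ¬P → proj₁ (Z-stable (π i) (stays π o i ¬P))
      where
      to-Z : ∀ (_ : ℕ) u → Dec (∃[ t ] u ⟶ t × Z n t)
      to-Z _ u = Fin.any? λ t → t ∈? lookup R u ×-dec Z? n t
      stays : ∀ π → Out s _ π → ∀ i → (∀ j → j < i → ¬ P (π j)) → Z n (π i)
      stays π o zero    ¬P = subst (Z n) (sym (Out.starts o)) z₀
      stays π o (suc i) ¬P with Z-stable (π i) (stays π o i λ j j< → ¬P j (m<n⇒m<1+n j<)) | lookup σ (π i) ∈? A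
      ... | _ , inj₁ p             | _       = ⊥-elim (¬P i ≤-refl p)
      ... | _ , inj₂ (own , _)     | yes a∈A = let (t , r , z) = own a∈A in
        subst (Z n) (sym (trans (Out.follows o i a∈A) (strategy-move (prefer (λ _ _ → Z n) to-Z) (prefer-legal (λ _ _ → Z n) to-Z) π i))) (prefer-good (λ _ _ → Z n) to-Z (suc i) (π i) r z)
      ... | _ , inj₂ (_ , other)   | no  a∉A = other a∉A (π (suc i)) (Out.fullPath o i)

    -- The play is kept outside stage `n ∸ i` at each time `i ≤ n`. While it is, `P` fails, because
    -- `Q` holds by the assumption that `F` wins. At time `n` this contradicts stage 0 being
    -- everything. The length of the path so far is the time of the next state, so it names the
    -- stage to be avoided.
    loses : ∀ {s} → s ∈ S → ¬ Z n s → ¬ Wins s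
    loses {s} s∈S ¬z (F , win) = proj₂ (invariant n ≤-refl) (subst (λ r → Z r (π n)) (sym (n∸n≡0 n)) _)
      where
      -- At time m the opponent moves out of stage n ∸ m whenever this is possible.
      out-of-Z : ∀ m u → Dec (∃[ t ] u ⟶ t × ¬ Z (n ∸ m) t)
      out-of-Z m u = Fin.any? λ t → t ∈? lookup R u ×-dec ¬? (Z? (n ∸ m) t)
      open Play F (strategy (prefer (λ m _ t → ¬ Z (n ∸ m) t) out-of-Z) (prefer-legal (λ m _ t → ¬ Z (n ∸ m) t) out-of-Z)) s∈S
      invariant : ∀ i → i ≤ n → (∀ j → j < i → ¬ P (π j)) × ¬ Z (n ∸ i) (π i)
      invariant zero    i≤ = (λ _ ()) , ¬z
      invariant (suc i) i<n with invariant i (<⇒≤ i<n)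
      ... | ¬P , ¬Z = (λ j j< → [ ¬P j , (λ { refl → ¬Pi }) ]′ (m≤n⇒m<n∨m≡n (≤-pred j<))) , ¬Z′ (lookup σ (π i) ∈? A)
        where
        r = n ∸ suc i
        ¬Zi : ¬ Z (suc r) (π i)
        ¬Zi = subst (λ r → ¬ Z r (π i)) (+-∸-assoc 1 i<n) ¬Z
        q : Q (π i)
        q = win π outcome i ¬P
        ¬Pi : ¬ P (π i)
        ¬Pi p = ¬Zi (q , inj₁ p)
        i⟶ : π i ⟶ π (suc i)
        i⟶ = Out.fullPath outcome i
        ¬Z′ : Dec (lookup σ (π i) ∈ A) → ¬ Z r (π (suc i))
        ¬Z′ (yes a∈A) z = ¬Zi (q , inj₂ ((λ _ → π (suc i) , i⟶ , z) , λ a∉A → ⊥-elim (a∉A a∈A)))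
        ¬Z′ (no  a∉A) z with Fin.any? (λ t → t ∈? lookup R (π i) ×-dec ¬? (Z? r t))
        ... | no  none = ¬Zi (q , inj₂ ((λ a∈A → ⊥-elim (a∉A a∈A)) , λ _ t r⟶ → decidable-stable (Z? r t) λ ¬zt → none (t , r⟶ , ¬zt)))
        ... | yes (t , r⟶ , ¬zt) = prefer-good (λ m _ t → ¬ Z (n ∸ m) t) out-of-Z (suc i) (π i) r⟶ ¬zt
          (subst (Z r) (trans (opponent-moves i a∉A) (strategy-move (prefer (λ m _ t → ¬ Z (n ∸ m) t) out-of-Z) (prefer-legal (λ m _ t → ¬ Z (n ∸ m) t) out-of-Z) π i)) z)

    V-correct : ∀ {s} → s ∈ S → Wins s ⇔ Z n s
    V-correct s∈S = mk⇔ (λ w → decidable-stable (Z? n _) λ ¬z → loses s∈S ¬z w) wins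

  dec-⇔ : ∀ {A B : Set} → A ⇔ B → Dec B → Dec A
  dec-⇔ e (yes b) = yes (Equivalence.from e b)
  dec-⇔ e (no ¬b) = no (¬b ∘ Equivalence.to e)

  -- From a state outside S no path starts, so every strategy is winning.
  outside : ∀ {A s} {W : (ℕ → Fin n) → Set} → s ∉ S → Σ[ F ∈ StrategyFor A ] ∀ π → Out s F π → W π
  outside s∉S = (λ _ _ → strategy (λ _ → successor) λ _ _ → ⟶-successor) ,
    λ π o → ⊥-elim (s∉S (subst (_∈ S) (Out.starts o) (⟶-source (Out.fullPath o 0))))

  -- Stages range over all of `Fin n`, so satisfaction is decided outside `S` as well.
  ⊨-dec : ∀ φ s → Dec (M , s ⊨ φ)
  ⊨-dec tt       s = yes _
  ⊨-dec ff       s = no λ ()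
  ⊨-dec (atom q) s = q ∈? lookup L s
  ⊨-dec (¬′ φ)   s = ¬? (⊨-dec φ s)
  ⊨-dec (φ ∧′ ψ) s = ⊨-dec φ s ×-dec ⊨-dec ψ s
  ⊨-dec (φ ∨′ ψ) s = ⊨-dec φ s ⊎-dec ⊨-dec ψ s
  ⊨-dec (⟪ A ⟫X φ) s with s ∈? S
  ... | yes s∈S = dec-⇔ (X-correct A (⊨-dec φ) s∈S) (Controls-dec A (⊨-dec φ) s)
  ... | no  s∉S = yes (outside s∉S)
  ⊨-dec ⟪ A ⟫[ φ V ψ ] s with s ∈? S
  ... | yes s∈S = dec-⇔ (Release.V-correct A (⊨-dec φ) (⊨-dec ψ) s∈S) (Release.Z? A (⊨-dec φ) (⊨-dec ψ) n s)
  ... | no  s∉S = yes (outside s∉S)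

  ⊨-X : ∀ A φ {s} → s ∈ S → (M , s ⊨ (⟪ A ⟫X φ)) ⇔ Controls A (λ t → M , t ⊨ φ) s
  ⊨-X A φ = X-correct A (⊨-dec φ)

  ⊨-V : ∀ A φ ψ {s} → s ∈ S → (M , s ⊨ ⟪ A ⟫[ φ V ψ ]) ⇔ Stage A (λ t → M , t ⊨ φ) (λ t → M , t ⊨ ψ) n s
  ⊨-V A φ ψ = Release.V-correct A (⊨-dec φ) (⊨-dec ψ)

-- Codes of instances

PrefixFree : {A : Set} → (A → Word) → Set
PrefixFree {A} e = ∀ (a b : A) {r r′} → e a ++ r ≡ e b ++ r′ → a ≡ b × r ≡ r′

encodeℕ-prefixFree : PrefixFree encodeℕ
encodeℕ-prefixFree zero    zero    e = refl , List.∷-injectiveʳ e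
encodeℕ-prefixFree (suc m) (suc n) e =
  let (m≡n , r≡r′) = encodeℕ-prefixFree m n (List.∷-injectiveʳ e) in cong suc m≡n , r≡r′

encodeFin-prefixFree : ∀ {m} → PrefixFree (encodeFin {m})
encodeFin-prefixFree i j e = let (i≡j , r≡r′) = encodeℕ-prefixFree (toℕ i) (toℕ j) e in Fin.toℕ-injective i≡j , r≡r′

encodeSubset-prefixFree : ∀ {m} → PrefixFree (encodeSubset {m})
encodeSubset-prefixFree []      []      e = refl , e
encodeSubset-prefixFree (b ∷ A) (c ∷ B) e =
  let (A≡B , r≡r′) = encodeSubset-prefixFree A B (List.∷-injectiveʳ e) in cong₂ _∷_ (List.∷-injectiveˡ e) A≡B , r≡r′

encodeVec-prefixFree : ∀ {A : Set} {m} {e : A → Word} → PrefixFree e → PrefixFree (encodeVec {A} {m} e)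
encodeVec-prefixFree         free []      []      eq = refl , eq
encodeVec-prefixFree {e = e} free (a ∷ v) (b ∷ w) {r} {r′} eq =
  let (a≡b , eq′)  = free a b (trans (sym (List.++-assoc (e a) (encodeVec e v) r)) (trans eq (List.++-assoc (e b) (encodeVec e w) r′)))
      (v≡w , r≡r′) = encodeVec-prefixFree free v w eq′
  in cong₂ _∷_ a≡b v≡w , r≡r′

parseFin : ∀ m → Word → Maybe (Fin m × Word)
parseFin zero    _           = nothing
parseFin (suc m) []          = nothing
parseFin (suc m) (false ∷ w) = just (zero , w)
parseFin (suc m) (true ∷ w)  = Maybe.map (map₁ suc) (parseFin m w)

parseSubset : ∀ m → Word → Maybe (Subset m × Word)
parseSubset zero    w       = just ([] , w)
parseSubset (suc m) []      = nothing
parseSubset (suc m) (b ∷ w) = Maybe.map (map₁ (b ∷_)) (parseSubset m w)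

module _ {p k : ℕ} where

  Parser : Set → Set
  Parser A = Word → Maybe (A × Word)

  _⟫=_ : {A B : Set} → Maybe (A × Word) → (A → Parser B) → Maybe (B × Word)
  nothing      ⟫= f = nothing
  just (a , w) ⟫= f = f a w

  -- The number is fuel, and `height` is enough. The parser yields prefix-freeness of the code, and
  -- later it tells which formula, if any, starts at a given position.
  parse : ℕ → Parser (Formula p k)
  parse (suc f) (false ∷ false ∷ false ∷ w) = just (tt , w)
  parse (suc f) (false ∷ false ∷ true  ∷ w) = just (ff , w)
  parse (suc f) (false ∷ true  ∷ false ∷ w) = parseFin p w ⟫= λ q w → just (atom q , w)
  parse (suc f) (false ∷ true  ∷ true  ∷ w) = parse f w ⟫= λ φ w → just (¬′ φ , w)
  parse (suc f) (true  ∷ false ∷ false ∷ w) = parse f w ⟫= λ φ w → parse f w ⟫= λ ψ w → just (φ ∧′ ψ , w)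
  parse (suc f) (true  ∷ false ∷ true  ∷ w) = parse f w ⟫= λ φ w → parse f w ⟫= λ ψ w → just (φ ∨′ ψ , w)
  parse (suc f) (true  ∷ true  ∷ false ∷ w) = parseSubset k w ⟫= λ A w → parse f w ⟫= λ φ w → just (⟪ A ⟫X φ , w)
  parse (suc f) (true  ∷ true  ∷ true  ∷ w) = parseSubset k w ⟫= λ A w → parse f w ⟫= λ φ w → parse f w ⟫= λ ψ w →
    just (⟪ A ⟫[ φ V ψ ] , w)
  parse _       _                           = nothing

  height : Formula p k → ℕ
  height tt             = 1
  height ff             = 1
  height (atom q)       = 1
  height (¬′ φ)         = suc (height φ)
  height (φ ∧′ ψ)       = suc (height φ ⊔ height ψ)
  height (φ ∨′ ψ)       = suc (height φ ⊔ height ψ)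
  height (⟪ A ⟫X φ)     = suc (height φ)
  height ⟪ A ⟫[ φ V ψ ] = suc (height φ ⊔ height ψ)

parseFin-complete : ∀ {m} (i : Fin m) r → parseFin m (encodeFin i ++ r) ≡ just (i , r)
parseFin-complete zero    r = refl
parseFin-complete (suc i) r rewrite parseFin-complete i r = refl

parseSubset-complete : ∀ {m} (A : Subset m) r → parseSubset m (encodeSubset A ++ r) ≡ just (A , r)
parseSubset-complete []      r = refl
parseSubset-complete (b ∷ A) r rewrite parseSubset-complete A r = refl

parseFin-sound : ∀ m w {i r} → parseFin m w ≡ just (i , r) → w ≡ encodeFin i ++ r
parseFin-sound (suc m) (false ∷ w) refl = refl
parseFin-sound (suc m) (true ∷ w)  e with just _ ← parseFin m w in eq | refl ← e = cong (true ∷_) (parseFin-sound m w eq)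

parseSubset-sound : ∀ m w {A r} → parseSubset m w ≡ just (A , r) → w ≡ encodeSubset A ++ r
parseSubset-sound zero    w       refl = refl
parseSubset-sound (suc m) (b ∷ w) e with just _ ← parseSubset m w in eq | refl ← e = cong (b ∷_) (parseSubset-sound m w eq)

module _ {p k : ℕ} where

  parse-complete : ∀ (φ : Formula p k) r f → height φ ≤ f → parse f (encodeFormula φ ++ r) ≡ just (φ , r)
  parse-complete tt             r (suc f) h       = refl
  parse-complete ff             r (suc f) h       = refl
  parse-complete (atom q)       r (suc f) h       rewrite parseFin-complete q r = refl
  parse-complete (¬′ φ)         r (suc f) (s≤s h) rewrite parse-complete φ r f h = refl
  parse-complete (φ ∧′ ψ)       r (suc f) (s≤s h)
    rewrite List.++-assoc (encodeFormula φ) (encodeFormula ψ) r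
          | parse-complete φ (encodeFormula ψ ++ r) f (m⊔n≤o⇒m≤o (height φ) (height ψ) h)
          | parse-complete ψ r f (m⊔n≤o⇒n≤o (height φ) (height ψ) h) = refl
  parse-complete (φ ∨′ ψ)       r (suc f) (s≤s h)
    rewrite List.++-assoc (encodeFormula φ) (encodeFormula ψ) r
          | parse-complete φ (encodeFormula ψ ++ r) f (m⊔n≤o⇒m≤o (height φ) (height ψ) h)
          | parse-complete ψ r f (m⊔n≤o⇒n≤o (height φ) (height ψ) h) = refl
  parse-complete (⟪ A ⟫X φ)     r (suc f) (s≤s h)
    rewrite List.++-assoc (encodeSubset A) (encodeFormula φ) r
          | parseSubset-complete A (encodeFormula φ ++ r)
          | parse-complete φ r f h = refl
  parse-complete ⟪ A ⟫[ φ V ψ ] r (suc f) (s≤s h)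
    rewrite List.++-assoc (encodeSubset A) (encodeFormula φ ++ encodeFormula ψ) r
          | parseSubset-complete A ((encodeFormula φ ++ encodeFormula ψ) ++ r)
          | List.++-assoc (encodeFormula φ) (encodeFormula ψ) r
          | parse-complete φ (encodeFormula ψ ++ r) f (m⊔n≤o⇒m≤o (height φ) (height ψ) h)
          | parse-complete ψ r f (m⊔n≤o⇒n≤o (height φ) (height ψ) h) = refl

  parse-sound : ∀ f w {φ : Formula p k} {r} → parse f w ≡ just (φ , r) → w ≡ encodeFormula φ ++ r
  parse-sound (suc f) (false ∷ false ∷ false ∷ w) refl = refl
  parse-sound (suc f) (false ∷ false ∷ true  ∷ w) refl = refl
  parse-sound (suc f) (false ∷ true  ∷ false ∷ w) e
    with just _ ← parseFin p w in e₁ | refl ← e = cong (λ w → false ∷ true ∷ false ∷ w) (parseFin-sound p w e₁)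
  parse-sound (suc f) (false ∷ true  ∷ true  ∷ w) e
    with just _ ← parse {p} {k} f w in e₁ | refl ← e = cong (λ w → false ∷ true ∷ true ∷ w) (parse-sound f w e₁)
  parse-sound (suc f) (true  ∷ false ∷ false ∷ w) e
    with just (φ , w′) ← parse {p} {k} f w in e₁
    with just (ψ , r)  ← parse {p} {k} f w′ in e₂ | refl ← e = cong (λ w → true ∷ false ∷ false ∷ w)
      (trans (parse-sound f w e₁) (trans (cong (encodeFormula φ ++_) (parse-sound f w′ e₂)) (sym (List.++-assoc (encodeFormula φ) (encodeFormula ψ) r))))
  parse-sound (suc f) (true  ∷ false ∷ true  ∷ w) e
    with just (φ , w′) ← parse {p} {k} f w in e₁
    with just (ψ , r)  ← parse {p} {k} f w′ in e₂ | refl ← e = cong (λ w → true ∷ false ∷ true ∷ w)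
      (trans (parse-sound f w e₁) (trans (cong (encodeFormula φ ++_) (parse-sound f w′ e₂)) (sym (List.++-assoc (encodeFormula φ) (encodeFormula ψ) r))))
  parse-sound (suc f) (true  ∷ true  ∷ false ∷ w) e
    with just (A , w′) ← parseSubset k w in e₁
    with just (φ , r)  ← parse {p} {k} f w′ in e₂ | refl ← e = cong (λ w → true ∷ true ∷ false ∷ w)
      (trans (parseSubset-sound k w e₁) (trans (cong (encodeSubset A ++_) (parse-sound f w′ e₂)) (sym (List.++-assoc (encodeSubset A) (encodeFormula φ) r))))
  parse-sound (suc f) (true  ∷ true  ∷ true  ∷ w) e
    with just (A , w′) ← parseSubset k w in e₁
    with just (φ , w″) ← parse {p} {k} f w′ in e₂
    with just (ψ , r)  ← parse {p} {k} f w″ in e₃ | refl ← e = cong (λ w → true ∷ true ∷ true ∷ w)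
      (trans (parseSubset-sound k w e₁) (trans (cong (encodeSubset A ++_)
        (trans (parse-sound f w′ e₂) (trans (cong (encodeFormula φ ++_) (parse-sound f w″ e₃)) (sym (List.++-assoc (encodeFormula φ) (encodeFormula ψ) r)))))
        (sym (List.++-assoc (encodeSubset A) (encodeFormula φ ++ encodeFormula ψ) r))))

  encodeFormula-prefixFree : PrefixFree (encodeFormula {p} {k})
  encodeFormula-prefixFree φ ψ {r} {r′} e
    with refl ← trans (sym (parse-complete φ r (height φ ⊔ height ψ) (m≤m⊔n (height φ) (height ψ))))
                  (trans (cong (parse (height φ ⊔ height ψ)) e) (parse-complete ψ r′ (height φ ⊔ height ψ) (m≤n⊔m (height φ) (height ψ))))
    = refl , refl

module _ {n p k : ℕ} where

  -- A code does not determine the proofs `s₀∈S` and `R⊆S×S`, so structures with equal codes agree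
  -- up to these two fields.
  data SameData : GameStructure n p k → GameStructure n p k → Set where
    same : ∀ {S s₀ R L σ a c} {b d : ∀ {s t : Fin n} → t ∈ lookup R s → s ∈ S × t ∈ S} → SameData
      (record { S = S ; s₀ = s₀ ; R = R ; L = L ; σ = σ ; s₀∈S = a ; R⊆S×S = λ {s} → b {s} })
      (record { S = S ; s₀ = s₀ ; R = R ; L = L ; σ = σ ; s₀∈S = c ; R⊆S×S = λ {s} → d {s} })

  encodeStructure-prefixFree : (M N : GameStructure n p k) {r r′ : Word} → encodeStructure M ++ r ≡ encodeStructure N ++ r′ → SameData M N × r ≡ r′
  encodeStructure-prefixFree
      (record { S = S ; s₀ = s₀ ; R = R ; L = L ; σ = σ }) (record { S = S′ ; s₀ = s₀′ ; R = R′ ; L = L′ ; σ = σ′ }) {r} {r′} e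
    with refl , e₁ ← encodeSubset-prefixFree S S′ (trans (sym (List.++-assoc (encodeSubset S) _ r)) (trans e (List.++-assoc (encodeSubset S′) _ r′)))
    with refl , e₂ ← encodeFin-prefixFree s₀ s₀′ (trans (sym (List.++-assoc (encodeFin s₀) _ r)) (trans e₁ (List.++-assoc (encodeFin s₀′) _ r′)))
    with refl , e₃ ← encodeVec-prefixFree encodeSubset-prefixFree R R′ (trans (sym (List.++-assoc (encodeVec encodeSubset R) _ r)) (trans e₂ (List.++-assoc (encodeVec encodeSubset R′) _ r′)))
    with refl , e₄ ← encodeVec-prefixFree encodeSubset-prefixFree L L′ (trans (sym (List.++-assoc (encodeVec encodeSubset L) _ r)) (trans e₃ (List.++-assoc (encodeVec encodeSubset L′) _ r′)))
    with refl , e₅ ← encodeVec-prefixFree encodeFin-prefixFree σ σ′ e₄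
    = same , e₅

  ⊑-same : ∀ {M N M′} → SameData M N → M′ ⊑ M → M′ ⊑ N
  ⊑-same same sub = record { _⊑_ sub }

-- Membership in `ModelRepair` is witnessed by some instance with the given code, which need not be
-- the one that the reduction had in mind.
repairable-code : ∀ I J → encode I ≡ encode J → Repairable I → Repairable J
repairable-code (record { n = n ; p = p ; k = k ; M = M ; η = η }) (record { n = n′ ; p = p′ ; k = k′ ; M = N ; η = η′ }) e (M′ , sub , total , sat)
  with refl , e₁ ← encodeℕ-prefixFree n n′ e
  with refl , e₂ ← encodeℕ-prefixFree p p′ e₁
  with refl , e₃ ← encodeℕ-prefixFree k k′ e₂
  with same , e₄ ← encodeStructure-prefixFree M N e₃
  with refl , _  ← encodeFormula-prefixFree η η′ (trans (List.++-identityʳ _) (trans e₄ (sym (List.++-identityʳ _))))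
  = M′ , ⊑-same same sub , total , sat

comprehension : ∀ n → (ℕ → Bool) → Subset n
comprehension n h = tabulate (h ∘ toℕ)

∈-comprehension : ∀ {n} h {i : Fin n} → i ∈ comprehension n h ⇔ h (toℕ i) ≡ true
∈-comprehension h {i} = mk⇔
  (λ e → trans (sym (Vec.lookup∘tabulate (h ∘ toℕ) i)) (Vec.[]=⇒lookup e))
  (λ e → Vec.lookup⇒[]= i _ (trans (Vec.lookup∘tabulate (h ∘ toℕ) i) e))

relation : ∀ a b → (ℕ → ℕ → Bool) → Vec (Subset b) a
relation a b f = tabulate ((λ s → comprehension b (f s)) ∘ toℕ)

∈-relation : ∀ {a b} f s t → t ∈ lookup (relation a b f) s ⇔ f (toℕ s) (toℕ t) ≡ true
∈-relation {b = b} f s t = subst (λ A → t ∈ A ⇔ f (toℕ s) (toℕ t) ≡ true)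
  (sym (Vec.lookup∘tabulate ((λ s → comprehension b (f s)) ∘ toℕ) s)) (∈-comprehension (f (toℕ s)))

-- Definable languages reduce to model repair

wordFrom-cong : ∀ {f g : ℕ → Word} → (∀ i → f i ≡ g i) → ∀ i n → wordFrom f i n ≡ wordFrom g i n
wordFrom-cong eq i zero    = refl
wordFrom-cong eq i (suc n) = cong₂ _++_ (eq i) (wordFrom-cong eq (suc i) n)

wordFrom-shift : ∀ (f : ℕ → Word) i n → wordFrom (f ∘ suc) i n ≡ wordFrom f (suc i) n
wordFrom-shift f i zero    = refl
wordFrom-shift f i (suc n) = cong (f (suc i) ++_) (wordFrom-shift f (suc i) n)

encodeVec-tabulate : ∀ {A : Set} (e : A → Word) (h : ℕ → A) n → encodeVec e (tabulate {n = n} (h ∘ toℕ)) ≡ wordFrom (e ∘ h) 0 n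
encodeVec-tabulate e h zero    = refl
encodeVec-tabulate e h (suc n) = cong (e (h 0) ++_) (trans (encodeVec-tabulate e (h ∘ suc) n) (wordFrom-shift (e ∘ h) 0 n))

encodeSubset-comprehension : ∀ h n → encodeSubset (comprehension n h) ≡ wordFrom ([_] ∘ h) 0 n
encodeSubset-comprehension h zero    = refl
encodeSubset-comprehension h (suc n) = cong (h 0 ∷_) (trans (encodeSubset-comprehension (h ∘ suc) n) (wordFrom-shift ([_] ∘ h) 0 n))

encodeℕ-wordFrom : ∀ i n → encodeℕ n ≡ wordFrom (λ _ → [ true ]) i n ++ [ false ]
encodeℕ-wordFrom i zero    = refl
encodeℕ-wordFrom i (suc n) = cong (true ∷_) (encodeℕ-wordFrom (suc i) n)

abstract
  tuples : ℕ → ℕ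
  tuples D = suc D ^ 5

  tuples-≡ : ∀ D → tuples D ≡ suc D ^ 5
  tuples-≡ D = refl

module Reduction {𝓛 : Language} (def : Definable 𝓛) where
  open Definable def

  powTm : ℕ → Tm → Tm
  powTm zero    a = lit 1
  powTm (suc m) a = a ⊗ powTm m a

  value-powTm : ∀ m a {d} (ρ : Vec ℕ d) → value (powTm m a) ρ ≡ value a ρ ^ m
  value-powTm zero    a ρ = refl
  value-powTm (suc m) a ρ = cong (value a ρ *_) (value-powTm m a ρ)

  -- The number of propositional variables is Pᵗ.
  D Pᵗ : Tm
  D  = polyTm side (var 1)
  Pᵗ = powTm 5 (lit 1 ⊕ D)

  xᶜ : ∀ {d} → Tm → Cond d
  xᶜ = bit

  gᶜ : ∀ {d} → Vec Tm 5 → Cond d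
  gᶜ as = guard D as (flag (indexTm D as))

  open Translation xᶜ gᶜ

  puts : ∀ {d} → Word → Writer d
  puts []      = nil
  puts (b ∷ w) = put b ⊹ puts w

  decide : ∀ {d} → Cond d → Writer d → Writer d → Writer d
  decide φ W W′ = when φ W ⊹ when (neg φ) W′

  unary : ∀ {d} → Tm → Writer d
  unary a = for a (put true) ⊹ put false

  render : ∀ {d} → Cond d → Writer d
  render (bit a)    = decide (bit a) (puts (encodeFormula {0} {0} tt)) (puts (encodeFormula {0} {0} ff))
  -- The seven bits are the tag of `⟪_⟫X_`, the coalition of the only player, and the tag of `atom`.
  render (flag a)   = decide (a ≺ Pᵗ) (puts (true ∷ true ∷ false ∷ true ∷ false ∷ true ∷ false ∷ []) ⊹ unary a)
                        (puts (encodeFormula {0} {0} ff))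
  render (a ≺ b)    = decide (a ≺ b) (puts (encodeFormula {0} {0} tt)) (puts (encodeFormula {0} {0} ff))
  render (neg φ)    = puts (false ∷ true ∷ true ∷ []) ⊹ render φ
  render (both φ ψ) = puts (true ∷ false ∷ false ∷ []) ⊹ (render φ ⊹ render ψ)
  -- Codes are in prefix notation, so a right-nested conjunction is printed by a plain loop and
  -- closed by `tt`.
  render (each a φ) = for a (puts (true ∷ false ∷ false ∷ []) ⊹ render φ) ⊹ puts (encodeFormula {0} {0} tt)

  isEqual : ℕ → ℕ → Bool
  isEqual s t = not (s <ᵇ t) ∧ not (t <ᵇ s)

  isEqualᶜ : ∀ {d} → Tm → Tm → Cond d
  isEqualᶜ s t = both (neg (s ≺ t)) (neg (t ≺ s))

  isEqual-correct : ∀ s t → isEqual s t ≡ true ⇔ s ≡ t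
  isEqual-correct s t = mk⇔ (to s t) from
    where
    to : ∀ s t → isEqual s t ≡ true → s ≡ t
    to zero    zero    e = refl
    to (suc s) (suc t) e = cong suc (to s t e)
    from : ∀ {s t} → s ≡ t → isEqual s t ≡ true
    from {zero}  refl = refl
    from {suc s} refl = from {s} refl

  -- A substructure keeps an arbitrary set of the edges from state 0 to the states
  -- suc j, and thereby chooses a truth assignment.
  edge : ℕ → ℕ → Bool
  edge s t = not ((0 <ᵇ s) ∧ not (isEqual s t))

  edgeᶜ : ∀ {d} → Tm → Tm → Cond d
  edgeᶜ s t = neg (both (lit 0 ≺ s) (neg (isEqualᶜ s t)))

  put-bit : ∀ {d} → Cond d → Writer d
  put-bit φ = decide φ (put true) (put false)

  writer : Writer 2
  writer = unary (lit 1 ⊕ Pᵗ) ⊹ unary Pᵗ ⊹ unary (lit 1) ⊹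
    (for (lit 1 ⊕ Pᵗ) (put true) ⊹ put false ⊹
     for (lit 1 ⊕ Pᵗ) (for (lit 1 ⊕ Pᵗ) (put-bit (edgeᶜ (var 2) (var 3)))) ⊹
     for (lit 1 ⊕ Pᵗ) (for Pᵗ (put-bit (isEqualᶜ (var 2) (lit 1 ⊕ var 3)))) ⊹
     for (lit 1 ⊕ Pᵗ) (put false)) ⊹
    render (tr formula)

  module _ (x : Word) where

    m P : ℕ
    m = length x
    P = tuples (eval side m)

    ρ₀ : Vec ℕ 2
    -- The value of variable 0 is free; `writer-PolyTime` makes it the length as well.
    ρ₀ = m ∷ m ∷ []

    value-P : ∀ {d} {ρ : Vec ℕ d} → Extends ρ₀ ρ → value Pᵗ ρ ≡ P
    value-P {ρ = ρ} E = trans (value-powTm 5 (lit 1 ⊕ D) ρ)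
      (trans (cong (λ v → suc v ^ 5) (trans (value-polyTm side (var 1) ρ) (cong (eval side) (get-extends E ≤-refl)))) (sym (tuples-≡ (eval side m))))

    structure : GameStructure (suc P) P 1
    structure = record
      { S  = comprehension _ (λ _ → true)
      ; s₀ = zero
      ; R  = relation _ _ edge
      ; L  = relation _ _ (λ s j → isEqual s (suc j))
      ; σ  = tabulate ((λ _ → zero) ∘ toℕ)
      ; s₀∈S  = everywhere
      ; R⊆S×S = λ _ → everywhere , everywhere }
      where
      everywhere : ∀ {s} → s ∈ comprehension (suc P) (λ _ → true)
      everywhere = Equivalence.from (∈-comprehension _) refl

    open GameStructure structure

    ⟶-edge : ∀ {s t} → s ⟶ t ⇔ edge (toℕ s) (toℕ t) ≡ true
    ⟶-edge {s} {t} = ∈-relation edge s t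

    label : ∀ {s j} → j ∈ lookup L s ⇔ toℕ s ≡ suc (toℕ j)
    label {s} {j} = mk⇔ (Equivalence.to (isEqual-correct _ _) ∘ Equivalence.to member) (Equivalence.from member ∘ Equivalence.from (isEqual-correct _ _))
      where member = ∈-relation (λ s j → isEqual s (suc j)) s j

    -- Because of these loops, removing edges from state 0 to other states never destroys totality.
    edge-refl : ∀ s → edge s s ≡ true
    edge-refl s rewrite Equivalence.from (isEqual-correct s s) refl with 0 <ᵇ s
    ... | true  = refl
    ... | false = refl

    structure-total : Total
    structure-total {s} _ = s , Equivalence.from ⟶-edge (edge-refl (toℕ s))

    variableAt : ℕ → Formula P 1
    variableAt v with v <? P
    ... | yes v<P = ⟪ true ∷ [] ⟫X atom (fromℕ< v<P)
    ... | no  _   = ff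

    conjunction : (ℕ → Formula P 1) → ℕ → ℕ → Formula P 1
    conjunction φ i zero    = tt
    conjunction φ i (suc n) = φ i ∧′ conjunction φ (suc i) n

    meaning : ∀ {d} → Cond d → Vec ℕ d → Formula P 1
    meaning (bit a)    ρ = if bit-at x (value a ρ) then tt else ff
    meaning (flag a)   ρ = variableAt (value a ρ)
    meaning (a ≺ b)    ρ = if value a ρ <ᵇ value b ρ then tt else ff
    meaning (neg φ)    ρ = ¬′ meaning φ ρ
    meaning (both φ ψ) ρ = meaning φ ρ ∧′ meaning ψ ρ
    meaning (each a φ) ρ = conjunction (λ i → meaning φ (i ∷ ρ)) 0 (value a ρ)

    produce-unary : ∀ {d} a {ρ : Vec ℕ d} → produce (unary a) x ρ ≡ encodeℕ (value a ρ)
    produce-unary a {ρ} = sym (encodeℕ-wordFrom 0 (value a ρ))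

    produce-decide : ∀ {d} (φ : Cond d) {W W′} {ρ : Vec ℕ d} →
      produce (decide φ W W′) x ρ ≡ (if holds φ (bit-at x) noFlags ρ then produce W x ρ else produce W′ x ρ)
    produce-decide φ {ρ = ρ} with holds φ (bit-at x) noFlags ρ
    ... | true  = List.++-identityʳ _
    ... | false = refl

    produce-put-bit : ∀ {d} (φ : Cond d) {ρ : Vec ℕ d} → produce (put-bit φ) x ρ ≡ [ holds φ (bit-at x) noFlags ρ ]
    produce-put-bit φ {ρ} with holds φ (bit-at x) noFlags ρ
    ... | true  = refl
    ... | false = refl

    produce-truth : ∀ {d} (φ : Cond d) {ρ : Vec ℕ d} →
      produce (decide φ (puts (encodeFormula {0} {0} tt)) (puts (encodeFormula {0} {0} ff))) x ρ ≡
      encodeFormula {P} {1} (if holds φ (bit-at x) noFlags ρ then tt else ff)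
    produce-truth φ {ρ} with holds φ (bit-at x) noFlags ρ
    ... | true  = refl
    ... | false = refl

    produce-render : ∀ {d} (φ : Cond d) {ρ : Vec ℕ d} → Extends ρ₀ ρ → produce (render φ) x ρ ≡ encodeFormula (meaning φ ρ)
    produce-render (bit a)    E = produce-truth (bit a)
    produce-render (flag a) {ρ} E = trans (produce-decide (a ≺ Pᵗ) {puts (true ∷ true ∷ false ∷ true ∷ false ∷ true ∷ false ∷ []) ⊹ unary a}
        {puts (encodeFormula {0} {0} ff)})
      (trans (cong (λ n → if value a ρ <ᵇ n then true ∷ true ∷ false ∷ true ∷ false ∷ true ∷ false ∷ produce (unary a) x ρ else false ∷ false ∷ true ∷ []) (value-P E))
      (lemma (value a ρ) (produce-unary a)))
      where
      lemma : ∀ v {w} → w ≡ encodeℕ v → (if v <ᵇ P then true ∷ true ∷ false ∷ true ∷ false ∷ true ∷ false ∷ w else false ∷ false ∷ true ∷ []) ≡ encodeFormula (variableAt v)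
      lemma v refl with v <? P
      ... | yes v<P rewrite Fin.toℕ-fromℕ< v<P | dec-true (v <? P) v<P = refl
      ... | no  v≮P rewrite dec-false (v <? P) v≮P = refl
    produce-render (a ≺ b)    E = produce-truth (a ≺ b)
    produce-render (neg φ)    E = cong (λ w → false ∷ true ∷ true ∷ w) (produce-render φ E)
    produce-render (both φ ψ) E = cong₂ (λ w w′ → true ∷ false ∷ false ∷ w ++ w′) (produce-render φ E) (produce-render ψ E)
    produce-render (each a φ) {ρ} E = loop 0 (value a ρ)
      where
      loop : ∀ i n → wordFrom (λ i → true ∷ false ∷ false ∷ produce (render φ) x (i ∷ ρ)) i n ++ (false ∷ false ∷ false ∷ []) ≡
        encodeFormula (conjunction (λ i → meaning φ (i ∷ ρ)) i n)
      loop i zero    = refl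
      loop i (suc n) = cong (λ w → true ∷ false ∷ false ∷ w) (trans (List.++-assoc (produce (render φ) x (i ∷ ρ)) _ _)
        (cong₂ _++_ (produce-render φ (bind E)) (loop (suc i) n)))

    problem : Instance
    problem = record { M = structure ; total = λ {s} → structure-total {s} ; η = meaning (tr formula) ρ₀ }

    produce-writer : produce writer x ρ₀ ≡ encode problem
    produce-writer = cong₂ _++_ (trans (produce-unary (lit 1 ⊕ Pᵗ) {ρ₀}) (cong (encodeℕ ∘ suc) (value-P base)))
      (cong₂ _++_ (trans (produce-unary Pᵗ {ρ₀}) (cong encodeℕ (value-P base)))
      (cong (λ w → true ∷ false ∷ w) (cong₂ _++_ part (produce-render (tr formula) base))))
      where
      rows : ∀ (f : ℕ → ℕ → Bool) a b → encodeVec encodeSubset (relation a b f) ≡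
        wordFrom (λ s → wordFrom (λ t → [ f s t ]) 0 b) 0 a
      rows f a b = trans (encodeVec-tabulate encodeSubset (λ s → comprehension b (f s)) a)
        (wordFrom-cong (λ s → encodeSubset-comprehension (f s) b) 0 a)
      produce-rows : ∀ (c : Cond 4) (f : ℕ → ℕ → Bool) {a b A B} → (∀ s t → holds c (bit-at x) noFlags (t ∷ s ∷ ρ₀) ≡ f s t) →
        value a ρ₀ ≡ A → (∀ s → value b (s ∷ ρ₀) ≡ B) →
        produce (for a (for b (put-bit c))) x ρ₀ ≡ encodeVec encodeSubset (relation A B f)
      produce-rows c f {a} {b} {A} {B} eq a≡A b≡B = trans
        (wordFrom-cong (λ s → trans (wordFrom-cong (λ t → trans (produce-put-bit c) (cong [_] (eq s t))) 0 (value b (s ∷ ρ₀)))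
          (cong (wordFrom (λ t → [ f s t ]) 0) (b≡B s))) 0 (value a ρ₀))
        (trans (cong (wordFrom (λ s → wordFrom (λ t → [ f s t ]) 0 B) 0) a≡A) (sym (rows f A B)))
      P≡ : value Pᵗ ρ₀ ≡ P
      P≡ = value-P base
      part : produce (for (lit 1 ⊕ Pᵗ) (put true) ⊹ put false ⊹
        for (lit 1 ⊕ Pᵗ) (for (lit 1 ⊕ Pᵗ) (put-bit (edgeᶜ (var 2) (var 3)))) ⊹
        for (lit 1 ⊕ Pᵗ) (for Pᵗ (put-bit (isEqualᶜ (var 2) (lit 1 ⊕ var 3)))) ⊹
        for (lit 1 ⊕ Pᵗ) (put false)) x ρ₀ ≡ encodeStructure structure
      part = cong₂ _++_ (trans (cong (λ n → wordFrom (λ _ → [ true ]) 0 (suc n)) P≡) (sym (encodeSubset-comprehension (λ _ → true) (suc P))))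
        (cong (false ∷_) (cong₂ _++_
          (produce-rows (edgeᶜ (var 2) (var 3)) edge {lit 1 ⊕ Pᵗ} {lit 1 ⊕ Pᵗ} (λ _ _ → refl) (cong suc P≡) (λ s → cong suc (value-P (bind {i = s} base))))
          (cong₂ _++_
            (produce-rows (isEqualᶜ (var 2) (lit 1 ⊕ var 3)) (λ s j → isEqual s (suc j)) {lit 1 ⊕ Pᵗ} {Pᵗ} (λ _ _ → refl) (cong suc P≡) (λ s → value-P (bind {i = s} base)))
            (trans (cong (λ n → wordFrom (λ _ → [ false ]) 0 (suc n)) P≡) (sym (encodeVec-tabulate encodeFin (λ _ → zero) (suc P)))))))

    formula-correct : ∀ {g y} → (∀ as → g as ≡ table (eval side m) y as) → ⟦ formula ⟧ x g ρ₀ ⇔ holds (tr formula) (bit-at x) y ρ₀ ≡ true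
    formula-correct {g} {y} eq = tr-correct (λ _ _ → refl) g-ok formula
      where
      g-ok : ∀ {d} {ρ : Vec ℕ d} → Extends ρ₀ ρ → ∀ as → g (values as ρ) ≡ holds (gᶜ as) (bit-at x) y ρ
      g-ok {ρ = ρ} E as rewrite holds-guard D as (flag (indexTm D as)) {bit-at x} {y} ρ
        | value-indexTm D as ρ | value-polyTm side (var 1) ρ | get-extends E {1} ≤-refl = eq (values as ρ)

    module Repaired (M′ : GameStructure (suc P) P 1) (sub : M′ ⊑ structure) (total : GameStructure.Total M′) where
      private module M′ = GameStructure M′
      open Game M′ total using (⊨-X; ⟶-target)

      flags : ℕ → Bool
      flags v with v <? P
      ... | yes v<P = does (suc (fromℕ< v<P) ∈? lookup M′.R zero)
      ... | no  _   = false

      zero∈S : zero ∈ M′.S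
      zero∈S = subst (_∈ M′.S) (_⊑_.s₀′≡s₀ sub) M′.s₀∈S

      everyone : ∀ (a : Fin 1) → a ∈ (true ∷ [])
      everyone zero = Vec.here

      -- State `suc j` is the only one labelled `j`, and the coalition, which contains the only
      -- player, chooses the successor.
      X-atom : ∀ j → (M′ , zero ⊨ (⟪ true ∷ [] ⟫X atom j)) ⇔ suc j ∈ lookup M′.R zero
      X-atom j = mk⇔ (to ∘ Equivalence.to (⊨-X (true ∷ []) (atom j) zero∈S)) (Equivalence.from (⊨-X (true ∷ []) (atom j) zero∈S) ∘ from)
        where
        labels : ∀ {t} → t ∈ M′.S → j ∈ lookup M′.L t ⇔ toℕ t ≡ suc (toℕ j)
        labels {t} t∈S = subst (λ A → j ∈ A ⇔ toℕ t ≡ suc (toℕ j)) (sym (_⊑_.L′≡L↾S′ sub t∈S)) label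
        to : Game.Controls M′ total (true ∷ []) (λ t → j ∈ lookup M′.L t) zero → suc j ∈ lookup M′.R zero
        to (own , _) with t , r , j∈L ← own (everyone _) =
          subst (_∈ lookup M′.R zero) (Fin.toℕ-injective (Equivalence.to (labels (⟶-target r)) j∈L)) r
        from : suc j ∈ lookup M′.R zero → Game.Controls M′ total (true ∷ []) (λ t → j ∈ lookup M′.L t) zero
        from r = (λ _ → suc j , r , Equivalence.from (labels (⟶-target r)) refl) , λ a∉A → ⊥-elim (a∉A (everyone _))

      variable-reflects : ∀ v → Reflects (M′ , zero ⊨ variableAt v) (flags v)
      variable-reflects v with v <? P
      ... | no  _   = ofⁿ λ ()
      ... | yes v<P = reflects-map (Equivalence.from (X-atom _)) (Equivalence.to (X-atom _)) (proof (suc (fromℕ< v<P) ∈? lookup M′.R zero))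

      constant-reflects : ∀ b → Reflects (M′ , zero ⊨ (if b then tt else ff)) b
      constant-reflects true  = ofʸ _
      constant-reflects false = ofⁿ λ ()

      meaning-reflects : ∀ {d} (φ : Cond d) (ρ : Vec ℕ d) → Reflects (M′ , zero ⊨ meaning φ ρ) (holds φ (bit-at x) flags ρ)
      meaning-reflects (bit a)    ρ = constant-reflects (bit-at x (value a ρ))
      meaning-reflects (flag a)   ρ = variable-reflects (value a ρ)
      meaning-reflects (a ≺ b)    ρ = constant-reflects (value a ρ <ᵇ value b ρ)
      meaning-reflects (neg φ)    ρ = ¬-reflects (meaning-reflects φ ρ)
      meaning-reflects (both φ ψ) ρ = meaning-reflects φ ρ ×-reflects meaning-reflects ψ ρ
      meaning-reflects (each a φ) ρ = go 0 (value a ρ)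
        where
        go : ∀ i n → Reflects (M′ , zero ⊨ conjunction (λ i → meaning φ (i ∷ ρ)) i n) (allFrom (λ i → holds φ (bit-at x) flags (i ∷ ρ)) i n)
        go i zero    = ofʸ _
        go i (suc n) = meaning-reflects φ (i ∷ ρ) ×-reflects go (suc i) n

    repairable⇒member : Repairable problem → 𝓛 x
    repairable⇒member (M′ , sub , total , sat) =
      sound m x (table (eval side m) flags) (Equivalence.from (formula-correct {y = flags} λ _ → refl)
        (Equivalence.to (reflects-⇔ (meaning-reflects (tr formula) ρ₀)) sat))
      where open Repaired M′ sub total

    member⇒repairable : 𝓛 x → Repairable problem
    member⇒repairable x∈𝓛 = M′ , sub , (λ {s} → total {s}) , Equivalence.from (reflects-⇔ (Repaired.meaning-reflects M′ sub (λ {s} → total {s}) (tr formula) ρ₀))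
        (Equivalence.to (formula-correct (table-of D′ {g} supp′ λ v v< → flags-digits v (≤-trans v< (≤-reflexive (sym (tuples-≡ D′)))))) (proj₂ (proj₂ (complete x x∈𝓛)) m))
      where
      D′ = eval side m
      g  = proj₁ (complete x x∈𝓛)
      supp′ : Supported (suc D′) g
      supp′ as e = All.map m<n⇒m<1+n (proj₁ (proj₂ (complete x x∈𝓛)) as e)
      kept edge′ : ℕ → ℕ → Bool
      kept zero    (suc v) = g (digits D′ 5 v)
      kept zero    zero    = true
      kept (suc _) _       = true
      edge′ s t = edge s t ∧ kept s t
      R′ : Vec (Subset (suc P)) (suc P)
      R′ = relation (suc P) (suc P) edge′
      ⟶-edge′ : ∀ {s t} → t ∈ lookup R′ s ⇔ edge′ (toℕ s) (toℕ t) ≡ true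
      ⟶-edge′ {s} {t} = ∈-relation edge′ s t
      R′⊆R : ∀ {s t} → t ∈ lookup R′ s → s ⟶ t
      R′⊆R {s} {t} e = Equivalence.from (⟶-edge {s} {t}) (Bool.∧-conicalˡ (edge (toℕ s) (toℕ t)) _ (Equivalence.to (⟶-edge′ {s} {t}) e))
      M′ : GameStructure (suc P) P 1
      M′ = record structure { R = R′ ; R⊆S×S = λ {s} {t} e → R⊆S×S (R′⊆R {s} {t} e) }
      sub : M′ ⊑ structure
      sub = record { S′⊆S = id ; s₀′≡s₀ = refl ; R′⊆R = λ {s} {t} → R′⊆R {s} {t} ; L′≡L↾S′ = λ _ → refl ; σ′≡σ↾S′ = λ _ → refl }
      total : GameStructure.Total M′
      total {s} _ = s , Equivalence.from (⟶-edge′ {s} {s}) (trans (cong (_∧ kept (toℕ s) (toℕ s)) (edge-refl (toℕ s))) (kept-refl (toℕ s)))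
        where
        kept-refl : ∀ s → kept s s ≡ true
        kept-refl zero    = refl
        kept-refl (suc s) = refl
      flags-digits : ∀ v → v < P → Repaired.flags M′ sub (λ {s} → total {s}) v ≡ g (digits D′ 5 v)
      flags-digits v v<P with v <? P
      ... | no  v≮P  = ⊥-elim (v≮P v<P)
      ... | yes v<P′ = does-⇔ (subst (λ v → suc (fromℕ< v<P′) ∈ lookup R′ zero ⇔ g (digits D′ 5 v) ≡ true) (Fin.toℕ-fromℕ< v<P′) (⟶-edge′ {zero} {suc (fromℕ< v<P′)})) (suc (fromℕ< v<P′) ∈? lookup R′ zero)
        where
        does-⇔ : ∀ {A : Set} {b} → A ⇔ b ≡ true → (d : Dec A) → does d ≡ b
        does-⇔ {b = true}  e (yes _) = refl
        does-⇔ {b = false} e (yes a) = sym (Equivalence.to e a)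
        does-⇔ {b = true}  e (no ¬a) = ⊥-elim (¬a (Equivalence.from e refl))
        does-⇔ {b = false} e (no _)  = refl

  reduction : 𝓛 ≤ₚ ModelRepair
  reduction = (λ x → produce writer x (ρ₀ x)) , writer-PolyTime 2 writer , λ x → mk⇔
    (λ x∈𝓛 → problem x , sym (produce-writer x) , member⇒repairable x x∈𝓛)
    (λ (I , e , repair) → repairable⇒member x (repairable-code I (problem x) (trans e (produce-writer x)) repair))

-- Segments of a word

-- The word w occupies the positions from i up to, but excluding, j of x.
Seg : Word → ℕ → Word → ℕ → Set
Seg x i []      j = i ≡ j
Seg x i (b ∷ w) j = bit-at x i ≡ b × Seg x (suc i) w j

length-encodeℕ : ∀ a → length (encodeℕ a) ≡ suc a
length-encodeℕ zero    = refl
length-encodeℕ (suc a) = cong suc (length-encodeℕ a)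

module _ {x : Word} where

  seg-++ : ∀ u {v i j l} → Seg x i u j → Seg x j v l → Seg x i (u ++ v) l
  seg-++ []      refl     q = q
  seg-++ (b ∷ u) (e , p)  q = e , seg-++ u p q

  seg-split : ∀ u {v i l} → Seg x i (u ++ v) l → ∃[ j ] Seg x i u j × Seg x j v l
  seg-split []      p       = _ , refl , p
  seg-split (b ∷ u) (e , p) = let (j , q , r) = seg-split u p in j , (e , q) , r

  seg-end : ∀ w {i j} → Seg x i w j → j ≡ i + length w
  seg-end []      {i} refl    = sym (+-identityʳ i)
  seg-end (b ∷ w) {i} (_ , p) = trans (seg-end w p) (sym (+-suc i (length w)))

  seg-≤ : ∀ w {i j} → Seg x i w j → i ≤ j
  seg-≤ w {i} p = ≤-trans (m≤m+n i (length w)) (≤-reflexive (sym (seg-end w p)))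

  seg-unary : ∀ a {i} → (∀ j → j < a → bit-at x (i + j) ≡ true) × ¬ bit-at x (i + a) ≡ true → Seg x i (encodeℕ a) (i + suc a)
  seg-unary zero    {i} (_ , z) = subst (λ v → bit-at x v ≡ false) (+-identityʳ i) (Bool.¬-not z) , sym (+-comm i 1)
  seg-unary (suc a) {i} (o , z) = subst (λ v → bit-at x v ≡ true) (+-identityʳ i) (o 0 (s≤s z≤n)) ,
    subst (Seg x (suc i) (encodeℕ a)) (sym (+-suc i (suc a)))
      (seg-unary a ((λ j j< → subst (λ v → bit-at x v ≡ true) (+-suc i j) (o (suc j) (s≤s j<))) , z ∘ subst (λ v → bit-at x v ≡ true) (sym (+-suc i a))))

  unary-seg : ∀ a {i j} → Seg x i (encodeℕ a) j → (∀ j → j < a → bit-at x (i + j) ≡ true) × ¬ bit-at x (i + a) ≡ true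
  unary-seg zero    {i} (e , _) = (λ _ ()) , λ e′ → Bool.not-¬ e (subst (λ v → bit-at x v ≡ true) (+-identityʳ i) e′)
  unary-seg (suc a) {i} (e , p) with unary-seg a p
  ... | o , z = (λ { zero _ → subst (λ v → bit-at x v ≡ true) (sym (+-identityʳ i)) e
                   ; (suc j) (s≤s j<) → subst (λ v → bit-at x v ≡ true) (sym (+-suc i j)) (o j j<) })
              , z ∘ subst (λ v → bit-at x v ≡ true) (+-suc i a)

  unary-split : ∀ a {i w l} → Seg x i (encodeℕ a ++ w) l →
    ((∀ j → j < a → bit-at x (i + j) ≡ true) × ¬ bit-at x (i + a) ≡ true) × Seg x (i + suc a) w l
  unary-split a {i} p with seg-split (encodeℕ a) p
  ... | _ , q , r with trans (seg-end (encodeℕ a) q) (cong (i +_) (length-encodeℕ a))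
  ...   | refl = unary-seg a q , r

  seg-subset : ∀ {m} (A : Subset m) {i} → (∀ a → bit-at x (i + toℕ a) ≡ lookup A a) → Seg x i (encodeSubset A) (i + m)
  seg-subset []      {i} h = sym (+-identityʳ i)
  seg-subset {suc m} (b ∷ A) {i} h = subst (λ v → bit-at x v ≡ b) (+-identityʳ i) (h zero) ,
    subst (Seg x (suc i) (encodeSubset A)) (sym (+-suc i m)) (seg-subset A λ a → trans (cong (bit-at x) (sym (+-suc i (toℕ a)))) (h (suc a)))

  subset-seg : ∀ {m} (A : Subset m) {i j} → Seg x i (encodeSubset A) j → j ≡ i + m × ∀ a → bit-at x (i + toℕ a) ≡ lookup A a
  subset-seg []      {i} refl = sym (+-identityʳ i) , λ ()
  subset-seg {suc m} (b ∷ A) {i} (e , p) with subset-seg A p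
  ... | refl , h = sym (+-suc i m) , λ { zero → trans (cong (bit-at x) (+-identityʳ i)) e
                                       ; (suc a) → trans (cong (bit-at x) (+-suc i (toℕ a))) (h a) }

  seg-matrix : ∀ {a b} (A : Vec (Subset b) a) {i} → (∀ s t → bit-at x (i + (toℕ s * b + toℕ t)) ≡ lookup (lookup A s) t) →
    Seg x i (encodeVec encodeSubset A) (i + a * b)
  seg-matrix {b = b} []      {i} h = sym (+-identityʳ i)
  seg-matrix {suc a} {b} (B ∷ A) {i} h = seg-++ (encodeSubset B) (seg-subset B (h zero))
    (subst (Seg x (i + b) (encodeVec encodeSubset A)) (+-assoc i b (a * b))
      (seg-matrix A λ s t → trans (cong (bit-at x) (trans (+-assoc i b _) (cong (i +_) (sym (+-assoc b _ _))))) (h (suc s) t)))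

  matrix-seg : ∀ {a b} (A : Vec (Subset b) a) {i j} → Seg x i (encodeVec encodeSubset A) j →
    j ≡ i + a * b × ∀ s t → bit-at x (i + (toℕ s * b + toℕ t)) ≡ lookup (lookup A s) t
  matrix-seg []      {i} refl = sym (+-identityʳ i) , λ ()
  matrix-seg {suc a} {b} (B ∷ A) {i} p with seg-split (encodeSubset B) p
  ... | _ , q , r with subset-seg B q
  ...   | refl , h with matrix-seg A r
  ...     | refl , h′ = +-assoc i b (a * b) , λ { zero t → h t
      ; (suc s) t → trans (cong (bit-at x) (sym (trans (+-assoc i b _) (cong (i +_) (sym (+-assoc b _ _)))))) (h′ s t) }

-- The start of entry s of v, when v is written in unary from position j.
offset : ∀ {k m} → Vec (Fin k) m → ℕ → ℕ → ℕ
offset v       j zero    = j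
offset []      j (suc s) = j
offset (a ∷ v) j (suc s) = offset v (j + suc (toℕ a)) s

module _ {x : Word} {k : ℕ} where

  offset-split : ∀ {m} (a : Fin k) (v : Vec (Fin k) m) {j f} → Seg x j (encodeVec encodeFin (a ∷ v)) f →
    Seg x j (encodeFin a) (j + suc (toℕ a)) × Seg x (j + suc (toℕ a)) (encodeVec encodeFin v) f
  offset-split a v {j} p with seg-split (encodeFin a) p
  ... | _ , q , r with trans (seg-end (encodeFin a) q) (cong (j +_) (length-encodeℕ (toℕ a)))
  ...   | refl = q , r

  offset-end : ∀ {m} (v : Vec (Fin k) m) {j f} → Seg x j (encodeVec encodeFin v) f → offset v j m ≡ f
  offset-end []      refl = refl
  offset-end (a ∷ v) p    = offset-end v (proj₂ (offset-split a v p))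

  offset-entry : ∀ {m} (v : Vec (Fin k) m) {j f} → Seg x j (encodeVec encodeFin v) f → ∀ s →
    Seg x (offset v j (toℕ s)) (encodeFin (lookup v s)) (offset v j (suc (toℕ s))) × offset v j (suc (toℕ s)) ≤ f
  offset-entry (a ∷ v) p zero    = let (q , r) = offset-split a v p in q , seg-≤ (encodeVec encodeFin v) r
  offset-entry (a ∷ v) p (suc s) = offset-entry v (proj₂ (offset-split a v p)) s

  offset-≤ : ∀ {m} (v : Vec (Fin k) m) {j f} → Seg x j (encodeVec encodeFin v) f → ∀ s → offset v j s ≤ f
  offset-≤ v       p    zero    = seg-≤ (encodeVec encodeFin v) p
  offset-≤ []      refl (suc s) = ≤-refl
  offset-≤ (a ∷ v) p    (suc s) = offset-≤ v (proj₂ (offset-split a v p)) s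

seg-shift : ∀ {x b} w {i j} → Seg x i w j → Seg (b ∷ x) (suc i) w (suc j)
seg-shift []      refl    = refl
seg-shift (c ∷ w) (e , p) = e , seg-shift w p

seg-unshift : ∀ {x b} w {i j} → Seg (b ∷ x) (suc i) w (suc j) → Seg x i w j
seg-unshift []      refl    = refl
seg-unshift (c ∷ w) (e , p) = e , seg-unshift w p

seg-drop : ∀ x i {w r} → drop i x ≡ w ++ r → i ≤ length x → Seg x i w (i + length w)
seg-drop x       zero    {[]}    e  l       = refl
seg-drop (c ∷ x) zero    {b ∷ w} e  l       = List.∷-injectiveˡ e , seg-shift w (seg-drop x 0 (List.∷-injectiveʳ e) z≤n)
seg-drop (c ∷ x) (suc i) {w}     e  (s≤s l) = seg-shift w (seg-drop x i e l)

-- `bit-at` is false beyond the end of `x`, so a segment may stick out of the word; hence the bound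
-- on `j`.
drop-seg : ∀ x i w {j} → Seg x i w j → j ≤ length x → drop i x ≡ w ++ drop j x
drop-seg x       i       []      refl    l       = refl
drop-seg []      i       (b ∷ w) (e , p) l       = ⊥-elim (<⇒≱ (seg-≤ w p) (≤-trans l z≤n))
drop-seg (c ∷ x) zero    (b ∷ w) {zero}  (e , p) l = ⊥-elim (<⇒≱ (seg-≤ w p) z≤n)
drop-seg (c ∷ x) zero    (b ∷ w) {suc j} (e , p) (s≤s l) = cong₂ _∷_ e (drop-seg x 0 w (seg-unshift w p) l)
drop-seg (c ∷ x) (suc i) (b ∷ w) {zero}  p l       = ⊥-elim (<⇒≱ (seg-≤ (b ∷ w) p) z≤n)
drop-seg (c ∷ x) (suc i) (b ∷ w) {suc j} p (s≤s l) = drop-seg x i (b ∷ w) (seg-unshift (b ∷ w) p) l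

seg-whole : ∀ x w → Seg x 0 w (length x) → w ≡ x
seg-whole x w p = sym (trans (drop-seg x 0 w p ≤-refl) (trans (cong (w ++_) (List.drop-all (length x) x ≤-refl)) (List.++-identityʳ w)))

seg-self : ∀ x → Seg x 0 x (length x)
seg-self x = seg-drop x 0 (sym (List.++-identityʳ x)) z≤n

-- A formula defining model repair

-- Up to the owners, every part of the code starts at a position given by a term. The owners are in
-- unary, so the start of an entry is a sum of varying length, which the table has to supply through
-- `offᶠ`.
module CodePositions (n p k s₀ : ℕ) where
  atP atK atS at₀ atR atL atσ : ℕ
  atP = suc n
  atK = atP + suc p
  atS = atK + suc k
  at₀ = atS + n
  atR = at₀ + suc s₀
  atL = atR + n * n
  atσ = atL + n * p

module RepairFormula where

  -- keepᶠ and stepᶠ give the states and transitions of the substructure, turnᶠ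
  -- the owner of a state, offᶠ s j says that the code of the owner of s starts at
  -- position j, and nodeᶠ i e that a formula occupies the positions from i to e.
  -- For such a formula, satᶠ i e s N̂ says that it holds in s; for a release
  -- formula, satᶠ i e s r describes stage r of its fixpoint.
  keepᶠ : ∀ {d} → Tm → Fm d
  keepᶠ s = G (lit 0 ∷ s ∷ lit 0 ∷ lit 0 ∷ lit 0 ∷ [])

  stepᶠ turnᶠ offᶠ nodeᶠ : ∀ {d} → Tm → Tm → Fm d
  stepᶠ s t = G (lit 1 ∷ s ∷ t ∷ lit 0 ∷ lit 0 ∷ [])
  turnᶠ s a = G (lit 2 ∷ s ∷ a ∷ lit 0 ∷ lit 0 ∷ [])
  offᶠ s j  = G (lit 3 ∷ s ∷ j ∷ lit 0 ∷ lit 0 ∷ [])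
  nodeᶠ i e = G (lit 4 ∷ i ∷ e ∷ lit 0 ∷ lit 0 ∷ [])

  satᶠ : ∀ {d} → Tm → Tm → Tm → Tm → Fm d
  satᶠ i e s r = G (lit 5 ∷ i ∷ e ∷ s ∷ r ∷ [])

  X̂ X̂+1 N̂ P̂ K̂ Ŝ : Tm
  X̂   = var 1
  X̂+1 = lit 1 ⊕ X̂
  N̂   = var 2
  P̂   = var 3
  K̂   = var 4
  Ŝ   = var 5

  pP pK pS p₀ pR pL pσ : Tm
  pP = lit 1 ⊕ N̂
  pK = pP ⊕ (lit 1 ⊕ P̂)
  pS = pK ⊕ (lit 1 ⊕ K̂)
  p₀ = pS ⊕ N̂
  pR = p₀ ⊕ (lit 1 ⊕ Ŝ)
  pL = pR ⊕ N̂ ⊗ N̂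
  pσ = pL ⊕ N̂ ⊗ P̂

  unaryᶠ : ∀ {d} → Tm → Tm → Fm d
  unaryᶠ i a = (⋀[ j < a ] X (i ⊕ j)) ⊓ᶠ ∼ X (i ⊕ a)

  infix 5 _⇔ᶠ_

  _⇔ᶠ_ : ∀ {d} → Fm d → Fm d → Fm d
  φ ⇔ᶠ ψ = (φ ⇒ ψ) ⊓ᶠ (ψ ⇒ φ)

  everyᶠ : ∀ {d} → (Tm → Fm (suc d)) → Fm d
  everyᶠ φ = ⋀[ s < N̂ ] (keepᶠ s ⇒ φ s)

  -- `nodesᶠ` imposes conditions only on nodes that start before `X̂`, so a child must be known to
  -- start there.
  childᶠ : ∀ {d} → Tm → Tm → Fm d
  childᶠ j e = j ⊏ X̂ ⊓ᶠ nodeᶠ j e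

  controlsᶠ : ∀ {d} → Tm → (∀ {d} → Tm → Fm d) → Tm → Fm d
  controlsᶠ c Z s = ⋀[ a < K̂ ] (turnᶠ s a ⇒
    (X (c ⊕ a) ⇒ ⋁[ t < N̂ ] (stepᶠ s t ⊓ᶠ Z t)) ⊓ᶠ (∼ X (c ⊕ a) ⇒ ⋀[ t < N̂ ] (stepᶠ s t ⇒ Z t)))

  -- The node under consideration occupies the positions from I to E.
  I E I₃ : Tm
  I  = var 6
  E  = var 7
  I₃ = lit 3 ⊕ I

  literal : ∀ {d} → Bool → Tm → Fm d
  literal true  a = X a
  literal false a = ∼ X a

  tagᶠ : Bool → Bool → Bool → Fm 8
  tagᶠ b₀ b₁ b₂ = literal b₀ I ⊓ᶠ literal b₁ (lit 1 ⊕ I) ⊓ᶠ literal b₂ (lit 2 ⊕ I)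

  -- Each case relates a node to its immediate children only, which a first-order formula can do.
  -- That a node carries a formula, and that its satisfaction entries are right, then follows by
  -- induction outside the formula.
  ttᶠ ffᶠ atomᶠ negᶠ andᶠ orᶠ nextᶠ releaseᶠ : Fm 8
  ttᶠ   = tagᶠ false false false ⊓ᶠ E ≐ I₃ ⊓ᶠ everyᶠ λ s → satᶠ I E s N̂
  ffᶠ   = tagᶠ false false true ⊓ᶠ E ≐ I₃ ⊓ᶠ everyᶠ λ s → ∼ satᶠ I E s N̂
  atomᶠ = tagᶠ false true false ⊓ᶠ (⋁[ q < P̂ ] (unaryᶠ I₃ q ⊓ᶠ E ≐ I₃ ⊕ (lit 1 ⊕ q) ⊓ᶠ
    everyᶠ λ s → satᶠ I E s N̂ ⇔ᶠ X (pL ⊕ (s ⊗ P̂ ⊕ q))))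
  negᶠ  = tagᶠ false true true ⊓ᶠ childᶠ I₃ E ⊓ᶠ everyᶠ λ s → satᶠ I E s N̂ ⇔ᶠ (∼ satᶠ I₃ E s N̂)
  andᶠ  = tagᶠ true false false ⊓ᶠ (⋁[ m < X̂+1 ] (childᶠ I₃ m ⊓ᶠ childᶠ m E ⊓ᶠ
    everyᶠ λ s → satᶠ I E s N̂ ⇔ᶠ (satᶠ I₃ m s N̂ ⊓ᶠ satᶠ m E s N̂)))
  orᶠ   = tagᶠ true false true ⊓ᶠ (⋁[ m < X̂+1 ] (childᶠ I₃ m ⊓ᶠ childᶠ m E ⊓ᶠ
    everyᶠ λ s → satᶠ I E s N̂ ⇔ᶠ (satᶠ I₃ m s N̂ ⊔ᶠ satᶠ m E s N̂)))
  nextᶠ = tagᶠ true true false ⊓ᶠ childᶠ (I₃ ⊕ K̂) E ⊓ᶠ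
    everyᶠ λ s → satᶠ I E s N̂ ⇔ᶠ controlsᶠ I₃ (λ t → satᶠ (I₃ ⊕ K̂) E t N̂) s
  releaseᶠ = tagᶠ true true true ⊓ᶠ (⋁[ m < X̂+1 ] (childᶠ (I₃ ⊕ K̂) m ⊓ᶠ childᶠ m E ⊓ᶠ
    everyᶠ λ s → satᶠ I E s (lit 0) ⊓ᶠ (⋀[ r < N̂ ] satᶠ I E s (lit 1 ⊕ r) ⇔ᶠ
      (satᶠ m E s N̂ ⊓ᶠ (satᶠ (I₃ ⊕ K̂) m s N̂ ⊔ᶠ controlsᶠ I₃ (λ t → satᶠ I E t r) s)))))

  nodeConditionᶠ : Fm 8
  nodeConditionᶠ = ttᶠ ⊔ᶠ ffᶠ ⊔ᶠ atomᶠ ⊔ᶠ negᶠ ⊔ᶠ andᶠ ⊔ᶠ orᶠ ⊔ᶠ nextᶠ ⊔ᶠ releaseᶠ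

  edgeᶠ : ∀ {d} → Tm → Tm → Fm d
  edgeᶠ s t = X (pR ⊕ (s ⊗ N̂ ⊕ t))

  headerᶠ edgesᶠ totalᶠ ownersᶠ subᶠ rootᶠ nodesᶠ : Fm 6
  headerᶠ = unaryᶠ (lit 0) N̂ ⊓ᶠ unaryᶠ pP P̂ ⊓ᶠ unaryᶠ pK K̂ ⊓ᶠ unaryᶠ p₀ Ŝ ⊓ᶠ X (pS ⊕ Ŝ)
  edgesᶠ  = ⋀[ s < N̂ ] ⋀[ t < N̂ ] edgeᶠ s t ⇒ X (pS ⊕ s) ⊓ᶠ X (pS ⊕ t)
  totalᶠ  = ⋀[ s < N̂ ] X (pS ⊕ s) ⇒ (⋁[ t < N̂ ] edgeᶠ s t)
  ownersᶠ = (pσ ⊏ X̂+1 ⊓ᶠ offᶠ (lit 0) pσ) ⊓ᶠ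
    (⋀[ s < N̂ ] ⋀[ j < X̂+1 ] offᶠ s j ⇒ (⋁[ a < K̂ ] turnᶠ s a ⊓ᶠ unaryᶠ j a ⊓ᶠ
      j ⊕ (lit 1 ⊕ a) ⊏ X̂+1 ⊓ᶠ offᶠ (lit 1 ⊕ s) (j ⊕ (lit 1 ⊕ a)))) ⊓ᶠ
    -- `controlsᶠ` consults every listed owner of a state, so there must not be two.
    (⋀[ s < N̂ ] ⋀[ a < K̂ ] ⋀[ b < K̂ ] turnᶠ s a ⊓ᶠ turnᶠ s b ⇒ a ≐ b)
  subᶠ    = keepᶠ Ŝ ⊓ᶠ (everyᶠ λ s → X (pS ⊕ s)) ⊓ᶠ
    (⋀[ s < N̂ ] ⋀[ t < N̂ ] stepᶠ s t ⇒ edgeᶠ s t ⊓ᶠ keepᶠ s ⊓ᶠ keepᶠ t) ⊓ᶠ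
    (everyᶠ λ s → ⋁[ t < N̂ ] stepᶠ s t)
  -- The table may list several positions as the end of the owners. The condition is imposed at all
  -- of them, so it holds at the one that is reached by following the entries.
  rootᶠ   = ⋀[ f < X̂+1 ] offᶠ N̂ f ⇒ childᶠ f X̂ ⊓ᶠ satᶠ f X̂ Ŝ N̂
  nodesᶠ  = ⋀[ i < X̂ ] ⋀[ e < X̂+1 ] nodeᶠ i e ⇒ nodeConditionᶠ

  repairᶠ : Fm 2
  repairᶠ = ⋁[ n < X̂+1 ] ⋁[ p < X̂+1 ] ⋁[ k < X̂+1 ] ⋁[ s₀ < N̂ ]
    headerᶠ ⊓ᶠ edgesᶠ ⊓ᶠ totalᶠ ⊓ᶠ ownersᶠ ⊓ᶠ subᶠ ⊓ᶠ rootᶠ ⊓ᶠ nodesᶠ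

  literal-correct : ∀ b {x g d} {ρ : Vec ℕ d} a → ⟦ literal b a ⟧ x g ρ ⇔ bit-at x (value a ρ) ≡ b
  literal-correct true  a = mk⇔ id id
  literal-correct false a = mk⇔ Bool.¬-not Bool.not-¬

iff-trans : {A B C : Set} → A ⇔ B → B ⇔ C → A ⇔ C
iff-trans e f = mk⇔ (Equivalence.to f ∘ Equivalence.to e) (Equivalence.from e ∘ Equivalence.from f)

iff-sym : {A B : Set} → A ⇔ B → B ⇔ A
iff-sym e = mk⇔ (Equivalence.from e) (Equivalence.to e)

iff-¬ : {A B : Set} → A ⇔ B → (¬ A) ⇔ (¬ B)
iff-¬ e = mk⇔ (_∘ Equivalence.from e) (_∘ Equivalence.to e)

iff-× : {A B C D : Set} → A ⇔ C → B ⇔ D → (A × B) ⇔ (C × D)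
iff-× e f = mk⇔ (λ (a , b) → Equivalence.to e a , Equivalence.to f b) (λ (c , d) → Equivalence.from e c , Equivalence.from f d)

iff-⊎ : {A B C D : Set} → A ⇔ C → B ⇔ D → (A ⊎ B) ⇔ (C ⊎ D)
iff-⊎ e f = mk⇔ [ inj₁ ∘ Equivalence.to e , inj₂ ∘ Equivalence.to f ]′ [ inj₁ ∘ Equivalence.from e , inj₂ ∘ Equivalence.from f ]′

iff-pair : {A B : Set} → (A → B) × (B → A) → A ⇔ B
iff-pair (f , g) = mk⇔ f g

pair-iff : {A B : Set} → A ⇔ B → (A → B) × (B → A)
pair-iff e = Equivalence.to e , Equivalence.from e

below : ∀ {n i} {P : ℕ → Set} → (∀ (s : Fin n) → P (toℕ s)) → i < n → P i
below {P = P} h i<n = subst P (Fin.toℕ-fromℕ< i<n) (h (fromℕ< i<n))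

-- Agreement between a table and a game structure

module Frame {n p k : ℕ} (x : Word) (g : Table) (atL : ℕ) (M : GameStructure n p k) (total : GameStructure.Total M) where
  open GameStructure M
  open Game M total

  keep : ℕ → Set
  keep s = g (0 ∷ s ∷ 0 ∷ 0 ∷ 0 ∷ []) ≡ true

  arc turn node : ℕ → ℕ → Set
  arc s t  = g (1 ∷ s ∷ t ∷ 0 ∷ 0 ∷ []) ≡ true
  turn s a = g (2 ∷ s ∷ a ∷ 0 ∷ 0 ∷ []) ≡ true
  node i e = g (4 ∷ i ∷ e ∷ 0 ∷ 0 ∷ []) ≡ true

  sat : ℕ → ℕ → ℕ → ℕ → Set
  sat i e s r = g (5 ∷ i ∷ e ∷ s ∷ r ∷ []) ≡ true

  -- Owners and labels are compared on `S` alone, because outside it a substructure may carry any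
  -- values.
  record Describes : Set where
    field
      keeps  : ∀ s → keep (toℕ s) ⇔ s ∈ S
      arcs   : ∀ s t → arc (toℕ s) (toℕ t) ⇔ s ⟶ t
      turns  : ∀ s → s ∈ S → ∀ a → turn (toℕ s) (toℕ a) ⇔ a ≡ lookup σ s
      labels : ∀ s → s ∈ S → ∀ q → bit-at x (atL + (toℕ s * p + toℕ q)) ≡ true ⇔ q ∈ lookup L s

  Satᵍ : ℕ → ℕ → Formula p k → Set
  Satᵍ i e ψ = ∀ s → s ∈ S → sat i e (toℕ s) n ⇔ (M , s ⊨ ψ)

  Controlsᵍ : ℕ → (ℕ → Set) → ℕ → Set
  Controlsᵍ c Z s = ∀ a → a < k → turn s a →
    (bit-at x (c + a) ≡ true → ∃[ t ] t < n × arc s t × Z t) × (¬ bit-at x (c + a) ≡ true → ∀ t → t < n → arc s t → Z t)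

  module _ (D : Describes) where
    open Describes D

    every : {Q : ℕ → Set} → (∀ s → s ∈ S → Q (toℕ s)) → ∀ i → i < n → keep i → Q i
    every {Q} h i i<n = below {P = λ i → keep i → Q i} (λ s kept → h s (Equivalence.to (keeps s) kept)) i<n

    every⁻¹ : {Q : ℕ → Set} → (∀ i → i < n → keep i → Q i) → ∀ s → s ∈ S → Q (toℕ s)
    every⁻¹ h s s∈S = h (toℕ s) (Fin.toℕ<n s) (Equivalence.from (keeps s) s∈S)

    -- The owner of `s` is unique, so the quantifier over players collapses to it. Agreement of `Zᵍ`
    -- and `Z` on `S` is enough, as successors lie in `S`.
    controls-iff : ∀ {c} {A : Subset k} → (∀ a → bit-at x (c + toℕ a) ≡ lookup A a) →
      ∀ {Zᵍ : ℕ → Set} {Z : Fin n → Set} → (∀ t → t ∈ S → Zᵍ (toℕ t) ⇔ Z t) → ∀ s → s ∈ S → Controlsᵍ c Zᵍ (toℕ s) ⇔ Controls A Z s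
    controls-iff {c} {A} bits {Zᵍ} {Z} Z-iff s s∈S = mk⇔ to from
      where
      a₀ = lookup σ s
      owner : turn (toℕ s) (toℕ a₀)
      owner = Equivalence.from (turns s s∈S a₀) refl
      member : ∀ a → bit-at x (c + toℕ a) ≡ true ⇔ a ∈ A
      member a = mk⇔ (λ e → Vec.lookup⇒[]= a A (trans (sym (bits a)) e)) (λ e → trans (bits a) (Vec.[]=⇒lookup e))
      to : Controlsᵍ c Zᵍ (toℕ s) → Controls A Z s
      to h = (λ a∈A → let (t , t< , r , z) = proj₁ (h (toℕ a₀) (Fin.toℕ<n a₀) owner) (Equivalence.from (member a₀) a∈A)
                          t≡ = Fin.toℕ-fromℕ< t<
                          s⟶t = Equivalence.to (arcs s (fromℕ< t<)) (subst (arc (toℕ s)) (sym t≡) r)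
                      in fromℕ< t< , s⟶t , Equivalence.to (Z-iff (fromℕ< t<) (⟶-target s⟶t)) (subst Zᵍ (sym t≡) z))
           , λ a∉A t s⟶t → Equivalence.to (Z-iff t (⟶-target s⟶t))
               (proj₂ (h (toℕ a₀) (Fin.toℕ<n a₀) owner) (a∉A ∘ Equivalence.to (member a₀)) (toℕ t) (Fin.toℕ<n t) (Equivalence.from (arcs s t) s⟶t))
      from : Controls A Z s → Controlsᵍ c Zᵍ (toℕ s)
      from (own , other) a a< = below {P = λ a → turn (toℕ s) a → (bit-at x (c + a) ≡ true → ∃[ t ] t < n × arc (toℕ s) t × Zᵍ t) ×
          (¬ bit-at x (c + a) ≡ true → ∀ t → t < n → arc (toℕ s) t → Zᵍ t)} at-owner a<
        where
        at-owner : ∀ a → turn (toℕ s) (toℕ a) → (bit-at x (c + toℕ a) ≡ true → ∃[ t ] t < n × arc (toℕ s) t × Zᵍ t) ×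
          (¬ bit-at x (c + toℕ a) ≡ true → ∀ t → t < n → arc (toℕ s) t → Zᵍ t)
        at-owner a is-turn with Equivalence.to (turns s s∈S a) is-turn
        ... | refl = (λ e → let (t , r , z) = own (Equivalence.to (member a₀) e)
                            in toℕ t , Fin.toℕ<n t , Equivalence.from (arcs s t) r , Equivalence.from (Z-iff t (⟶-target r)) z)
                   , λ ne t t< → below {P = λ t → arc (toℕ s) t → Zᵍ t} (λ t r → let s⟶t = Equivalence.to (arcs s t) r
                       in Equivalence.from (Z-iff t (⟶-target s⟶t)) (other (ne ∘ Equivalence.from (member a₀)) t s⟶t)) t<

-- From a table to a repair

module RepairSound (x : Word) (l : ℕ) (g : Table) (n p k s₀ : ℕ) (s₀<n : s₀ < n) where
  open CodePositions n p k s₀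
  open RepairFormula

  ρ : Vec ℕ 6
  ρ = s₀ ∷ k ∷ p ∷ n ∷ length x ∷ l ∷ []

  module Structures (header : ⟦ headerᶠ ⟧ x g ρ) (edges : ⟦ edgesᶠ ⟧ x g ρ) (isTotal : ⟦ totalᶠ ⟧ x g ρ)
    (owners : ⟦ ownersᶠ ⟧ x g ρ) (sub : ⟦ subᶠ ⟧ x g ρ) where

    off : ℕ → ℕ → Set
    off s j = g (3 ∷ s ∷ j ∷ 0 ∷ 0 ∷ []) ≡ true

    turn : ℕ → ℕ → Set
    turn s a = g (2 ∷ s ∷ a ∷ 0 ∷ 0 ∷ []) ≡ true

    -- Each offset entry leads to the next one, and `c` counts those that are left. Offsets need not
    -- be unique: one thread through them already spells out all owners.
    chain : ∀ c s j → s + c ≡ n → j < suc (length x) → off s j →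
      Σ[ v ∈ Vec (Fin k) c ] ∃[ f ] f < suc (length x) × Seg x j (encodeVec encodeFin v) f × off n f × ∀ i → turn (s + toℕ i) (toℕ (lookup v i))
    chain zero    s j s≡n j≤ o = [] , j , j≤ , refl , subst (λ s → off s j) (trans (sym (+-identityʳ s)) s≡n) o , λ ()
    chain (suc c) s j s≡n j≤ o =
      let (a , a< , t , u , j′< , o′) = proj₁ (proj₂ owners) s (≤-trans (m<m+n s (s≤s z≤n)) (≤-reflexive s≡n)) j j≤ o
          (v , f , f≤ , seg , of , ts) = chain c (suc s) (j + suc a) (trans (sym (+-suc s c)) s≡n) j′< o′
          a≡ = Fin.toℕ-fromℕ< a<
      in fromℕ< a< ∷ v , f , f≤
       , seg-++ (encodeFin (fromℕ< a<)) (subst (λ b → Seg x j (encodeℕ b) (j + suc a)) (sym a≡) (seg-unary a u)) seg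
       , of , λ { zero → subst₂ turn (sym (+-identityʳ s)) (sym a≡) t ; (suc i) → subst (λ s → turn s (toℕ (lookup v i))) (sym (+-suc s (toℕ i))) (ts i) }

    all-owners : Σ[ v ∈ Vec (Fin k) n ] ∃[ f ] f < suc (length x) × Seg x atσ (encodeVec encodeFin v) f × off n f × ∀ i → turn (toℕ i) (toℕ (lookup v i))
    all-owners = chain n 0 atσ refl (proj₁ (proj₁ owners)) (proj₂ (proj₁ owners))

    σ : Vec (Fin k) n
    σ = proj₁ all-owners

    is-state : ℕ → Bool
    is-state s = bit-at x (atS + s)

    is-edge is-label : ℕ → ℕ → Bool
    is-edge s t  = bit-at x (atR + (s * n + t))
    is-label s q = bit-at x (atL + (s * p + q))

    kept : ℕ → Bool
    kept s = g (0 ∷ s ∷ 0 ∷ 0 ∷ 0 ∷ [])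

    kept-edge : ℕ → ℕ → Bool
    kept-edge s t = g (1 ∷ s ∷ t ∷ 0 ∷ 0 ∷ [])

    start : Fin n
    start = fromℕ< s₀<n

    start≡ : toℕ start ≡ s₀
    start≡ = Fin.toℕ-fromℕ< s₀<n

    in-set : ∀ h (s : Fin n) → s ∈ comprehension n h ⇔ h (toℕ s) ≡ true
    in-set h s = ∈-comprehension h

    M M′ : GameStructure n p k
    M = record
      { S = comprehension n is-state ; s₀ = start ; R = relation n n is-edge ; L = relation n p is-label ; σ = σ
      ; s₀∈S = Equivalence.from (in-set is-state start) (subst (λ s → is-state s ≡ true) (sym start≡) (proj₂ (proj₂ (proj₂ (proj₂ header)))))
      ; R⊆S×S = λ {s} {t} e →
          let (a , b) = edges (toℕ s) (Fin.toℕ<n s) (toℕ t) (Fin.toℕ<n t) (Equivalence.to (∈-relation is-edge s t) e)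
          in Equivalence.from (in-set is-state s) a , Equivalence.from (in-set is-state t) b }
    M′ = record
      { S = comprehension n kept ; s₀ = start ; R = relation n n kept-edge ; L = relation n p is-label ; σ = σ
      ; s₀∈S = Equivalence.from (in-set kept start) (subst (λ s → kept s ≡ true) (sym start≡) (proj₁ sub))
      ; R⊆S×S = λ {s} {t} e →
          let (_ , a , b) = proj₁ (proj₂ (proj₂ sub)) (toℕ s) (Fin.toℕ<n s) (toℕ t) (Fin.toℕ<n t) (Equivalence.to (∈-relation kept-edge s t) e)
          in Equivalence.from (in-set kept s) a , Equivalence.from (in-set kept t) b }

    M-total : GameStructure.Total M
    M-total {s} e =
      let (t , t< , r) = isTotal (toℕ s) (Fin.toℕ<n s) (Equivalence.to (in-set is-state s) e)
      in fromℕ< t< , Equivalence.from (∈-relation is-edge s (fromℕ< t<)) (subst (λ t → is-edge (toℕ s) t ≡ true) (sym (Fin.toℕ-fromℕ< t<)) r)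

    M′-total : GameStructure.Total M′
    M′-total {s} e =
      let (t , t< , r) = proj₂ (proj₂ (proj₂ sub)) (toℕ s) (Fin.toℕ<n s) (Equivalence.to (in-set kept s) e)
      in fromℕ< t< , Equivalence.from (∈-relation kept-edge s (fromℕ< t<)) (subst (λ t → kept-edge (toℕ s) t ≡ true) (sym (Fin.toℕ-fromℕ< t<)) r)

    M′⊑M : M′ ⊑ M
    M′⊑M = record
      { S′⊆S = λ {s} e → Equivalence.from (in-set is-state s) (proj₁ (proj₂ sub) (toℕ s) (Fin.toℕ<n s) (Equivalence.to (in-set kept s) e))
      ; s₀′≡s₀ = refl
      ; R′⊆R = λ {s} {t} e → Equivalence.from (∈-relation is-edge s t)
          (proj₁ (proj₁ (proj₂ (proj₂ sub)) (toℕ s) (Fin.toℕ<n s) (toℕ t) (Fin.toℕ<n t) (Equivalence.to (∈-relation kept-edge s t) e)))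
      ; L′≡L↾S′ = λ _ → refl
      ; σ′≡σ↾S′ = λ _ → refl }

    open Frame x g atL M′ (λ {s} → M′-total {s}) hiding (turn)
    open Game M′ (λ {s} → M′-total {s}) using (Controls; Stage; ⊨-X; ⊨-V)

    describes : Describes
    describes = record
      { keeps  = λ s → iff-sym (in-set kept s)
      ; arcs   = λ s t → iff-sym (∈-relation kept-edge s t)
      ; turns  = λ s _ a → mk⇔
          (λ t → Fin.toℕ-injective (proj₂ (proj₂ owners) (toℕ s) (Fin.toℕ<n s) (toℕ a) (Fin.toℕ<n a) (toℕ (lookup σ s)) (Fin.toℕ<n (lookup σ s)) (t , owned s)))
          (λ { refl → owned s })
      ; labels = λ s _ q → iff-sym (∈-relation is-label s q) }
      where
      owned : ∀ s → turn (toℕ s) (toℕ (lookup σ s))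
      owned = proj₂ (proj₂ (proj₂ (proj₂ (proj₂ all-owners))))

    module Nodes (nodes : ⟦ nodesᶠ ⟧ x g ρ) where

      ρ₈ : ℕ → ℕ → Vec ℕ 8
      ρ₈ i e = e ∷ i ∷ ρ

      Parsed : ℕ → ℕ → Set
      Parsed i e = Σ[ ψ ∈ Formula p k ] Seg x i (encodeFormula ψ) e × Satᵍ i e ψ

      tagged : ∀ {i e} b₀ b₁ b₂ {w} → ⟦ tagᶠ b₀ b₁ b₂ ⟧ x g (ρ₈ i e) → Seg x (3 + i) w e → Seg x i (b₀ ∷ b₁ ∷ b₂ ∷ w) e
      tagged {i} {e} b₀ b₁ b₂ (t₀ , t₁ , t₂) seg =
        Equivalence.to (literal-correct b₀ {g = g} {ρ = ρ₈ i e} I) t₀ , Equivalence.to (literal-correct b₁ {g = g} {ρ = ρ₈ i e} (lit 1 ⊕ I)) t₁ ,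
        Equivalence.to (literal-correct b₂ {g = g} {ρ = ρ₈ i e} (lit 2 ⊕ I)) t₂ , seg

      coalition : ℕ → Subset k
      coalition c = comprehension k (λ a → bit-at x (c + a))

      coalition-bits : ∀ c a → bit-at x (c + toℕ a) ≡ lookup (coalition c) a
      coalition-bits c a = sym (Vec.lookup∘tabulate (λ a → bit-at x (c + toℕ a)) a)

      coalition-seg : ∀ c → Seg x c (encodeSubset (coalition c)) (c + k)
      coalition-seg c = seg-subset (coalition c) (coalition-bits c)

      sat-every : ∀ {i e} {Q : ℕ → Set} {ψ : Formula p k} → (∀ s → s < n → keep s → (sat i e s n → Q s) × (Q s → sat i e s n)) →
        (∀ s → s ∈ GameStructure.S M′ → Q (toℕ s) ⇔ (M′ , s ⊨ ψ)) → Satᵍ i e ψ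
      sat-every h Q-iff s s∈S = iff-trans (iff-pair (every⁻¹ describes h s s∈S)) (Q-iff s s∈S)

      stages : ∀ {i e j m c φ ψ A} → (∀ a → bit-at x (c + toℕ a) ≡ lookup A a) → Satᵍ j m φ → Satᵍ m e ψ →
        (∀ s → s < n → keep s → sat i e s 0 × (∀ r → r < n →
          (sat i e s (suc r) → sat m e s n × (sat j m s n ⊎ Controlsᵍ c (λ t → sat i e t r) s)) ×
          (sat m e s n × (sat j m s n ⊎ Controlsᵍ c (λ t → sat i e t r) s) → sat i e s (suc r)))) →
        ∀ r → r ≤ n → ∀ s → s ∈ GameStructure.S M′ → sat i e (toℕ s) r ⇔ Stage A (λ t → M′ , t ⊨ φ) (λ t → M′ , t ⊨ ψ) r s
      stages bits okφ okψ h zero    r≤ s s∈S = mk⇔ _ λ _ → proj₁ (every⁻¹ describes h s s∈S)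
      stages bits okφ okψ h (suc r) r≤ s s∈S = iff-trans (iff-pair (proj₂ (every⁻¹ describes h s s∈S) r r≤))
        (iff-× (okψ s s∈S) (iff-⊎ (okφ s s∈S) (controls-iff describes bits (stages bits okφ okψ h r (<⇒≤ r≤)) s s∈S)))

      -- Children start strictly later than their parent, so the fuel bounds the distance to the end
      -- of the word. The second child starts where the first one ends, and this is later too
      -- because the first is a genuine segment.
      parsed : ∀ fuel i e → length x ≤ i + fuel → i < length x → e < suc (length x) → node i e → Parsed i e
      parsed zero i e l i< e≤ is-node = ⊥-elim (<⇒≱ i< (≤-trans l (≤-reflexive (+-identityʳ i))))
      parsed (suc f) i e l i< e≤ is-node = cases (nodes i i< e e≤ is-node)
        where
        child : ∀ j e → i < j → e < suc (length x) → j < length x × node j e → Parsed j e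
        child j e i<j e≤ (j< , is-node) = parsed f j e (≤-trans l (≤-trans (≤-reflexive (+-suc i f)) (+-monoˡ-≤ f i<j))) j< e≤ is-node
        i<3+i : i < 3 + i
        i<3+i = s≤s (m≤n+m i 2)
        i<3+i+k : i < 3 + i + k
        i<3+i+k = ≤-trans i<3+i (m≤m+n (3 + i) k)
        cases : ⟦ nodeConditionᶠ ⟧ x g (ρ₈ i e) → Parsed i e
        cases (inj₁ (tag , refl , h)) = tt , tagged false false false tag refl ,
          λ s s∈S → mk⇔ _ λ _ → every⁻¹ describes h s s∈S
        cases (inj₂ (inj₁ (tag , refl , h))) = ff , tagged false false true tag refl ,
          λ s s∈S → mk⇔ (every⁻¹ describes h s s∈S) ⊥-elim
        cases (inj₂ (inj₂ (inj₁ (tag , q , q< , u , refl , h)))) =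
          let q≡ = Fin.toℕ-fromℕ< q< in atom (fromℕ< q<) ,
          tagged false true false tag (subst (λ q′ → Seg x (3 + i) (encodeℕ q′) (3 + i + suc q)) (sym q≡) (seg-unary q u)) ,
          sat-every {ψ = atom (fromℕ< q<)} h (λ s s∈S → subst (λ q → bit-at x (atL + (toℕ s * p + q)) ≡ true ⇔ (M′ , s ⊨ atom (fromℕ< q<))) q≡
            (Describes.labels describes s s∈S (fromℕ< q<)))
        cases (inj₂ (inj₂ (inj₂ (inj₁ (tag , c , h))))) =
          let (φ , seg , ok) = child (3 + i) e i<3+i e≤ c
          in ¬′ φ , tagged false true true tag seg , sat-every {ψ = ¬′ φ} h (λ s s∈S → iff-¬ (ok s s∈S))
        cases (inj₂ (inj₂ (inj₂ (inj₂ (inj₁ (tag , m , m≤ , c₁ , c₂ , h)))))) =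
          let (φ , seg₁ , ok₁) = child (3 + i) m i<3+i m≤ c₁
              (ψ , seg₂ , ok₂) = child m e (≤-trans i<3+i (seg-≤ (encodeFormula φ) seg₁)) e≤ c₂
          in φ ∧′ ψ , tagged true false false tag (seg-++ (encodeFormula φ) seg₁ seg₂) ,
             sat-every {ψ = φ ∧′ ψ} h (λ s s∈S → iff-× (ok₁ s s∈S) (ok₂ s s∈S))
        cases (inj₂ (inj₂ (inj₂ (inj₂ (inj₂ (inj₁ (tag , m , m≤ , c₁ , c₂ , h))))))) =
          let (φ , seg₁ , ok₁) = child (3 + i) m i<3+i m≤ c₁
              (ψ , seg₂ , ok₂) = child m e (≤-trans i<3+i (seg-≤ (encodeFormula φ) seg₁)) e≤ c₂
          in φ ∨′ ψ , tagged true false true tag (seg-++ (encodeFormula φ) seg₁ seg₂) ,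
             sat-every {ψ = φ ∨′ ψ} h (λ s s∈S → iff-⊎ (ok₁ s s∈S) (ok₂ s s∈S))
        cases (inj₂ (inj₂ (inj₂ (inj₂ (inj₂ (inj₂ (inj₁ (tag , c , h)))))))) =
          let (φ , seg , ok) = child (3 + i + k) e i<3+i+k e≤ c
              A = coalition (3 + i)
          in ⟪ A ⟫X φ , tagged true true false tag (seg-++ (encodeSubset A) (coalition-seg (3 + i)) seg) ,
             sat-every {ψ = ⟪ A ⟫X φ} h (λ s s∈S → iff-trans (controls-iff describes (coalition-bits (3 + i)) ok s s∈S) (iff-sym (⊨-X A φ s∈S)))
        cases (inj₂ (inj₂ (inj₂ (inj₂ (inj₂ (inj₂ (inj₂ (tag , m , m≤ , c₁ , c₂ , h)))))))) =
          let (φ , seg₁ , ok₁) = child (3 + i + k) m i<3+i+k m≤ c₁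
              (ψ , seg₂ , ok₂) = child m e (≤-trans i<3+i+k (seg-≤ (encodeFormula φ) seg₁)) e≤ c₂
              A = coalition (3 + i)
          in ⟪ A ⟫[ φ V ψ ] , tagged true true true tag (seg-++ (encodeSubset A) (coalition-seg (3 + i)) (seg-++ (encodeFormula φ) seg₁ seg₂)) ,
             λ s s∈S → iff-trans (stages (coalition-bits (3 + i)) ok₁ ok₂ h n ≤-refl s s∈S) (iff-sym (⊨-V A φ ψ s∈S))

      repairable : ⟦ rootᶠ ⟧ x g ρ → ModelRepair x
      repairable root = instance′ , seg-whole x (encode instance′) whole , M′ , M′⊑M , (λ {s} → M′-total {s}) ,
        Equivalence.to (ok start (GameStructure.s₀∈S M′)) (subst (λ s → sat f (length x) s n) (sym start≡) (proj₂ at-f))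
        where
        f = proj₁ (proj₂ all-owners)
        f≤ = proj₁ (proj₂ (proj₂ all-owners))
        owner-codes = proj₁ (proj₂ (proj₂ (proj₂ all-owners)))
        at-f = root f f≤ (proj₁ (proj₂ (proj₂ (proj₂ (proj₂ all-owners)))))
        formula : Parsed f (length x)
        formula = parsed (length x) f (length x) (m≤n+m (length x) f) (proj₁ (proj₁ at-f)) ≤-refl (proj₂ (proj₁ at-f))
        η  = proj₁ formula
        ok = proj₂ (proj₂ formula)
        instance′ : Instance
        instance′ = record { M = M ; total = λ {s} → M-total {s} ; η = η }
        whole : Seg x 0 (encode instance′) (length x)
        whole =
          seg-++ (encodeℕ n) (seg-unary n (proj₁ header)) $
          seg-++ (encodeℕ p) (seg-unary p (proj₁ (proj₂ header))) $
          seg-++ (encodeℕ k) (seg-unary k (proj₁ (proj₂ (proj₂ header)))) $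
          seg-++ (encodeStructure M)
            (seg-++ (encodeSubset (GameStructure.S M)) (seg-subset (GameStructure.S M) λ a → sym (Vec.lookup∘tabulate (is-state ∘ toℕ) a)) $
             seg-++ (encodeFin start) (subst (λ s → Seg x at₀ (encodeℕ s) atR) (sym start≡) (seg-unary s₀ (proj₁ (proj₂ (proj₂ (proj₂ header)))))) $
             seg-++ (encodeVec encodeSubset (GameStructure.R M)) (seg-matrix (GameStructure.R M) (bits is-edge)) $
             seg-++ (encodeVec encodeSubset (GameStructure.L M)) (seg-matrix (GameStructure.L M) (bits is-label))
             owner-codes)
            (proj₁ (proj₂ formula))
          where
          bits : ∀ {a b} (h : ℕ → ℕ → Bool) (s : Fin a) (t : Fin b) → h (toℕ s) (toℕ t) ≡ lookup (lookup (relation a b h) s) t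
          bits {b = b} h s t = sym (trans (cong (λ v → lookup v t) (Vec.lookup∘tabulate (λ s → comprehension b (h (toℕ s))) s))
            (Vec.lookup∘tabulate (λ t → h (toℕ s) (toℕ t)) t))

repair-sound : ∀ l x g → ⟦ RepairFormula.repairᶠ ⟧ x g (length x ∷ l ∷ []) → ModelRepair x
repair-sound l x g (n , _ , p , _ , k , _ , s₀ , s₀<n , header , edges , isTotal , owners , sub , root , nodes) = repairable root
  where
  open RepairSound x l g n p k s₀ s₀<n
  open Structures header edges isTotal owners sub
  open Nodes nodes

-- From a repair to a table

⊔-≤-++ : ∀ u {v : Word} {a b} → a ≤ length u → b ≤ length v → a ⊔ b ≤ length (u ++ v)
⊔-≤-++ u l l′ = ≤-trans (⊔-lub (≤-trans l (m≤m+n _ _)) (≤-trans l′ (m≤n+m _ _))) (≤-reflexive (sym (List.length-++ u)))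

-- Hence `length x` is enough fuel for parsing at any position of `x`.
height≤length : ∀ {p k} (φ : Formula p k) → height φ ≤ length (encodeFormula φ)
height≤length tt             = s≤s z≤n
height≤length ff             = s≤s z≤n
height≤length (atom q)       = s≤s z≤n
height≤length (¬′ φ)         = s≤s (≤-trans (height≤length φ) (m≤n+m _ 2))
height≤length (φ ∧′ ψ)       = s≤s (≤-trans (⊔-≤-++ (encodeFormula φ) (height≤length φ) (height≤length ψ)) (m≤n+m _ 2))
height≤length (φ ∨′ ψ)       = s≤s (≤-trans (⊔-≤-++ (encodeFormula φ) (height≤length φ) (height≤length ψ)) (m≤n+m _ 2))
height≤length (⟪ A ⟫X φ)     = s≤s (≤-trans (⊔-≤-++ (encodeSubset A) z≤n (height≤length φ)) (m≤n+m _ 2))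
height≤length ⟪ A ⟫[ φ V ψ ] = s≤s (≤-trans (⊔-≤-++ (encodeSubset A) z≤n (⊔-≤-++ (encodeFormula φ) (height≤length φ) (height≤length ψ))) (m≤n+m _ 2))

formula-nonempty : ∀ {p k} (φ : Formula p k) → 0 < length (encodeFormula φ)
formula-nonempty φ = ≤-trans (positive φ) (height≤length φ)
  where
  positive : ∀ φ → 0 < height φ
  positive tt             = s≤s z≤n
  positive ff             = s≤s z≤n
  positive (atom q)       = s≤s z≤n
  positive (¬′ φ)         = s≤s z≤n
  positive (φ ∧′ ψ)       = s≤s z≤n
  positive (φ ∨′ ψ)       = s≤s z≤n
  positive (⟪ A ⟫X φ)     = s≤s z≤n
  positive ⟪ A ⟫[ φ V ψ ] = s≤s z≤n

lookup-iff : ∀ {n} (A : Subset n) i {b} → b ≡ lookup A i → b ≡ true ⇔ i ∈ A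
lookup-iff A i e = mk⇔ (λ e′ → Vec.lookup⇒[]= i A (trans (sym e) e′)) (λ i∈A → trans e (Vec.[]=⇒lookup i∈A))

module RepairComplete (x : Word) {n p k : ℕ} (M : GameStructure n p k) (M-total : GameStructure.Total M) (η : Formula p k)
  (code : Seg x 0 (encodeℕ n ++ encodeℕ p ++ encodeℕ k ++ encodeStructure M ++ encodeFormula η) (length x))
  (M′ : GameStructure n p k) (sub : M′ ⊑ M) (M′-total : GameStructure.Total M′)
  (satisfied : M′ , GameStructure.s₀ M ⊨ η) where

  private
    module M  = GameStructure M
    module M′ = GameStructure M′
  open Game M′ (λ {s} → M′-total {s})
  open CodePositions n p k (toℕ M.s₀)

  Block : ℕ → ℕ → Set
  Block i a = (∀ j → j < a → bit-at x (i + j) ≡ true) × ¬ bit-at x (i + a) ≡ true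

  record Layout : Set where
    field
      n-block  : Block 0 n
      p-block  : Block atP p
      k-block  : Block atK k
      s₀-block : Block at₀ (toℕ M.s₀)
      states   : ∀ s → bit-at x (atS + toℕ s) ≡ lookup M.S s
      edges    : ∀ s t → bit-at x (atR + (toℕ s * n + toℕ t)) ≡ lookup (lookup M.R s) t
      labels   : ∀ s q → bit-at x (atL + (toℕ s * p + toℕ q)) ≡ lookup (lookup M.L s) q
      atS≤     : atS ≤ length x
      end      : ℕ
      owners   : Seg x atσ (encodeVec encodeFin M.σ) end
      formula  : Seg x end (encodeFormula η) (length x)

  layout : Layout
  layout =
    let (b₁ , r₁) = unary-split n code
        (b₂ , r₂) = unary-split p r₁
        (b₃ , r₃) = unary-split k r₂
        (end , r₄ , r₅) = seg-split (encodeStructure M) r₃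
        (states , r₆) = subset-split M.S r₄
        (b₅ , r₇) = unary-split (toℕ M.s₀) r₆
        (edges , r₈) = matrix-split M.R r₇
        (labels , r₉) = matrix-split M.L r₈
    in record
      { n-block = b₁ ; p-block = b₂ ; k-block = b₃ ; s₀-block = b₅ ; states = states ; edges = edges ; labels = labels
      ; atS≤ = seg-≤ (encodeStructure M ++ encodeFormula η) r₃ ; end = end
      ; owners = r₉ ; formula = r₅ }
    where
    subset-split : ∀ {m} (A : Subset m) {i w l} → Seg x i (encodeSubset A ++ w) l →
      (∀ a → bit-at x (i + toℕ a) ≡ lookup A a) × Seg x (i + m) w l
    subset-split A p with seg-split (encodeSubset A) p
    ... | _ , q , r with subset-seg A q
    ...   | refl , h = h , r
    matrix-split : ∀ {a b} (A : Vec (Subset b) a) {i w l} → Seg x i (encodeVec encodeSubset A ++ w) l →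
      (∀ s t → bit-at x (i + (toℕ s * b + toℕ t)) ≡ lookup (lookup A s) t) × Seg x (i + a * b) w l
    matrix-split A p with seg-split (encodeVec encodeSubset A) p
    ... | _ , q , r with matrix-seg A q
    ...   | refl , h = h , r

  open Layout layout

  end≤ : end ≤ length x
  end≤ = seg-≤ (encodeFormula η) formula

  n≤ : n ≤ length x
  n≤ = ≤-trans (≤-trans (m≤m+n n (suc p)) (≤-trans (n≤1+n _) (m≤m+n atK (suc k)))) atS≤

  p≤ : p ≤ length x
  p≤ = ≤-trans (≤-trans (n≤1+n p) (≤-trans (m≤n+m (suc p) atP) (m≤m+n atK (suc k)))) atS≤

  k≤ : k ≤ length x
  k≤ = ≤-trans (≤-trans (n≤1+n k) (m≤n+m (suc k) atK)) atS≤

  -- The intended meaning of `satᶠ`. Only release formulas depend on the stage; at stage `n` all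
  -- formulas have their proper meaning on the states of `M′`.
  Approx : Formula p k → ℕ → Fin n → Set
  Approx ⟪ A ⟫[ φ V ψ ] r s = Stage A (λ t → M′ , t ⊨ φ) (λ t → M′ , t ⊨ ψ) r s
  Approx φ              r s = M′ , s ⊨ φ

  Approx? : ∀ φ r s → Dec (Approx φ r s)
  Approx? tt             r s = ⊨-dec tt s
  Approx? ff             r s = ⊨-dec ff s
  Approx? (atom q)       r s = ⊨-dec (atom q) s
  Approx? (¬′ φ)         r s = ⊨-dec (¬′ φ) s
  Approx? (φ ∧′ ψ)       r s = ⊨-dec (φ ∧′ ψ) s
  Approx? (φ ∨′ ψ)       r s = ⊨-dec (φ ∨′ ψ) s
  Approx? (⟪ A ⟫X φ)     r s = ⊨-dec (⟪ A ⟫X φ) s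
  Approx? ⟪ A ⟫[ φ V ψ ] r s = Release.Z? A (⊨-dec φ) (⊨-dec ψ) r s

  Approx-n : ∀ φ {s} → s ∈ M′.S → Approx φ n s ⇔ (M′ , s ⊨ φ)
  Approx-n tt             s∈S = mk⇔ id id
  Approx-n ff             s∈S = mk⇔ id id
  Approx-n (atom q)       s∈S = mk⇔ id id
  Approx-n (¬′ φ)         s∈S = mk⇔ id id
  Approx-n (φ ∧′ ψ)       s∈S = mk⇔ id id
  Approx-n (φ ∨′ ψ)       s∈S = mk⇔ id id
  Approx-n (⟪ A ⟫X φ)     s∈S = mk⇔ id id
  Approx-n ⟪ A ⟫[ φ V ψ ] s∈S = iff-sym (⊨-V A φ ψ s∈S)

  -- Codes are prefix-free, so at most one formula starts at a position and the parser finds it.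
  -- Referring to it, instead of quantifying over formulas, makes `Listed` decidable.
  OnParsed : Maybe (Formula p k × Word) → (Formula p k → Set) → Set
  OnParsed (just (φ , _)) Q = Q φ
  OnParsed nothing        Q = ⊥

  on-parsed? : ∀ m {Q} → (∀ φ → Dec (Q φ)) → Dec (OnParsed m Q)
  on-parsed? (just (φ , _)) Q? = Q? φ
  on-parsed? nothing        Q? = no λ ()

  parse-at : ℕ → Maybe (Formula p k × Word)
  parse-at i = parse (length x) (drop i x)

  Spans : ℕ → ℕ → Formula p k → Set
  Spans i e φ = i < length x × e ≡ i + length (encodeFormula φ) × e ≤ length x

  Listed : Vec ℕ 5 → Set
  Listed (0 ∷ a ∷ b ∷ c ∷ d ∷ []) = (∃[ s ] a ≡ toℕ s × s ∈ M′.S) × b ≡ 0 × c ≡ 0 × d ≡ 0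
  Listed (1 ∷ a ∷ b ∷ c ∷ d ∷ []) = (∃[ s ] ∃[ t ] a ≡ toℕ s × b ≡ toℕ t × s M′.⟶ t) × c ≡ 0 × d ≡ 0
  Listed (2 ∷ a ∷ b ∷ c ∷ d ∷ []) = (∃[ s ] a ≡ toℕ s × b ≡ toℕ (lookup M.σ s)) × c ≡ 0 × d ≡ 0
  Listed (3 ∷ a ∷ b ∷ c ∷ d ∷ []) = (a ≤ n × b ≡ offset M.σ atσ a) × c ≡ 0 × d ≡ 0
  Listed (4 ∷ a ∷ b ∷ c ∷ d ∷ []) = OnParsed (parse-at a) (Spans a b) × c ≡ 0 × d ≡ 0
  Listed (5 ∷ a ∷ b ∷ c ∷ d ∷ []) = OnParsed (parse-at a) λ φ → Spans a b φ × d ≤ n × ∃[ s ] c ≡ toℕ s × Approx φ d s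
  Listed _                        = ⊥

  Spans? : ∀ i e φ → Dec (Spans i e φ)
  Spans? i e φ = i <? length x ×-dec e ≟ i + length (encodeFormula φ) ×-dec e ≤? length x

  Listed? : ∀ as → Dec (Listed as)
  Listed? (0 ∷ a ∷ b ∷ c ∷ d ∷ []) = Fin.any? (λ s → a ≟ toℕ s ×-dec s ∈? M′.S) ×-dec b ≟ 0 ×-dec c ≟ 0 ×-dec d ≟ 0
  Listed? (1 ∷ a ∷ b ∷ c ∷ d ∷ []) = Fin.any? (λ s → Fin.any? λ t → a ≟ toℕ s ×-dec b ≟ toℕ t ×-dec t ∈? lookup M′.R s) ×-dec c ≟ 0 ×-dec d ≟ 0
  Listed? (2 ∷ a ∷ b ∷ c ∷ d ∷ []) = Fin.any? (λ s → a ≟ toℕ s ×-dec b ≟ toℕ (lookup M.σ s)) ×-dec c ≟ 0 ×-dec d ≟ 0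
  Listed? (3 ∷ a ∷ b ∷ c ∷ d ∷ []) = (a ≤? n ×-dec b ≟ offset M.σ atσ a) ×-dec c ≟ 0 ×-dec d ≟ 0
  Listed? (4 ∷ a ∷ b ∷ c ∷ d ∷ []) = on-parsed? (parse-at a) (Spans? a b) ×-dec c ≟ 0 ×-dec d ≟ 0
  Listed? (5 ∷ a ∷ b ∷ c ∷ d ∷ []) = on-parsed? (parse-at a) λ φ → Spans? a b φ ×-dec d ≤? n ×-dec Fin.any? λ s → c ≟ toℕ s ×-dec Approx? φ d s
  Listed? (suc (suc (suc (suc (suc (suc _))))) ∷ _) = no λ ()

  abstract
    g : Table
    g as = does (Listed? as)

    g-iff : ∀ as → g as ≡ true ⇔ Listed as
    g-iff as = iff-sym (reflects-⇔ (proof (Listed? as)))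

  -- Components are tags up to 5 or else states, players, positions and stages, all at most
  -- `length x` because `n` and `k` are written in unary in the word.
  supported : Supported (6 + length x) g
  supported as e = bounds as (Equivalence.to (g-iff as) e)
    where
    tag< : ∀ {a} → a ≤ 5 → a < 6 + length x
    tag< l = ≤-trans (s≤s l) (m≤m+n 6 (length x))
    ok : ∀ {a} → a ≤ length x → a < 6 + length x
    ok l = s≤s (≤-trans l (m≤n+m (length x) 5))
    fin : ∀ {m} (i : Fin m) → m ≤ length x → toℕ i < 6 + length x
    fin i l = ok (≤-trans (<⇒≤ (Fin.toℕ<n i)) l)
    bounds : ∀ as → Listed as → All (_< 6 + length x) as
    bounds (0 ∷ a ∷ b ∷ c ∷ d ∷ []) ((s , refl , _) , refl , refl , refl) = tag< z≤n All.∷ fin s n≤ All.∷ ok z≤n All.∷ ok z≤n All.∷ ok z≤n All.∷ All.[]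
    bounds (1 ∷ a ∷ b ∷ c ∷ d ∷ []) ((s , t , refl , refl , _) , refl , refl) =
      tag< (s≤s z≤n) All.∷ fin s n≤ All.∷ fin t n≤ All.∷ ok z≤n All.∷ ok z≤n All.∷ All.[]
    bounds (2 ∷ a ∷ b ∷ c ∷ d ∷ []) ((s , refl , refl) , refl , refl) =
      tag< (s≤s (s≤s z≤n)) All.∷ fin s n≤ All.∷ fin (lookup M.σ s) k≤ All.∷ ok z≤n All.∷ ok z≤n All.∷ All.[]
    bounds (3 ∷ a ∷ b ∷ c ∷ d ∷ []) ((a≤ , refl) , refl , refl) =
      tag< (s≤s (s≤s (s≤s z≤n))) All.∷ ok (≤-trans a≤ n≤) All.∷ ok (≤-trans (offset-≤ M.σ owners a) end≤) All.∷ ok z≤n All.∷ ok z≤n All.∷ All.[]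
    bounds (4 ∷ a ∷ b ∷ c ∷ d ∷ []) (h , refl , refl) with parse-at a | h
    ... | just _ | (a< , _ , b≤) =
      tag< (s≤s (s≤s (s≤s (s≤s z≤n)))) All.∷ ok (<⇒≤ a<) All.∷ ok b≤ All.∷ ok z≤n All.∷ ok z≤n All.∷ All.[]
    bounds (5 ∷ a ∷ b ∷ c ∷ d ∷ []) h with parse-at a | h
    ... | just _ | ((a< , _ , b≤) , d≤ , s , refl , _) =
      tag< ≤-refl All.∷ ok (<⇒≤ a<) All.∷ ok b≤ All.∷ fin s n≤ All.∷ ok (≤-trans d≤ n≤) All.∷ All.[]

  open Frame x g atL M′ (λ {s} → M′-total {s})

  parse-seg : ∀ {i e} φ → Seg x i (encodeFormula φ) e → e ≤ length x → parse-at i ≡ just (φ , drop e x)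
  parse-seg {i} {e} φ seg e≤ = trans (cong (parse (length x)) (drop-seg x i (encodeFormula φ) seg e≤))
    (parse-complete φ (drop e x) (length x) (≤-trans (height≤length φ)
      (≤-trans (m≤n+m _ i) (≤-trans (≤-reflexive (sym (seg-end (encodeFormula φ) seg))) e≤))))

  seg-< : ∀ {i e} (φ : Formula p k) → Seg x i (encodeFormula φ) e → i < e
  seg-< {i} φ seg = ≤-trans (m<m+n i (formula-nonempty φ)) (≤-reflexive (sym (seg-end (encodeFormula φ) seg)))

  spans-seg : ∀ {i e} φ → Seg x i (encodeFormula φ) e → e ≤ length x → Spans i e φ
  spans-seg φ seg e≤ = ≤-trans (seg-< φ seg) e≤ , seg-end (encodeFormula φ) seg , e≤

  node-intro : ∀ {i e} φ → Seg x i (encodeFormula φ) e → e ≤ length x → node i e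
  node-intro {i} {e} φ seg e≤ = Equivalence.from (g-iff (4 ∷ i ∷ e ∷ 0 ∷ 0 ∷ []))
    (subst (λ m → OnParsed m (Spans i e)) (sym (parse-seg φ seg e≤)) (spans-seg φ seg e≤) , refl , refl)

  node-elim : ∀ {i e} → node i e → Σ[ φ ∈ Formula p k ] Seg x i (encodeFormula φ) e
  node-elim {i} {e} h with parse-at i in eq | proj₁ (Equivalence.to (g-iff (4 ∷ i ∷ e ∷ 0 ∷ 0 ∷ [])) h)
  ... | just (φ , r) | i< , refl , e≤ = φ , seg-drop x i {encodeFormula φ} {r} (parse-sound (length x) (drop i x) eq) (<⇒≤ i<)

  sat-iff : ∀ {i e} φ → Seg x i (encodeFormula φ) e → e ≤ length x → ∀ s r → r ≤ n → sat i e (toℕ s) r ⇔ Approx φ r s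
  sat-iff {i} {e} φ seg e≤ s r r≤ = iff-trans (g-iff (5 ∷ i ∷ e ∷ toℕ s ∷ r ∷ []))
    (subst (λ m → OnParsed m (λ φ → Spans i e φ × r ≤ n × ∃[ s′ ] toℕ s ≡ toℕ s′ × Approx φ r s′) ⇔ Approx φ r s) (sym (parse-seg φ seg e≤))
      (mk⇔ (λ (_ , _ , s′ , e , a) → subst (Approx φ r) (Fin.toℕ-injective (sym e)) a)
           (λ a → spans-seg φ seg e≤ , r≤ , s , refl , a)))

  satᵍ : ∀ {i e} φ → Seg x i (encodeFormula φ) e → e ≤ length x → Satᵍ i e φ
  satᵍ φ seg e≤ s s∈S = iff-trans (sat-iff φ seg e≤ s n ≤-refl) (Approx-n φ s∈S)

  turn-intro : ∀ s → turn (toℕ s) (toℕ (lookup M.σ s))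
  turn-intro s = Equivalence.from (g-iff (2 ∷ toℕ s ∷ toℕ (lookup M.σ s) ∷ 0 ∷ 0 ∷ [])) ((s , refl , refl) , refl , refl)

  turn-elim : ∀ s a → turn (toℕ s) a → a ≡ toℕ (lookup M.σ s)
  turn-elim s a h with Equivalence.to (g-iff (2 ∷ toℕ s ∷ a ∷ 0 ∷ 0 ∷ [])) h
  ... | (s′ , e , refl) , _ = cong (λ s → toℕ (lookup M.σ s)) (Fin.toℕ-injective (sym e))

  describes : Describes
  describes = record
    { keeps  = λ s → iff-trans (g-iff (0 ∷ toℕ s ∷ 0 ∷ 0 ∷ 0 ∷ []))
        (mk⇔ (λ ((s′ , e , in-S) , _) → subst (_∈ M′.S) (Fin.toℕ-injective (sym e)) in-S) (λ in-S → (s , refl , in-S) , refl , refl , refl))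
    ; arcs   = λ s t → iff-trans (g-iff (1 ∷ toℕ s ∷ toℕ t ∷ 0 ∷ 0 ∷ []))
        (mk⇔ (λ ((s′ , t′ , e , e′ , r) , _) → subst₂ M′._⟶_ (Fin.toℕ-injective (sym e)) (Fin.toℕ-injective (sym e′)) r) (λ r → (s , t , refl , refl , r) , refl , refl))
    ; turns  = λ s s∈S a → mk⇔
        (λ h → Fin.toℕ-injective (trans (turn-elim s (toℕ a) h) (cong toℕ (sym (_⊑_.σ′≡σ↾S′ sub s∈S)))))
        (λ e → subst (λ a → turn (toℕ s) (toℕ a)) (sym (trans e (_⊑_.σ′≡σ↾S′ sub s∈S))) (turn-intro s))
    ; labels = λ s s∈S q → subst (λ A → bit-at x (atL + (toℕ s * p + toℕ q)) ≡ true ⇔ q ∈ A) (sym (_⊑_.L′≡L↾S′ sub s∈S)) (lookup-iff (lookup M.L s) q (labels s q)) }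

  literal-intro : ∀ {d} {ρ : Vec ℕ d} b a → bit-at x (value a ρ) ≡ b → ⟦ RepairFormula.literal b a ⟧ x g ρ
  literal-intro {ρ = ρ} b a = Equivalence.from (RepairFormula.literal-correct b {g = g} {ρ = ρ} a)

  module _ (l : ℕ) where
    open RepairFormula

    ρ : Vec ℕ 6
    ρ = toℕ M.s₀ ∷ k ∷ p ∷ n ∷ length x ∷ l ∷ []

    state-iff : ∀ s → bit-at x (atS + toℕ s) ≡ true ⇔ s ∈ M.S
    state-iff s = lookup-iff M.S s (states s)

    edge-iff : ∀ s t → bit-at x (atR + (toℕ s * n + toℕ t)) ≡ true ⇔ s M.⟶ t
    edge-iff s t = lookup-iff (lookup M.R s) t (edges s t)

    headerᶠ-holds : ⟦ headerᶠ ⟧ x g ρ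
    headerᶠ-holds = n-block , p-block , k-block , s₀-block , Equivalence.from (state-iff M.s₀) M.s₀∈S

    edgesᶠ-holds : ⟦ edgesᶠ ⟧ x g ρ
    edgesᶠ-holds s s< t t< = below {P = λ s → bit-at x (atR + (s * n + t)) ≡ true → bit-at x (atS + s) ≡ true × bit-at x (atS + t) ≡ true}
      (λ s → below {P = λ t → bit-at x (atR + (toℕ s * n + t)) ≡ true → bit-at x (atS + toℕ s) ≡ true × bit-at x (atS + t) ≡ true}
        (λ t e → let (a , b) = M.R⊆S×S (Equivalence.to (edge-iff s t) e) in Equivalence.from (state-iff s) a , Equivalence.from (state-iff t) b) t<) s<

    totalᶠ-holds : ⟦ totalᶠ ⟧ x g ρ
    totalᶠ-holds s s< = below {P = λ s → bit-at x (atS + s) ≡ true → ∃[ t ] t < n × bit-at x (atR + (s * n + t)) ≡ true}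
      (λ s e → let (t , r) = M-total (Equivalence.to (state-iff s) e) in toℕ t , Fin.toℕ<n t , Equivalence.from (edge-iff s t) r) s<

    off-intro : ∀ s → s ≤ n → g (3 ∷ s ∷ offset M.σ atσ s ∷ 0 ∷ 0 ∷ []) ≡ true
    off-intro s s≤ = Equivalence.from (g-iff (3 ∷ s ∷ offset M.σ atσ s ∷ 0 ∷ 0 ∷ [])) ((s≤ , refl) , refl , refl)

    off-elim : ∀ s j → g (3 ∷ s ∷ j ∷ 0 ∷ 0 ∷ []) ≡ true → j ≡ offset M.σ atσ s
    off-elim s j h = proj₂ (proj₁ (Equivalence.to (g-iff (3 ∷ s ∷ j ∷ 0 ∷ 0 ∷ [])) h))

    ownersᶠ-holds : ⟦ ownersᶠ ⟧ x g ρ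
    ownersᶠ-holds = (s≤s (≤-trans (seg-≤ (encodeVec encodeFin M.σ) owners) end≤) , off-intro 0 z≤n) , step-owner , unique-owner
      where
      Next : ℕ → ℕ → Set
      Next s j = ∃[ a ] a < k × turn s a × Block j a × j + suc a < suc (length x) × g (3 ∷ suc s ∷ j + suc a ∷ 0 ∷ 0 ∷ []) ≡ true
      next-owner : ∀ s → Next (toℕ s) (offset M.σ atσ (toℕ s))
      next-owner s =
        let a = lookup M.σ s
            (seg , ≤end) = offset-entry M.σ owners s
            e = trans (seg-end (encodeFin a) seg) (cong (offset M.σ atσ (toℕ s) +_) (length-encodeℕ (toℕ a)))
        in toℕ a , Fin.toℕ<n a , turn-intro s , unary-seg (toℕ a) seg , s≤s (≤-trans (≤-reflexive (sym e)) (≤-trans ≤end end≤)) ,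
           subst (λ j → g (3 ∷ suc (toℕ s) ∷ j ∷ 0 ∷ 0 ∷ []) ≡ true) e (off-intro (suc (toℕ s)) (Fin.toℕ<n s))
      step-owner : ∀ s → s < n → ∀ j → j < suc (length x) → g (3 ∷ s ∷ j ∷ 0 ∷ 0 ∷ []) ≡ true → Next s j
      step-owner s s< j j< h = subst (Next s) (sym (off-elim s j h)) (below {P = λ s → Next s (offset M.σ atσ s)} next-owner s<)
      unique-owner : ∀ s → s < n → ∀ a → a < k → ∀ b → b < k → turn s a × turn s b → a ≡ b
      unique-owner s s< a a< b b< = below {P = λ s → turn s a × turn s b → a ≡ b}
        (λ s (h , h′) → trans (turn-elim s a h) (sym (turn-elim s b h′))) s<

    open Describes describes using (keeps; arcs) renaming (labels to label-iff)

    subᶠ-holds : ⟦ subᶠ ⟧ x g ρ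
    subᶠ-holds = Equivalence.from (keeps M.s₀) s₀∈S′ ,
      every describes (λ s s∈S → Equivalence.from (state-iff s) (_⊑_.S′⊆S sub s∈S)) ,
      (λ s s< t t< → below {P = λ s → arc s t → bit-at x (atR + (s * n + t)) ≡ true × keep s × keep t}
        (λ s → below {P = λ t → arc (toℕ s) t → bit-at x (atR + (toℕ s * n + t)) ≡ true × keep (toℕ s) × keep t}
          (λ t h → let r = Equivalence.to (arcs s t) h ; (a , b) = M′.R⊆S×S r
                   in Equivalence.from (edge-iff s t) (_⊑_.R′⊆R sub r) , Equivalence.from (keeps s) a , Equivalence.from (keeps t) b) t<) s<) ,
      every describes (λ s s∈S → let (t , r) = M′-total s∈S in toℕ t , Fin.toℕ<n t , Equivalence.from (arcs s t) r)
      where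
      s₀∈S′ : M.s₀ ∈ M′.S
      s₀∈S′ = subst (_∈ M′.S) (_⊑_.s₀′≡s₀ sub) M′.s₀∈S

    rootᶠ-holds : ⟦ rootᶠ ⟧ x g ρ
    rootᶠ-holds f f≤ h = subst (λ f → (f < length x × node f (length x)) × sat f (length x) (toℕ M.s₀) n)
      (sym (trans (off-elim n f h) (offset-end M.σ owners)))
      ((seg-< η formula , node-intro η formula ≤-refl) ,
        Equivalence.from (satᵍ η formula ≤-refl M.s₀ (subst (_∈ M′.S) (_⊑_.s₀′≡s₀ sub) M′.s₀∈S)) satisfied)

    nodesᶠ-holds : ⟦ nodesᶠ ⟧ x g ρ
    nodesᶠ-holds i i< e (s≤s e≤) h = let (φ , seg) = node-elim h in condition φ seg
      where
      tag : ∀ b₀ b₁ b₂ {w} → Seg x i (b₀ ∷ b₁ ∷ b₂ ∷ w) e → ⟦ tagᶠ b₀ b₁ b₂ ⟧ x g (e ∷ i ∷ ρ)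
      tag b₀ b₁ b₂ (t₀ , t₁ , t₂ , _) = literal-intro {ρ = e ∷ i ∷ ρ} b₀ I t₀ , literal-intro {ρ = e ∷ i ∷ ρ} b₁ (lit 1 ⊕ I) t₁ , literal-intro {ρ = e ∷ i ∷ ρ} b₂ (lit 2 ⊕ I) t₂
      child : ∀ {j m} φ → Seg x j (encodeFormula φ) m → m ≤ length x → j < length x × node j m
      child φ seg m≤ = ≤-trans (seg-< φ seg) m≤ , node-intro φ seg m≤
      sat-pair : ∀ {Q : ℕ → Set} φ → Seg x i (encodeFormula φ) e → (∀ s → s ∈ M′.S → Q (toℕ s) ⇔ (M′ , s ⊨ φ)) →
        ∀ s → s < n → keep s → (sat i e s n → Q s) × (Q s → sat i e s n)
      sat-pair φ seg Q-iff = every describes λ s s∈S → pair-iff (iff-trans (satᵍ φ seg e≤ s s∈S) (iff-sym (Q-iff s s∈S)))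
      condition : ∀ φ → Seg x i (encodeFormula φ) e → ⟦ nodeConditionᶠ ⟧ x g (e ∷ i ∷ ρ)
      condition tt seg@(_ , _ , _ , e≡) = inj₁ (tag false false false seg , sym e≡ ,
        every describes λ s s∈S → Equivalence.from (satᵍ tt seg e≤ s s∈S) _)
      condition ff seg@(_ , _ , _ , e≡) = inj₂ (inj₁ (tag false false true seg , sym e≡ ,
        every describes λ s s∈S → Equivalence.to (satᵍ ff seg e≤ s s∈S)))
      condition (atom q) seg@(_ , _ , _ , r) = inj₂ (inj₂ (inj₁ (tag false true false seg , toℕ q , Fin.toℕ<n q , unary-seg (toℕ q) r ,
        trans (seg-end (encodeFin q) r) (cong (3 + i +_) (length-encodeℕ (toℕ q))) ,
        sat-pair (atom q) seg (λ s s∈S → label-iff s s∈S q))))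
      condition (¬′ φ) seg@(_ , _ , _ , r) = inj₂ (inj₂ (inj₂ (inj₁ (tag false true true seg , child φ r e≤ ,
        sat-pair (¬′ φ) seg λ s s∈S → iff-¬ (satᵍ φ r e≤ s s∈S)))))
      condition (φ ∧′ ψ) seg@(_ , _ , _ , r) =
        let (m , r₁ , r₂) = seg-split (encodeFormula φ) r
            m≤ = ≤-trans (seg-≤ (encodeFormula ψ) r₂) e≤
        in inj₂ (inj₂ (inj₂ (inj₂ (inj₁ (tag true false false seg , m , s≤s m≤ , child φ r₁ m≤ , child ψ r₂ e≤ ,
          sat-pair (φ ∧′ ψ) seg λ s s∈S → iff-× (satᵍ φ r₁ m≤ s s∈S) (satᵍ ψ r₂ e≤ s s∈S))))))
      condition (φ ∨′ ψ) seg@(_ , _ , _ , r) =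
        let (m , r₁ , r₂) = seg-split (encodeFormula φ) r
            m≤ = ≤-trans (seg-≤ (encodeFormula ψ) r₂) e≤
        in inj₂ (inj₂ (inj₂ (inj₂ (inj₂ (inj₁ (tag true false true seg , m , s≤s m≤ , child φ r₁ m≤ , child ψ r₂ e≤ ,
          sat-pair (φ ∨′ ψ) seg λ s s∈S → iff-⊎ (satᵍ φ r₁ m≤ s s∈S) (satᵍ ψ r₂ e≤ s s∈S)))))))
      condition (⟪ A ⟫X φ) seg@(_ , _ , _ , r) with seg-split (encodeSubset A) r
      ... | _ , r₁ , r₂ with subset-seg A r₁
      ...   | refl , bits = inj₂ (inj₂ (inj₂ (inj₂ (inj₂ (inj₂ (inj₁ (tag true true false seg , child φ r₂ e≤ ,
          sat-pair (⟪ A ⟫X φ) seg λ s s∈S → iff-trans (controls-iff describes bits (satᵍ φ r₂ e≤) s s∈S) (iff-sym (⊨-X A φ s∈S)))))))))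
      condition ⟪ A ⟫[ φ V ψ ] seg@(_ , _ , _ , r) with seg-split (encodeSubset A) r
      ... | _ , r₁ , r₂ with subset-seg A r₁
      ...   | refl , bits =
        let (m , r₃ , r₄) = seg-split (encodeFormula φ) r₂
            m≤ = ≤-trans (seg-≤ (encodeFormula ψ) r₄) e≤
            stage = λ s r r≤ → sat-iff ⟪ A ⟫[ φ V ψ ] seg e≤ s r r≤
        in inj₂ (inj₂ (inj₂ (inj₂ (inj₂ (inj₂ (inj₂ (tag true true true seg , m , s≤s m≤ , child φ r₃ m≤ , child ψ r₄ e≤ ,
          every describes λ s s∈S → Equivalence.from (stage s 0 z≤n) _ , λ r r< → pair-iff (iff-trans (stage s (suc r) r<) (iff-sym
            (iff-× (satᵍ ψ r₄ e≤ s s∈S) (iff-⊎ (satᵍ φ r₃ m≤ s s∈S) (controls-iff describes bits (λ t _ → stage t r (<⇒≤ r<)) s s∈S))))))))))))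

    repairᶠ-holds : ⟦ repairᶠ ⟧ x g (length x ∷ l ∷ [])
    repairᶠ-holds = n , s≤s n≤ , p , s≤s p≤ , k , s≤s k≤ , toℕ M.s₀ , Fin.toℕ<n M.s₀ ,
      headerᶠ-holds , edgesᶠ-holds , totalᶠ-holds , ownersᶠ-holds , subᶠ-holds , rootᶠ-holds , nodesᶠ-holds

modelRepair-definable : Definable ModelRepair
modelRepair-definable = record
  { formula  = RepairFormula.repairᶠ
  ; side     = 6 ∷ 1 ∷ []
  ; sound    = repair-sound
  ; complete = complete }
  where
  complete : ∀ x → ModelRepair x → Σ[ g ∈ Table ] Supported (eval (6 ∷ 1 ∷ []) (length x)) g ×
    ∀ l → ⟦ RepairFormula.repairᶠ ⟧ x g (length x ∷ l ∷ [])
  complete x (I , e , M′ , sub , M′-total , satisfied) =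
    g , subst (λ D → Supported (6 + D) g) (sym (eval-idₚ (length x))) supported , repairᶠ-holds
    where
    open Instance I
    open RepairComplete x M (λ {s} → total {s}) η (subst (λ w → Seg x 0 w (length x)) (sym e) (seg-self x)) M′ sub (λ {s} → M′-total {s}) satisfied

mainTheorem3 : NP-Complete ModelRepair
mainTheorem3 = definable⇒NP modelRepair-definable , λ 𝓚 𝓚∈NP → Reduction.reduction (NP⇒definable 𝓚∈NP)
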